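{- For a sequence ${\boldsymbol{\alpha}}=(\alpha_2,\alpha_3,\ldots)$ of nonnegative integers with finitely many nonzero entries, let $\widetilde{H}({\boldsymbol{\alpha}})$ be the number of equivalence classes of minimal factorizations of type ${\boldsymbol{\alpha}}$ of the cycle $(1\,2\ldots N)$ with $N=\langle{\boldsymbol{\alpha}}\rangle+1$, with the convention $\widetilde{H}(\boldsymbol{0})=1$. Then the formal power series \[\xi(\boldsymbol{x})=\sum_{{\boldsymbol{\alpha}}}\widetilde{H}({\boldsymbol{\alpha}})\,x_2^{\alpha_2}x_3^{\alpha_3}\cdots\] (sum over all such ${\boldsymbol{\alpha}}$) satisfies \[\xi(\boldsymbol{x})=1+x_2\xi(\boldsymbol{x})^3+x_3\xi(\boldsymbol{x})^5+\cdots=1+\sum_{j\ge2}x_j\,\xi(\boldsymbol{x})^{2j-1}.\] Moreover, for every $n\ge0$, \[\sum_{{\boldsymbol{\alpha}}:\,\langle{\boldsymbol{\alpha}}\rangle=n}(-1)^{|{\boldsymbol{\alpha}}|+n}\widetilde{H}({\boldsymbol{\alpha}})=\frac{1}{n+1}\binom{2n}{n},\] the $n$-th Catalan number.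
   Context: Permutations are composed from right to left. A factorization of the $N$-cycle $(1\,2\ldots N)$ is a sequence of cycles $\sigma_1,\ldots,\sigma_m\in S_N$, each of length at least $2$, with $\sigma_m\cdots\sigma_1=(1\,2\ldots N)$. It is of type ${\boldsymbol{\alpha}}$ if exactly $\alpha_j$ of the $\sigma_i$ are $j$-cycles for each $j\ge2$. Write $|{\boldsymbol{\alpha}}|=\sum_{j\ge2}\alpha_j$ and $\langle{\boldsymbol{\alpha}}\rangle=\sum_{j\ge2}(j-1)\alpha_j$; the factorization is minimal if $\langle{\boldsymbol{\alpha}}\rangle=N-1$. Two factorizations are equivalent if they differ only in the order of commuting factors, i.e. one is obtained from the other by repeatedly interchanging adjacent commuting factors. The generating functions are formal power series in the variables $x_2,x_3,\ldots$. -}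

module Defs where

open import Data.Nat using (ℕ; zero; suc; _+_; _*_; _∸_; _≤_; _/_)
open import Data.Nat.Properties using (_≟_)
open import Data.Nat.DivMod using (_mod_)
open import Data.Nat.Combinatorics using (_C_)
open import Data.Integer as ℤ using (ℤ; +_)
open import Data.Fin using (Fin; toℕ)
open import Data.Vec as Vec using (Vec)
open import Data.List as List using (List; []; _∷_; length; map; upTo; concatMap; zipWith; filter; foldr)
open import Data.Nat.ListAction using (sum)
open import Data.List.Relation.Binary.Pointwise using (Pointwise)
open import Data.List.Relation.Unary.All using (All)
open import Data.List.Relation.Binary.Pointwise using () renaming (Pointwise to All₂)
open import Data.Product using (Σ; ∃; _×_)
open import Data.Sum using (_⊎_)
open import Function using (_∘_; id)
open import Relation.Binary.PropositionalEquality using (_≡_; _≢_; _≗_)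
open import Relation.Binary.Construct.Closure.ReflexiveTransitive using (Star)
open import Relation.Nullary.Decidable using (⌊_⌋)
open import Data.Bool using (if_then_else_)

-- Types α = (α₂, α₃, …) with finite support are represented by lists:
-- the list a₀ ∷ a₁ ∷ … represents α with α_{i+2} = aᵢ, and αⱼ = 0
-- beyond the end of the list (so trailing zeros are irrelevant).

Ty : Set
Ty = List ℕ

coeff : Ty → ℕ → ℕ
coeff []      _       = 0
coeff (a ∷ _) zero    = a
coeff (_ ∷ r) (suc i) = coeff r i

size : Ty → ℕ
size = sum

-- ⟨α⟩ = Σ (j-1) αⱼ ;  the entry at list position i has j = i+2, so j-1 = i+1
weightFrom : ℕ → Ty → ℕ
weightFrom k []      = 0
weightFrom k (a ∷ r) = k * a + weightFrom (suc k) r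

weight : Ty → ℕ
weight = weightFrom 1

-- Permutations of {0,…,N-1} (point i stands for i+1), composed right to left.

Perm : ℕ → Set
Perm N = Fin N → Fin N

iter : ∀ {N} → ℕ → Perm N → Fin N → Fin N
iter zero    σ x = x
iter (suc k) σ x = σ (iter k σ x)

IsCycle : ∀ {N} → ℕ → Perm N → Set
IsCycle {N} j σ =
  Σ (Fin N) λ x →
    (iter j σ x ≡ x) ×
    (∀ (a b : Fin j) → iter (toℕ a) σ x ≡ iter (toℕ b) σ x → a ≡ b) ×
    (∀ y → (∀ (a : Fin j) → iter (toℕ a) σ x ≢ y) → σ y ≡ y)

longCycle : (N : ℕ) → Perm (suc N)
longCycle N i = suc (toℕ i) mod suc N

prod : ∀ {N} → List (Perm N) → Perm N
prod []       = id
prod (σ ∷ fs) = prod fs ∘ σ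

count : ℕ → List ℕ → ℕ
count j ls = length (filter (j ≟_) ls)

-- fs = [σ₁,…,σₘ] is a factorization of (1 2 … N) of type α,
-- with N = ⟨α⟩ + 1 (hence minimal); ls records the cycle lengths.
IsFact : (α : Ty) → List (Perm (suc (weight α))) → Set
IsFact α fs =
  Σ (List ℕ) λ ls →
    All₂ (λ j σ → (2 ≤ j) × IsCycle j σ) ls fs ×
    (prod fs ≗ longCycle (weight α)) ×
    (∀ i → count (suc (suc i)) ls ≡ coeff α i)

data Swap {N : ℕ} : List (Perm N) → List (Perm N) → Set where
  here  : ∀ {σ τ l} → (σ ∘ τ) ≗ (τ ∘ σ) → Swap (σ ∷ τ ∷ l) (τ ∷ σ ∷ l)
  there : ∀ {x l l'} → Swap l l' → Swap (x ∷ l) (x ∷ l')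

-- equivalence of factorizations: generated by the moves (and equality of
-- permutations, which is pointwise equality of functions)
Equiv : ∀ {N} → List (Perm N) → List (Perm N) → Set
Equiv = Star (λ l l' → Swap l l' ⊎ Pointwise _≗_ l l')

-- n is the number of equivalence classes of minimal factorizations of type α:
-- a system of n pairwise inequivalent representatives meeting every class.
ClassCount : Ty → ℕ → Set
ClassCount α n =
  Σ (Vec (List (Perm (suc (weight α)))) n) λ reps →
    (∀ i → IsFact α (Vec.lookup reps i)) ×
    (∀ i k → Equiv (Vec.lookup reps i) (Vec.lookup reps k) → i ≡ k) ×
    (∀ fs → IsFact α fs → ∃ λ i → Equiv fs (Vec.lookup reps i))

-- Formal power series in x₂, x₃, … as coefficient functions Ty → ℕ.

below : Ty → List Ty
below []      = [] ∷ []
below (a ∷ r) = concatMap (λ b → map (b ∷_) (below r)) (upTo (suc a))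

_⊖_ : Ty → Ty → Ty
α ⊖ β = zipWith _∸_ α β

allZero : Ty → ℕ
allZero []      = 1
allZero (a ∷ r) = if ⌊ a ≟ 0 ⌋ then allZero r else 0

one : Ty → ℕ
one = allZero

mul : (Ty → ℕ) → (Ty → ℕ) → Ty → ℕ
mul f g α = sum (map (λ β → f β * g (α ⊖ β)) (below α))

pow : (Ty → ℕ) → ℕ → Ty → ℕ
pow f zero    = one
pow f (suc k) = mul f (pow f k)

decAt : ℕ → Ty → Ty
decAt i       []      = []
decAt zero    (a ∷ r) = (a ∸ 1) ∷ r
decAt (suc i) (a ∷ r) = a ∷ decAt i r

timesVar : ℕ → (Ty → ℕ) → Ty → ℕ
timesVar i F α with coeff α i
... | zero  = 0
... | suc _ = F (decAt i α)

-- coefficient of x^α in  1 + Σ_{j≥2} x_j ξ^{2j-1}  (with j = i+2, 2j-1 = 2i+3);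
-- only j with α_j ≥ 1 contribute, and those have i < length α.
rhsCoeff : (Ty → ℕ) → Ty → ℕ
rhsCoeff ξ α = one α + sum (map (λ i → timesVar i (pow ξ (2 * i + 3)) α) (upTo (length α)))

-- All types α with ⟨α⟩ = n, each listed once (as lists of length n; for
-- ⟨α⟩ = n only α₂,…,α_{n+1} can be nonzero, and each is ≤ n).

boxes : ℕ → ℕ → List Ty
boxes zero    b = [] ∷ []
boxes (suc k) b = concatMap (λ a → map (a ∷_) (boxes k b)) (upTo (suc b))

typesOfWeight : ℕ → List Ty
typesOfWeight n = filter (λ α → weight α ≟ n) (boxes n n)

altSum : (Ty → ℕ) → ℕ → ℤ
altSum H n = foldr ℤ._+_ (+ 0) (map (λ α → (ℤ.- (+ 1)) ℤ.^ (size α + n) ℤ.* (+ H α)) (typesOfWeight n))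

catalan : ℕ → ℕ
catalan n = ((2 * n) C n) / suc n

{-# OPTIONS --safe #-}

-- A class of minimal factorizations of (1 2 … N) is a plane cactus: the
-- factors are polygons on the N points, glued in a tree-like way.  Rooting it
-- at the first point and removing the first polygon at the root, a j-gon,
-- leaves 2j − 1 rooted cacti: at each of the other j − 1 vertices one made of
-- the factors applied before the polygon and one of those applied after it,
-- and one more at the root.  This is the equation for ξ.
--
-- Every factorization comes from a cactus: adding the factors from the last
-- to the first, each of them must join distinct components, since otherwise
-- a total degree smaller than N − 1 would connect N points; and a cactus can be
-- re-rooted at any vertex by exchanging disjoint factors only.  The product of a
-- cactus is the cycle through its contour word, so the word is 1, 2, …, N.
-- Distinct cacti are inequivalent: two of the factors sharing a point never
-- commute, so the sequence of factors moving a given point is an invariant,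
-- and these sequences unfold to the cactus from the root down.
--
-- With signs, and t marking weight, the equation becomes
-- A = 1 + Σ (−1)ⁱ tⁱ⁺¹ A²ⁱ⁺³, hence Σ (−1)ⁱ tⁱ A²ⁱ⁺¹ = 1 and A = 1 + t A².
-- The coefficients of the powers of A are then ballot numbers.

module Submission where

open import Defs
open import Data.Nat using (ℕ; zero; suc; _+_; _*_; _∸_; _/_; _≤_; _<_; s≤s; z≤n; pred)
import Data.Nat.Properties as ℕ
open import Data.Nat.DivMod using (_mod_; _%_; m<n⇒m%n≡m; n%n≡0; m*n/n≡m)
open import Data.Nat.ListAction using (sum)
open import Data.Nat.ListAction.Properties using (sum-++; sum-↭)
open import Data.Nat.Tactic.RingSolver using (solve-∀)
open import Data.Integer as ℤ using (ℤ) renaming (+_ to pos)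
import Data.Integer.Properties as ℤ
import Data.Integer.Tactic.RingSolver as ℤSolver
open import Data.Fin using (Fin; zero; suc; toℕ; punchOut; punchIn)
import Data.Fin.Properties as Fin
open import Data.List.Membership.DecPropositional using (_∈?_)
open import Data.List using (List; []; _∷_; [_]; _++_; map; concatMap; length; allFin; tabulate; filter; lookup; upTo; replicate; foldr; cartesianProductWith)
open import Data.List.Properties using (++-assoc; ++-identityʳ; map-++; length-++; length-tabulate; map-id-local; filter-++; filter-none; filter-accept; filter-reject; ∷-injective; ∷-injectiveˡ; ∷-injectiveʳ; ++-conicalʳ; length-map; length-replicate; map-cong)
open import Data.List.Membership.Propositional using (_∈_; _∉_)
open import Data.List.Membership.Propositional.Properties using (∈-++⁻; ∈-++⁺ˡ; ∈-++⁺ʳ; ∈-allFin; ∈-tabulate⁺; ∈-tabulate⁻; ∈-lookup; ∈-∃++; ∈-filter⁺; ∈-filter⁻; ∈-map⁺; ∈-map⁻; ∈-upTo⁺; ∈-upTo⁻;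
    ∈-cartesianProductWith⁺; ∈-cartesianProductWith⁻)
open import Data.List.Membership.Propositional.Properties.WithK using (unique∧set⇒bag)
open import Data.List.Relation.Binary.BagAndSetEquality using (∼bag⇒↭)
open import Data.List.Relation.Unary.Any using (here; there; index)
open import Data.List.Relation.Unary.Any.Properties using (lookup-index)
open import Data.List.Relation.Unary.All as All using (All; []; _∷_)
import Data.List.Relation.Unary.All.Properties as All
import Data.List.Relation.Unary.AllPairs.Properties as AllPairs
import Data.List.Relation.Unary.Unique.Propositional.Properties as Unique
import Data.List.Relation.Unary.AllPairs as AllPairs′
open import Data.List.Relation.Unary.AllPairs using (AllPairs; []; _∷_)
open import Data.List.Relation.Unary.Unique.Propositional using (Unique)
open import Data.List.Relation.Unary.Unique.Propositional.Properties using (Unique[x∷xs]⇒x∉xs; allFin⁺; tabulate⁺)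
open import Data.List.Relation.Binary.Disjoint.Propositional using (Disjoint)
open import Data.List.Relation.Binary.Pointwise as Pointwise using (Pointwise; []; _∷_)
open import Data.List.Relation.Binary.Permutation.Propositional as Perm
  using (_↭_; ↭-refl; ↭-sym; ↭-trans; ↭-prep; ↭-swap; ↭-reflexive)
open import Data.List.Relation.Binary.Permutation.Propositional.Properties
  using (++-comm; ++⁺; ++⁺ˡ; map⁺; ∈-resp-↭; ++-commutativeMonoid; ↭-length; filter-↭; All-resp-↭)
import Data.List.Relation.Binary.Permutation.Setoid.Properties as PermSetoid
import Algebra.Solver.CommutativeMonoid as CMSolver
import Data.Vec as Vec
open import Data.Product using (∃; ∃₂; _×_; _,_; proj₁; proj₂)
open import Data.Sum using (_⊎_; inj₁; inj₂)
open import Data.Unit using (⊤; tt)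
open import Data.Empty using (⊥; ⊥-elim)
open import Function using (_∘_; id; mk⇔)
open import Relation.Nullary using (¬_; Dec; yes; no)
open import Relation.Nullary.Decidable using (¬?; decidable-stable)
open import Relation.Binary.PropositionalEquality hiding ([_])
open import Relation.Binary.Construct.Closure.ReflexiveTransitive as Star using (Star; ε; _◅_; _◅◅_)

-- A factorization is a list, its class is a planar object, and a new factor may meet an old part at
-- any vertex. The order from last to first resolves this: everything already placed is applied
-- after the new polygon, so each part that the polygon touches becomes, once re-rooted at the point
-- of contact, the `A` of a branch in one piece. The part at the base point of the polygon stays at
-- the root, behind it. Connectivity is expressed by labellings of the points that are constant on
-- every factor. A list of total degree d admits a surjective one with at least N - d labels,
-- whereas factors whose product is the long cycle admit only constant ones. Since the contour word
-- is forced, a class is known from the bare shape of its cactus, so the given class numbers are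
-- lengths of lists of unlabelled trees. Both halves of the theorem then use the same decomposition
-- `code`: once graded by type, and once with signs and graded by weight alone.

private
  variable
    V : Set
    N k : ℕ

-- Rooted cacti

Unique-↭ : {xs ys : List V} → xs ↭ ys → Unique xs → Unique ys
Unique-↭ {V} p = PermSetoid.Unique-resp-↭ (setoid V) (Perm.↭⇒↭ₛ p)

Unique-++⁻ : ∀ (xs : List V) {ys} → Unique (xs ++ ys) → Unique xs × Unique ys × Disjoint xs ys
Unique-++⁻ []       u       = [] , u , λ ()
Unique-++⁻ (x ∷ xs) (p ∷ u) with Unique-++⁻ xs u
... | ux , uy , d = All.++⁻ˡ xs p ∷ ux , uy , λ where
  (here refl , q) → All.lookup (All.++⁻ʳ xs p) q refl
  (there p , q)   → d (p , q)

disjointParts : ∀ {zs} (xs ys : List V) {rs} → Unique zs → zs ↭ xs ++ (ys ++ rs) → Disjoint xs ys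
disjointParts xs ys u p (x∈ , y∈) = proj₂ (proj₂ (Unique-++⁻ xs (Unique-↭ p u))) (x∈ , ∈-++⁺ˡ y∈)

uniquePart : ∀ {zs} (xs : List V) {rs} → Unique zs → zs ↭ xs ++ rs → Unique xs
uniquePart xs u p = proj₁ (Unique-++⁻ xs (Unique-↭ p u))

-- A rooted cactus with vertices labelled in V, the root label being kept
-- outside.  In node b C the polygon through the root and the vertices of b is
-- the first one at the root, and C carries the later ones.  In branch A v B b
-- the polygons at the vertex v form B if applied before that polygon and A if
-- applied after it.
data Tree (V : Set) : Set
data Branches (V : Set) : Set

data Tree V where
  leaf : Tree V
  node : Branches V → Tree V → Tree V

data Branches V where
  none   : Branches V
  branch : Tree V → V → Tree V → Branches V → Branches V

-- The pair of `r` and `vs` codes the cycle through `r` and then `vs`. The base point is a choice,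
-- so a cycle has several codes; `rotate` below relates them.
Edge : Set → Set
Edge V = V × List V

support : Edge V → List V
support (r , vs) = r ∷ vs

verts : Branches V → List V
verts none             = []
verts (branch A v B b) = v ∷ verts b

-- The contour without the root. The `A` part stands before `v` because its factors are applied
-- after the polygon: a point sent to `v` by the polygon is at once sent on into `A`. The `B` part
-- is entered from `v` itself.
word  : Tree V → List V
wordB : Branches V → List V
word leaf       = []
word (node b C) = wordB b ++ word C
wordB none             = []
wordB (branch A v B b) = word A ++ v ∷ word B ++ wordB b

-- In order of application. Parts hanging at different vertices are disjoint, so collecting all `B`
-- parts before the polygon and all `A` parts after it fixes one list out of an equivalence class.
factors : V → Tree V → List (Edge V)
before  : Branches V → List (Edge V)
after   : Branches V → List (Edge V)
factors r leaf       = []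
factors r (node b C) = before b ++ (r , verts b) ∷ after b ++ factors r C
before none             = []
before (branch A v B b) = factors v B ++ before b
after none             = []
after (branch A v B b) = factors v A ++ after b

infixr 5 _⊕_ _⊞_

_⊕_ : Tree V → Tree V → Tree V
leaf     ⊕ t = t
node b C ⊕ t = node b (C ⊕ t)

_⊞_ : Branches V → Branches V → Branches V
none           ⊞ c = c
branch A v B b ⊞ c = branch A v B (b ⊞ c)

⊕-assoc : ∀ (s t u : Tree V) → (s ⊕ t) ⊕ u ≡ s ⊕ (t ⊕ u)
⊕-assoc leaf       t u = refl
⊕-assoc (node b C) t u = cong (node b) (⊕-assoc C t u)

⊕-leaf : ∀ (t : Tree V) → t ⊕ leaf ≡ t
⊕-leaf leaf       = refl
⊕-leaf (node b C) = cong (node b) (⊕-leaf C)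

⊞-assoc : ∀ (a b c : Branches V) → (a ⊞ b) ⊞ c ≡ a ⊞ (b ⊞ c)
⊞-assoc none             b c = refl
⊞-assoc (branch A v B a) b c = cong (branch A v B) (⊞-assoc a b c)

word-⊕ : ∀ (s t : Tree V) → word (s ⊕ t) ≡ word s ++ word t
word-⊕ leaf       t = refl
word-⊕ (node b C) t = trans (cong (wordB b ++_) (word-⊕ C t)) (sym (++-assoc (wordB b) _ _))

factors-⊕ : ∀ (r : V) s t → factors r (s ⊕ t) ≡ factors r s ++ factors r t
factors-⊕ r leaf       t = refl
factors-⊕ r (node b C) t = trans
  (cong (λ z → before b ++ (r , verts b) ∷ z)
    (trans (cong (after b ++_) (factors-⊕ r C t)) (sym (++-assoc (after b) _ _))))
  (sym (++-assoc (before b) _ _))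

verts-⊞ : ∀ (a b : Branches V) → verts (a ⊞ b) ≡ verts a ++ verts b
verts-⊞ none             b = refl
verts-⊞ (branch A v B a) b = cong (v ∷_) (verts-⊞ a b)

wordB-⊞ : ∀ (a b : Branches V) → wordB (a ⊞ b) ≡ wordB a ++ wordB b
wordB-⊞ none             b = refl
wordB-⊞ (branch A v B a) b = trans
  (cong (λ z → word A ++ v ∷ z)
    (trans (cong (word B ++_) (wordB-⊞ a b)) (sym (++-assoc (word B) _ _))))
  (sym (++-assoc (word A) _ _))

before-⊞ : ∀ (a b : Branches V) → before (a ⊞ b) ≡ before a ++ before b
before-⊞ none             b = refl
before-⊞ (branch A v B a) b =
  trans (cong (factors v B ++_) (before-⊞ a b)) (sym (++-assoc (factors v B) _ _))

after-⊞ : ∀ (a b : Branches V) → after (a ⊞ b) ≡ after a ++ after b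
after-⊞ none             b = refl
after-⊞ (branch A v B a) b =
  trans (cong (factors v A ++_) (after-⊞ a b)) (sym (++-assoc (factors v A) _ _))

verts⊆wordB : ∀ (b : Branches V) {x} → x ∈ verts b → x ∈ wordB b
verts⊆wordB (branch A v B b) (here refl) = ∈-++⁺ʳ (word A) (here refl)
verts⊆wordB (branch A v B b) (there p)   =
  ∈-++⁺ʳ (word A) (there (∈-++⁺ʳ (word B) (verts⊆wordB b p)))

verts-unique : ∀ (b : Branches V) → Unique (wordB b) → Unique (verts b)
verts-unique none             u = []
verts-unique (branch A v B b) u with proj₁ (proj₂ (Unique-++⁻ (word A) u))
... | p ∷ u′ = All.tabulate (λ x∈ → All.lookup p (∈-++⁺ʳ (word B) (verts⊆wordB b x∈)))
             ∷ verts-unique b (proj₁ (proj₂ (Unique-++⁻ (word B) u′)))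

root-unique : ∀ (r : V) b {ws} → Unique (r ∷ wordB b ++ ws) → Unique (r ∷ verts b)
root-unique r b (p ∷ u) = All.tabulate (λ x∈ → All.lookup p (∈-++⁺ˡ (verts⊆wordB b x∈)))
                        ∷ verts-unique b (proj₁ (Unique-++⁻ (wordB b) u))

Within : List V → List (Edge V) → Set
Within X es = All (λ e → ∀ {x} → x ∈ support e → x ∈ X) es

Within-⊆ : ∀ {X Y : List V} {es} → (∀ {x} → x ∈ X → x ∈ Y) → Within X es → Within Y es
Within-⊆ s = All.map (λ f {x} p → s (f p))

Within-++ : ∀ (X : List V) {Y es fs} → Within X es → Within Y fs → Within (X ++ Y) (es ++ fs)
Within-++ X p q = All.++⁺ (Within-⊆ ∈-++⁺ˡ p) (Within-⊆ (∈-++⁺ʳ X) q)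

factors-within : ∀ (r : V) T → Within (r ∷ word T) (factors r T)
before-within : ∀ (b : Branches V) → Within (wordB b) (before b)
after-within : ∀ (b : Branches V) → Within (wordB b) (after b)
factors-within r leaf       = []
factors-within r (node b C) = All.++⁺ (Within-⊆ (λ p → there (∈-++⁺ˡ p)) (before-within b))
  ((λ { (here refl) → here refl ; (there p) → there (∈-++⁺ˡ (verts⊆wordB b p)) })
   ∷ All.++⁺ (Within-⊆ (λ p → there (∈-++⁺ˡ p)) (after-within b))
     (Within-⊆ (λ { (here refl) → here refl ; (there p) → there (∈-++⁺ʳ (wordB b) p) })
       (factors-within r C)))
before-within none             = []
before-within (branch A v B b) = Within-⊆ (∈-++⁺ʳ (word A))
  (Within-++ (v ∷ word B) (factors-within v B) (before-within b))
after-within none             = []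
after-within (branch A v B b) = All.++⁺
  (Within-⊆ (λ { (here refl) → ∈-++⁺ʳ (word A) (here refl) ; (there p) → ∈-++⁺ˡ p }) (factors-within v A))
  (Within-⊆ (λ p → ∈-++⁺ʳ (word A) (there (∈-++⁺ʳ (word B) p))) (after-within b))

-- Commutation of disjoint factors, and re-rooting

infix 4 _≈_ _⇝_

-- Equivalence at the level of codes. `rotate` changes the base point only; for distinct vertices
-- the permutation stays the same.
data _≈_ {V : Set} : List (Edge V) → List (Edge V) → Set where
  ≈refl  : ∀ {es} → es ≈ es
  ≈trans : ∀ {es fs gs} → es ≈ fs → fs ≈ gs → es ≈ gs
  prep   : ∀ e {es fs} → es ≈ fs → e ∷ es ≈ e ∷ fs
  swap   : ∀ {e f es} → Disjoint (support e) (support f) → e ∷ f ∷ es ≈ f ∷ e ∷ es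
  rotate : ∀ {r xs v ys es} → Unique (r ∷ xs ++ v ∷ ys) →
           (r , xs ++ v ∷ ys) ∷ es ≈ (v , ys ++ r ∷ xs) ∷ es

≡⇒≈ : ∀ {es fs : List (Edge V)} → es ≡ fs → es ≈ fs
≡⇒≈ refl = ≈refl

++-≈ˡ : ∀ {es fs : List (Edge V)} gs → es ≈ fs → es ++ gs ≈ fs ++ gs
++-≈ˡ gs ≈refl        = ≈refl
++-≈ˡ gs (≈trans p q) = ≈trans (++-≈ˡ gs p) (++-≈ˡ gs q)
++-≈ˡ gs (prep e p)   = prep e (++-≈ˡ gs p)
++-≈ˡ gs (swap d)     = swap d
++-≈ˡ gs (rotate u)   = rotate u

++-≈ʳ : ∀ {es fs : List (Edge V)} gs → es ≈ fs → gs ++ es ≈ gs ++ fs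
++-≈ʳ []       p = p
++-≈ʳ (g ∷ gs) p = prep g (++-≈ʳ gs p)

block-swap : ∀ {X Y : List V} {es fs} gs → Within X es → Within Y fs → Disjoint X Y →
             es ++ fs ++ gs ≈ fs ++ es ++ gs
block-swap gs []       q d = ≈refl
block-swap {X = X} {Y} {e ∷ es} {fs} gs (p ∷ ps) q d =
  ≈trans (prep e (block-swap gs ps q d)) (single q)
  where
  single : ∀ {fs} → Within Y fs → e ∷ fs ++ es ++ gs ≈ fs ++ e ∷ es ++ gs
  single []               = ≈refl
  single {f ∷ fs} (q ∷ w) =
    ≈trans (swap (λ { (x∈e , x∈f) → d (p x∈e , q x∈f) })) (prep f (single w))

System : Set → Set
System V = List V × List (Edge V)

-- Distinctness is a premise of the second component, so steps can be composed freely and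
-- distinctness supplied once at the end.
_⇝_ : System V → System V → Set
(X , es) ⇝ (Y , fs) = X ↭ Y × (Unique X → es ≈ fs)

⇝-trans : {s t u : System V} → s ⇝ t → t ⇝ u → s ⇝ u
⇝-trans (p , f) (q , g) = ↭-trans p q , λ u → ≈trans (f u) (g (Unique-↭ p u))

rooted : V → Tree V → System V
rooted r T = r ∷ word T , factors r T

module _ {V : Set} where
  open CMSolver (++-commutativeMonoid {A = V}) hiding (_⊕_)
  open CMSolver (++-commutativeMonoid {A = V}) using () renaming (_⊕_ to _∙_)

  -- Re-rooting across one polygon. Read cyclically from `v`, it shows `bR`, then `r`, then `bL`. At
  -- `v` the parts `B` and `A` become what precedes and follows the polygon at the root; at `r` the
  -- parts `pre` and `C` become the two sides of a branch. On each side of the polygon this only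
  -- exchanges two disjoint blocks of factors.
  move : ∀ r pre bL (A : Tree V) v B bR C →
    rooted r (pre ⊕ node (bL ⊞ branch A v B bR) C) ⇝ rooted v (B ⊕ node (bR ⊞ branch C r pre bL) A)
  move r pre bL A v B bR C = perm , fac
    where
    wordL : r ∷ word (pre ⊕ node (bL ⊞ branch A v B bR) C)
          ≡ [ r ] ++ (word pre ++ ((wordB bL ++ (word A ++ ([ v ] ++ (word B ++ wordB bR)))) ++ word C))
    wordL = cong (r ∷_) (trans (word-⊕ pre _)
      (cong (λ z → word pre ++ (z ++ word C)) (wordB-⊞ bL (branch A v B bR))))

    wordR : v ∷ word (B ⊕ node (bR ⊞ branch C r pre bL) A)
          ≡ [ v ] ++ (word B ++ ((wordB bR ++ (word C ++ ([ r ] ++ (word pre ++ wordB bL)))) ++ word A))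
    wordR = cong (v ∷_) (trans (word-⊕ B _)
      (cong (λ z → word B ++ (z ++ word A)) (wordB-⊞ bR (branch C r pre bL))))

    perm : r ∷ word (pre ⊕ node (bL ⊞ branch A v B bR) C) ↭ v ∷ word (B ⊕ node (bR ⊞ branch C r pre bL) A)
    perm = ↭-trans (↭-reflexive wordL) (↭-trans
      (solve 8 (λ r p l a v b q c → (r ∙ (p ∙ ((l ∙ (a ∙ (v ∙ (b ∙ q)))) ∙ c)))
                                 ⊜ (v ∙ (b ∙ ((q ∙ (c ∙ (r ∙ (p ∙ l)))) ∙ a))))
        ↭-refl [ r ] (word pre) (wordB bL) (word A) [ v ] (word B) (wordB bR) (word C))
      (↭-reflexive (sym wordR)))

    facL : factors r (pre ⊕ node (bL ⊞ branch A v B bR) C)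
         ≡ factors r pre ++ (before bL ++ (factors v B ++ before bR))
           ++ (r , verts bL ++ v ∷ verts bR) ∷ (after bL ++ (factors v A ++ after bR)) ++ factors r C
    facL rewrite factors-⊕ r pre (node (bL ⊞ branch A v B bR) C)
               | before-⊞ bL (branch A v B bR) | verts-⊞ bL (branch A v B bR)
               | after-⊞ bL (branch A v B bR) = refl

    facR : factors v (B ⊕ node (bR ⊞ branch C r pre bL) A)
         ≡ factors v B ++ (before bR ++ (factors r pre ++ before bL))
           ++ (v , verts bR ++ r ∷ verts bL) ∷ (after bR ++ (factors r C ++ after bL)) ++ factors v A
    facR rewrite factors-⊕ v B (node (bR ⊞ branch C r pre bL) A)
               | before-⊞ bR (branch C r pre bL) | verts-⊞ bR (branch C r pre bL)
               | after-⊞ bR (branch C r pre bL) = refl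

    module _ (u : Unique (r ∷ word (pre ⊕ node (bL ⊞ branch A v B bR) C))) where
      u′ : Unique ([ r ] ++ (word pre ++ ((wordB bL ++ (word A ++ ([ v ] ++ (word B ++ wordB bR)))) ++ word C)))
      u′ = subst Unique wordL u

      dis₁ : Disjoint ((r ∷ word pre) ++ wordB bL) ((v ∷ word B) ++ wordB bR)
      dis₁ = disjointParts _ _ u′
        (solve 8 (λ r p l a v b q c → (r ∙ (p ∙ ((l ∙ (a ∙ (v ∙ (b ∙ q)))) ∙ c)))
                                   ⊜ (((r ∙ p) ∙ l) ∙ (((v ∙ b) ∙ q) ∙ (a ∙ c))))
        ↭-refl [ r ] (word pre) (wordB bL) (word A) [ v ] (word B) (wordB bR) (word C))

      dis₂ : Disjoint (wordB bL ++ (v ∷ word A)) (wordB bR ++ (r ∷ word C))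
      dis₂ = disjointParts _ _ u′
        (solve 8 (λ r p l a v b q c → (r ∙ (p ∙ ((l ∙ (a ∙ (v ∙ (b ∙ q)))) ∙ c)))
                                   ⊜ ((l ∙ (v ∙ a)) ∙ ((q ∙ (r ∙ c)) ∙ (p ∙ b))))
        ↭-refl [ r ] (word pre) (wordB bL) (word A) [ v ] (word B) (wordB bR) (word C))

      uniqueRoot : Unique (r ∷ verts bL ++ v ∷ verts bR)
      uniqueRoot = subst (λ z → Unique (r ∷ z)) (verts-⊞ bL (branch A v B bR))
        (root-unique r (bL ⊞ branch A v B bR) (subst Unique
          (cong (λ z → r ∷ z ++ (word C ++ word pre)) (sym (wordB-⊞ bL (branch A v B bR))))
          (Unique-↭ (solve 8 (λ r p l a v b q c → (r ∙ (p ∙ ((l ∙ (a ∙ (v ∙ (b ∙ q)))) ∙ c)))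
                                               ⊜ (r ∙ ((l ∙ (a ∙ (v ∙ (b ∙ q)))) ∙ (c ∙ p))))
            ↭-refl [ r ] (word pre) (wordB bL) (word A) [ v ] (word B) (wordB bR) (word C)) u′)))

      assoc₄ : ∀ {X : Set} (a b c d : List X) {e} → a ++ (b ++ (c ++ d)) ++ e ≡ (a ++ b) ++ (c ++ d) ++ e
      assoc₄ a b c d = trans (cong (a ++_) (++-assoc b (c ++ d) _)) (sym (++-assoc a b _))

      assoc₃ : ∀ {X : Set} (a b c d : List X) → (a ++ (b ++ c)) ++ d ≡ (a ++ b) ++ (c ++ d) ++ []
      assoc₃ a b c d = trans (cong (_++ d) (sym (++-assoc a b c)))
        (trans (++-assoc (a ++ b) c d) (cong ((a ++ b) ++_) (sym (++-identityʳ (c ++ d)))))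

      assoc₅ : ∀ {X : Set} (a b c d : List X) {e} → (c ++ d) ++ (a ++ b) ++ e ≡ c ++ (d ++ (a ++ b)) ++ e
      assoc₅ a b c d = trans (++-assoc c d _) (cong (c ++_) (sym (++-assoc d (a ++ b) _)))

      fac : factors r (pre ⊕ node (bL ⊞ branch A v B bR) C) ≈ factors v (B ⊕ node (bR ⊞ branch C r pre bL) A)
      fac = ≈trans (≡⇒≈ (trans facL (assoc₄ (factors r pre) (before bL) (factors v B) (before bR))))
        (≈trans (block-swap _
          (Within-++ (r ∷ word pre) (factors-within r pre) (before-within bL))
          (Within-++ (v ∷ word B) (factors-within v B) (before-within bR)) dis₁)
        (≈trans (≡⇒≈ (assoc₅ (factors r pre) (before bL) (factors v B) (before bR)))
        (≈trans (++-≈ʳ (factors v B) (++-≈ʳ (before bR ++ factors r pre ++ before bL)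
          (≈trans (rotate uniqueRoot) (prep _
            (≈trans (≡⇒≈ (assoc₃ (after bL) (factors v A) (after bR) (factors r C)))
            (≈trans (block-swap []
              (Within-++ (wordB bL) (after-within bL) (factors-within v A))
              (Within-++ (wordB bR) (after-within bR) (factors-within r C)) dis₂)
              (≡⇒≈ (sym (assoc₃ (after bR) (factors r C) (after bL) (factors v A))))))))))
        (≡⇒≈ (sym facR)))))

  relabel : ∀ {r} {T T′ : Tree V} {s} → T ≡ T′ → rooted r T ⇝ s → rooted r T′ ⇝ s
  relabel refl p = p

  -- The recursion descends into `T`, and `pre` and `post` hold the rest of the cactus. Each `move`
  -- pushes the polygon just crossed into these accumulators, so the recursion is structural
  -- although the cactus as a whole never shrinks.
  reroot  : ∀ r pre (T : Tree V) post {x} → x ∈ word T →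
            ∃ λ T′ → rooted r (pre ⊕ (T ⊕ post)) ⇝ rooted x T′
  rerootB : ∀ r pre bL (b : Branches V) C {x} → x ∈ wordB b →
            ∃ λ T′ → rooted r (pre ⊕ node (bL ⊞ b) C) ⇝ rooted x T′
  reroot r pre (node b C) post x∈ with ∈-++⁻ (wordB b) x∈
  ... | inj₁ p = rerootB r pre none b (C ⊕ post) p
  ... | inj₂ p with reroot r (pre ⊕ node b leaf) C post p
  ...   | T′ , q = T′ , relabel (⊕-assoc pre _ _) q
  rerootB r pre bL (branch A v B bR) C x∈ with ∈-++⁻ (word A) x∈
  ... | inj₁ p with reroot v (B ⊕ node (bR ⊞ branch C r pre bL) leaf) A leaf p
  ...   | T′ , q = T′ , ⇝-trans (move r pre bL A v B bR C)
                   (relabel (trans (⊕-assoc B _ _) (cong (λ z → B ⊕ node (bR ⊞ branch C r pre bL) z) (⊕-leaf A))) q)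
  rerootB r pre bL (branch A v B bR) C x∈ | inj₂ (here refl) = B ⊕ node (bR ⊞ branch C r pre bL) A , move r pre bL A v B bR C
  rerootB r pre bL (branch A v B bR) C x∈ | inj₂ (there p) with ∈-++⁻ (word B) p
  ... | inj₁ p′ with reroot v leaf B (node (bR ⊞ branch C r pre bL) A) p′
  ...   | T′ , q = T′ , ⇝-trans (move r pre bL A v B bR C) q
  -- The target lies further along the same polygon: the root stays, and the branch at `v` joins
  -- those already passed.
  rerootB r pre bL (branch A v B bR) C x∈ | inj₂ (there p) | inj₂ p′
    with rerootB r pre (bL ⊞ branch A v B none) bR C p′
  ... | T′ , q = T′ , relabel (cong (λ z → pre ⊕ node z C) (⊞-assoc bL _ _)) q

  reroot′ : ∀ r (T : Tree V) {x} → x ∈ r ∷ word T → ∃ λ T′ → rooted r T ⇝ rooted x T′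
  reroot′ r T (here refl) = T , ↭-refl , λ _ → ≈refl
  reroot′ r T (there p) with reroot r leaf T leaf p
  ... | T′ , q = T′ , relabel (⊕-leaf T) q

-- Cycles as products of transpositions

transposition : Fin N → Fin N → Perm N
transposition a b x with x Fin.≟ a
... | yes _ = b
... | no  _ with x Fin.≟ b
...   | yes _ = a
...   | no  _ = x

transposition-left : ∀ (a b : Fin N) → transposition a b a ≡ b
transposition-left a b with a Fin.≟ a
... | yes _ = refl
... | no ¬p = ⊥-elim (¬p refl)

transposition-right : ∀ (a b : Fin N) → transposition a b b ≡ a
transposition-right a b with b Fin.≟ a
... | yes p = p
... | no _ with b Fin.≟ b
...   | yes _ = refl
...   | no ¬p = ⊥-elim (¬p refl)

transposition-fix : ∀ {a b x : Fin N} → x ≢ a → x ≢ b → transposition a b x ≡ x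
transposition-fix {a = a} {b} {x} x≢a x≢b with x Fin.≟ a
... | yes p = ⊥-elim (x≢a p)
... | no _ with x Fin.≟ b
...   | yes p = ⊥-elim (x≢b p)
...   | no _  = refl

Inj : Perm N → Set
Inj σ = ∀ {x y} → σ x ≡ σ y → x ≡ y

data Position (a b x : Fin N) : Set where
  left  : x ≡ a → Position a b x
  right : x ≡ b → Position a b x
  off   : x ≢ a → x ≢ b → Position a b x

position : ∀ (a b x : Fin N) → Position a b x
position a b x with x Fin.≟ a | x Fin.≟ b
... | yes p | _     = left p
... | no _  | yes q = right q
... | no p  | no q  = off p q

transposition-natural : ∀ {σ : Perm N} → Inj σ → ∀ a b x →
  σ (transposition a b x) ≡ transposition (σ a) (σ b) (σ x)
transposition-natural {σ = σ} inj a b x with position a b x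
... | left refl   = trans (cong σ (transposition-left a b)) (sym (transposition-left (σ a) (σ b)))
... | right refl  = trans (cong σ (transposition-right a b)) (sym (transposition-right (σ a) (σ b)))
... | off x≢a x≢b = trans (cong σ (transposition-fix x≢a x≢b))
                      (sym (transposition-fix (x≢a ∘ inj) (x≢b ∘ inj)))

transposition-sym : ∀ (a b x : Fin N) → transposition a b x ≡ transposition b a x
transposition-sym a b x with position a b x
... | left refl   = trans (transposition-left a b) (sym (transposition-right b a))
... | right refl  = trans (transposition-right a b) (sym (transposition-left b a))
... | off x≢a x≢b = trans (transposition-fix x≢a x≢b) (sym (transposition-fix x≢b x≢a))

transposition-involutive : ∀ (a b x : Fin N) → transposition a b (transposition a b x) ≡ x
transposition-involutive a b x with position a b x
... | left refl   = trans (cong (transposition a b) (transposition-left a b)) (transposition-right a b)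
... | right refl  = trans (cong (transposition a b) (transposition-right a b)) (transposition-left a b)
... | off x≢a x≢b = trans (cong (transposition a b) (transposition-fix x≢a x≢b)) (transposition-fix x≢a x≢b)

transposition-injective : ∀ (a b : Fin N) → Inj (transposition a b)
transposition-injective a b {x} {y} e =
  trans (sym (transposition-involutive a b x))
    (trans (cong (transposition a b) e) (transposition-involutive a b y))

-- The transposition with the first entry acts first. It sends `r` to that entry, and every entry
-- goes through `r` to the next one; for distinct entries this is the cycle through `r` and then the
-- list.
cycle : Fin N → List (Fin N) → Perm N
cycle r []       x = x
cycle r (w ∷ ws) x = cycle r ws (transposition r w x)

perm : Edge (Fin N) → Perm N
perm (r , ws) = cycle r ws

cycle-injective : ∀ (r : Fin N) ws → Inj (cycle r ws)
cycle-injective r []       e = e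
cycle-injective r (w ∷ ws) e = transposition-injective r w (cycle-injective r ws e)

-- Conjugation by `σ`, one transposition at a time. Commutation of disjoint cycles and change of
-- base point both come from it.
cycle-natural : ∀ {σ : Perm N} → Inj σ → ∀ r ws x → σ (cycle r ws x) ≡ cycle (σ r) (map σ ws) (σ x)
cycle-natural inj r []       x = refl
cycle-natural {σ = σ} inj r (w ∷ ws) x = trans (cycle-natural inj r ws _)
  (cong (cycle (σ r) (map σ ws)) (transposition-natural inj r w x))

cycle-++ : ∀ (r : Fin N) xs ys x → cycle r (xs ++ ys) x ≡ cycle r ys (cycle r xs x)
cycle-++ r []       ys x = refl
cycle-++ r (w ∷ xs) ys x = cycle-++ r xs ys _

cycle-fix : ∀ {r : Fin N} ws {x} → x ∉ r ∷ ws → cycle r ws x ≡ x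
cycle-fix []       x∉ = refl
cycle-fix {r = r} (w ∷ ws) x∉ = trans
  (cong (cycle r ws) (transposition-fix (λ p → x∉ (here p)) (λ p → x∉ (there (here p)))))
  (cycle-fix ws λ { (here p) → x∉ (here p) ; (there p) → x∉ (there (there p)) })

-- Conjugating the second cycle by the first changes nothing, since the first fixes every point of
-- the second.
cycle-comm : ∀ {r : Fin N} {ws s zs} → Disjoint (r ∷ ws) (s ∷ zs) →
  cycle r ws ∘ cycle s zs ≗ cycle s zs ∘ cycle r ws
cycle-comm {r = r} {ws} {s} {zs} d x = trans (cycle-natural (cycle-injective r ws) s zs x)
  (cong₂ (λ t ts → cycle t ts (cycle r ws x)) (fixed (here refl))
    (map-id-local (All.tabulate (fixed ∘ there))))
  where
  fixed : ∀ {y} → y ∈ s ∷ zs → cycle r ws y ≡ y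
  fixed y∈ = cycle-fix ws (λ y∈′ → d (y∈′ , y∈))

-- Carried across the transposition of `r` and `v`, the piece `xs` hangs at `v` instead of `r`.
-- There it is disjoint from `ys` at `r`, so the two pieces change places, and a second conjugation
-- hangs `ys` at `v`.
rotation : ∀ {r : Fin N} xs {v} ys → Unique (r ∷ xs ++ v ∷ ys) →
  cycle r (xs ++ v ∷ ys) ≗ cycle v (ys ++ r ∷ xs)
rotation {r = r} xs {v} ys u@(r≢ ∷ u′) x = begin
  cycle r (xs ++ v ∷ ys) x                               ≡⟨ cycle-++ r xs (v ∷ ys) x ⟩
  cycle r ys (transposition r v (cycle r xs x))          ≡⟨ cong (cycle r ys) (conj r v xs r∉xs v∉xs (transposition-left r v) x) ⟩
  cycle r ys (cycle v xs (transposition r v x))          ≡⟨ cycle-comm dis (transposition r v x) ⟩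
  cycle v xs (cycle r ys (transposition r v x))          ≡⟨ cong (cycle v xs ∘ cycle r ys) (transposition-sym r v x) ⟩
  cycle v xs (cycle r ys (transposition v r x))          ≡⟨ cong (cycle v xs) (sym (conj v r ys v∉ys r∉ys (transposition-left v r) x)) ⟩
  cycle v xs (transposition v r (cycle v ys x))          ≡⟨ sym (cycle-++ v ys (r ∷ xs) x) ⟩
  cycle v (ys ++ r ∷ xs) x                               ∎
  where
  open ≡-Reasoning
  split = Unique-++⁻ xs u′
  conj : ∀ a b ws → a ∉ ws → b ∉ ws → transposition a b a ≡ b → ∀ x →
         transposition a b (cycle a ws x) ≡ cycle b ws (transposition a b x)
  conj a b ws a∉ b∉ e x = trans (cycle-natural (transposition-injective a b) a ws x)
    (cong₂ (λ t ts → cycle t ts (transposition a b x)) e (map-id-local (All.tabulate λ {y} y∈ →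
      transposition-fix {a = a} {b} {y} (λ { refl → a∉ y∈ }) (λ { refl → b∉ y∈ }))))
  r∉ : r ∉ xs ++ v ∷ ys
  r∉ = Unique[x∷xs]⇒x∉xs u
  r∉xs : r ∉ xs
  r∉xs p = r∉ (∈-++⁺ˡ p)
  r∉ys : r ∉ ys
  r∉ys p = r∉ (∈-++⁺ʳ xs (there p))
  v∉xs : v ∉ xs
  v∉xs p = proj₂ (proj₂ split) (p , here refl)
  v∉ys : v ∉ ys
  v∉ys = Unique[x∷xs]⇒x∉xs (proj₁ (proj₂ split))
  dis : Disjoint (r ∷ ys) (v ∷ xs)
  dis (here refl , here refl) = r∉ (∈-++⁺ʳ xs (here refl))
  dis (here refl , there p)   = r∉xs p
  dis (there p , here refl)   = v∉ys p
  dis (there p , there q)     = proj₂ (proj₂ split) (q , there p)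

-- Products of factors and the contour word

product : List (Edge (Fin N)) → Perm N
product es = prod (map perm es)

product-++ : ∀ es (fs : List (Edge (Fin N))) x → product (es ++ fs) x ≡ product fs (product es x)
product-++ []       fs x = refl
product-++ (e ∷ es) fs x = product-++ es fs (perm e x)

product-≈ : ∀ {es fs : List (Edge (Fin N))} → es ≈ fs → product es ≗ product fs
product-≈ ≈refl        x = refl
product-≈ (≈trans p q) x = trans (product-≈ p x) (product-≈ q x)
product-≈ (prep e p)   x = product-≈ p (perm e x)
product-≈ (swap {es = es} d) x = cong (product es) (sym (cycle-comm d x))
product-≈ (rotate {xs = xs} {ys = ys} {es = es} u) x = cong (product es) (rotation xs ys u x)

Equiv-prep : ∀ (σ : Perm N) {fs gs} → Equiv fs gs → Equiv (σ ∷ fs) (σ ∷ gs)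
Equiv-prep σ ε             = ε
Equiv-prep σ (inj₁ s ◅ p) = inj₁ (there s) ◅ Equiv-prep σ p
Equiv-prep σ (inj₂ e ◅ p) = inj₂ ((λ _ → refl) ∷ e) ◅ Equiv-prep σ p

≗-refl : ∀ {fs : List (Perm N)} → Pointwise _≗_ fs fs
≗-refl = Pointwise.refl (λ _ → refl)

≈⇒Equiv : ∀ {es fs : List (Edge (Fin N))} → es ≈ fs → Equiv (map perm es) (map perm fs)
≈⇒Equiv ≈refl        = ε
≈⇒Equiv (≈trans p q) = ≈⇒Equiv p ◅◅ ≈⇒Equiv q
≈⇒Equiv (prep e p)   = Equiv-prep (perm e) (≈⇒Equiv p)
≈⇒Equiv (swap d)     = inj₁ (here (cycle-comm d)) ◅ ε
≈⇒Equiv (rotate {xs = xs} {ys = ys} u) = inj₂ (rotation xs ys u ∷ ≗-refl) ◅ ε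

Swap-sym : ∀ {fs gs : List (Perm N)} → Swap fs gs → Swap gs fs
Swap-sym (here c)  = here (λ x → sym (c x))
Swap-sym (there s) = there (Swap-sym s)

Equiv-sym : ∀ {fs gs : List (Perm N)} → Equiv fs gs → Equiv gs fs
Equiv-sym = Star.reverse λ where
  (inj₁ s) → inj₁ (Swap-sym s)
  (inj₂ e) → inj₂ (Pointwise.symmetric (λ p x → sym (p x)) e)

module _ {N : ℕ} where
  open CMSolver (++-commutativeMonoid {A = Fin N}) hiding (_⊕_)
  open CMSolver (++-commutativeMonoid {A = Fin N}) using () renaming (_⊕_ to _∙_)
  open ≡-Reasoning

  product-factors : ∀ (r : Fin N) T → Unique (r ∷ word T) → product (factors r T) ≗ cycle r (word T)
  -- Peel the transposition of `r` and `v` off the polygon. What remains of the polygon, with the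
  -- later branches, is disjoint from `v` and `A`, so the factors can be sorted into `B`, the
  -- transposition, `A`, and then the remaining branches. The first three multiply to the cycle at
  -- `v` through `word B`, `r`, `word A`; read from `r`, this is the beginning of the contour.
  product-branches : ∀ (r : Fin N) b → Unique (r ∷ wordB b) →
    product (before b ++ (r , verts b) ∷ after b) ≗ cycle r (wordB b)
  product-factors r leaf       u x = refl
  product-factors r (node b C) u x = begin
    product (before b ++ (r , verts b) ∷ after b ++ factors r C) x
      ≡⟨ cong (λ z → product z x) (sym (++-assoc (before b) _ _)) ⟩
    product ((before b ++ (r , verts b) ∷ after b) ++ factors r C) x
      ≡⟨ product-++ (before b ++ (r , verts b) ∷ after b) _ x ⟩
    product (factors r C) (product (before b ++ (r , verts b) ∷ after b) x)
      ≡⟨ product-factors r C uC _ ⟩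
    cycle r (word C) (product (before b ++ (r , verts b) ∷ after b) x)
      ≡⟨ cong (cycle r (word C)) (product-branches r b (proj₁ (Unique-++⁻ (r ∷ wordB b) u)) x) ⟩
    cycle r (word C) (cycle r (wordB b) x)
      ≡⟨ sym (cycle-++ r (wordB b) (word C) x) ⟩
    cycle r (wordB b ++ word C) x ∎
    where
    uC : Unique (r ∷ word C)
    uC = uniquePart _ u (solve 3 (λ r b c → (r ∙ (b ∙ c)) ⊜ ((r ∙ c) ∙ b)) ↭-refl [ r ] (wordB b) (word C))
  product-branches r none             u x = refl
  product-branches r (branch A v B b) u x = begin
    product ((factors v B ++ before b) ++ (r , v ∷ verts b) ∷ factors v A ++ after b) x
      ≡⟨ product-++ (factors v B ++ before b) _ x ⟩
    -- By definition the cycle of the polygon is that of `P` followed by that of `Q`, so this step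
    -- merely splits the product.
    product (P ++ Q ++ factors v A ++ after b) (product (factors v B ++ before b) x)
      ≡⟨ product-≈ (++-≈ʳ P (block-swap (after b) withinQ (factors-within v A) dis₁))
           (product (factors v B ++ before b) x) ⟩
    product (P ++ factors v A ++ Q ++ after b) (product (factors v B ++ before b) x)
      ≡⟨ cong (product (P ++ factors v A ++ Q ++ after b)) (product-++ (factors v B) (before b) x) ⟩
    product (P ++ factors v A ++ Q ++ after b) (product (before b) y)
      ≡⟨ sym (product-++ (before b) _ y) ⟩
    product (before b ++ (P ++ factors v A) ++ Q ++ after b) y
      ≡⟨ product-≈ (block-swap (Q ++ after b) (before-within b) withinPA dis₂) y ⟩
    product ((P ++ factors v A) ++ before b ++ Q ++ after b) y
      ≡⟨ product-++ (P ++ factors v A) _ y ⟩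
    product (before b ++ Q ++ after b) (product (factors v A) (transposition r v y))
      ≡⟨ product-branches r b uniqueb _ ⟩
    cycle r (wordB b) (product (factors v A) (transposition r v y))
      ≡⟨ cong (cycle r (wordB b)) (product-factors v A uniqueA _) ⟩
    cycle r (wordB b) (cycle v (word A) (transposition r v y))
      ≡⟨ cong (cycle r (wordB b) ∘ cycle v (word A))
           (trans (transposition-sym r v y) (cong (transposition v r) (product-factors v B uniqueB x))) ⟩
    cycle r (wordB b) (cycle v (word A) (transposition v r (cycle v (word B) x)))
      ≡⟨ cong (cycle r (wordB b)) (sym (cycle-++ v (word B) (r ∷ word A) x)) ⟩
    cycle r (wordB b) (cycle v (word B ++ r ∷ word A) x)
      ≡⟨ cong (cycle r (wordB b)) (sym (rotation (word A) (word B) uniqueAB x)) ⟩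
    cycle r (wordB b) (cycle r (word A ++ v ∷ word B) x)
      ≡⟨ sym (cycle-++ r (word A ++ v ∷ word B) (wordB b) x) ⟩
    cycle r ((word A ++ v ∷ word B) ++ wordB b) x
      ≡⟨ cong (λ z → cycle r z x) (++-assoc (word A) _ _) ⟩
    cycle r (word A ++ v ∷ word B ++ wordB b) x ∎
    where
    P Q : List (Edge (Fin N))
    P = [ (r , [ v ]) ]
    Q = [ (r , verts b) ]
    y = product (factors v B) x

    dis₁ : Disjoint (r ∷ wordB b) (v ∷ word A)
    dis₁ = disjointParts _ _ u (solve 5 (λ r a v b c → (r ∙ (a ∙ (v ∙ (b ∙ c)))) ⊜ ((r ∙ c) ∙ ((v ∙ a) ∙ b)))
      ↭-refl [ r ] (word A) [ v ] (word B) (wordB b))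
    dis₂ : Disjoint (wordB b) (r ∷ v ∷ word A)
    dis₂ = disjointParts _ _ u (solve 5 (λ r a v b c → (r ∙ (a ∙ (v ∙ (b ∙ c)))) ⊜ (c ∙ ((r ∙ (v ∙ a)) ∙ b)))
      ↭-refl [ r ] (word A) [ v ] (word B) (wordB b))
    uniqueb : Unique (r ∷ wordB b)
    uniqueb = uniquePart _ u (solve 5 (λ r a v b c → (r ∙ (a ∙ (v ∙ (b ∙ c)))) ⊜ ((r ∙ c) ∙ (v ∙ (a ∙ b))))
      ↭-refl [ r ] (word A) [ v ] (word B) (wordB b))
    uniqueA : Unique (v ∷ word A)
    uniqueA = uniquePart _ u (solve 5 (λ r a v b c → (r ∙ (a ∙ (v ∙ (b ∙ c)))) ⊜ ((v ∙ a) ∙ (r ∙ (c ∙ b))))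
      ↭-refl [ r ] (word A) [ v ] (word B) (wordB b))
    uniqueB : Unique (v ∷ word B)
    uniqueB = uniquePart _ u (solve 5 (λ r a v b c → (r ∙ (a ∙ (v ∙ (b ∙ c)))) ⊜ ((v ∙ b) ∙ (r ∙ (c ∙ a))))
      ↭-refl [ r ] (word A) [ v ] (word B) (wordB b))
    uniqueAB : Unique (r ∷ word A ++ v ∷ word B)
    uniqueAB = uniquePart _ u (solve 5 (λ r a v b c → (r ∙ (a ∙ (v ∙ (b ∙ c)))) ⊜ ((r ∙ (a ∙ (v ∙ b))) ∙ c))
      ↭-refl [ r ] (word A) [ v ] (word B) (wordB b))

    withinQ : Within (r ∷ wordB b) Q
    withinQ = (λ { (here refl) → here refl ; (there p) → there (verts⊆wordB b p) }) ∷ []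
    withinPA : Within (r ∷ v ∷ word A) (P ++ factors v A)
    withinPA = (λ { (here refl) → here refl ; (there (here refl)) → there (here refl) })
             ∷ Within-⊆ there (factors-within v A)

-- Cycles are compared through paths: a path fixes the values of `g` on all its points but the last,
-- and `g` with the starting point recovers the list up to the first visit to `t`.
Path : Perm N → Fin N → List (Fin N) → Fin N → Set
Path g u []       t = g u ≡ t
Path g u (w ∷ ws) t = g u ≡ w × Path g w ws t

Path-cong : ∀ {g h : Perm N} {u t} ws → (∀ {x} → x ∈ u ∷ ws → g x ≡ h x) → Path g u ws t → Path h u ws t
Path-cong []       e p       = trans (sym (e (here refl))) p
Path-cong (w ∷ ws) e (p , q) = trans (sym (e (here refl))) p , Path-cong ws (e ∘ there) q

Path-agree : ∀ {g h : Perm N} {u t} ws → Path g u ws t → Path h u ws t → ∀ {x} → x ∈ u ∷ ws → g x ≡ h x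
Path-agree []       p       q        (here refl) = trans p (sym q)
Path-agree (w ∷ ws) (p , _) (q , _)  (here refl) = trans p (sym q)
Path-agree (w ∷ ws) (_ , p) (_ , q)  (there x∈)  = Path-agree ws p q x∈

-- Both lists arise by iterating `g` from `u`, and as `t` occurs in neither, both end at the first
-- visit to `t`.
Path-determined : ∀ {g : Perm N} {u t} ws zs → Path g u ws t → Path g u zs t → t ∉ ws → t ∉ zs → ws ≡ zs
Path-determined []       []       _        _        _ _ = refl
Path-determined []       (z ∷ zs) p        (q , _)  _ n = ⊥-elim (n (here (trans (sym p) q)))
Path-determined (w ∷ ws) []       (p , _)  q        n _ = ⊥-elim (n (here (trans (sym q) p)))
Path-determined (w ∷ ws) (z ∷ zs) (p , ps) (q , qs) n n′ with trans (sym p) q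
... | refl = cong (w ∷_) (Path-determined ws zs ps qs (n ∘ there) (n′ ∘ there))

cycle-path : ∀ (r : Fin N) ws → Unique (r ∷ ws) → Path (cycle r ws) r ws r
cycle-path r []       u = refl
cycle-path r (w ∷ ws) ((r≢w ∷ r≢) ∷ (w≢ ∷ u)) =
    trans (cong (cycle r ws) (transposition-left r w)) (cycle-fix ws w∉) , tail ws (cycle-path r ws (r≢ ∷ u)) fixes
  where
  w∉ : w ∉ r ∷ ws
  w∉ (here refl) = r≢w refl
  w∉ (there p)   = All.lookup w≢ p refl
  fixes : ∀ {x} → x ∈ ws → transposition r w x ≡ x
  fixes x∈ = transposition-fix (λ { refl → All.lookup r≢ x∈ refl }) (λ { refl → All.lookup w≢ x∈ refl })
  -- The transposition acts first: it turns `w` into `r` and leaves the later entries alone, so a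
  -- path of the shorter cycle from `r` becomes a path from `w`, with the same end.
  tail : ∀ zs {h : Perm _} → Path h r zs r → (∀ {x} → x ∈ zs → transposition r w x ≡ x) →
         Path (h ∘ transposition r w) w zs r
  tail []       {h} p       f = trans (cong h (transposition-right r w)) p
  tail (z ∷ zs) {h} (p , q) f = trans (cong h (transposition-right r w)) p
    , Path-cong zs (λ x∈ → cong h (sym (f x∈))) q

-- Every minimal factorization comes from a cactus

edgeSize : Edge V → ℕ
edgeSize e = length (support e)

sizes  : Tree V → List ℕ
sizesB : Branches V → List ℕ
sizes leaf       = []
sizes (node b C) = suc (length (verts b)) ∷ sizesB b ++ sizes C
sizesB none             = []
sizesB (branch A v B b) = sizes A ++ sizes B ++ sizesB b

-- For the cycle lengths of a factorization of type α this is ⟨α⟩.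
degreeSum : List ℕ → ℕ
degreeSum ls = sum (map pred ls)

degreeSum-++ : ∀ ls ks → degreeSum (ls ++ ks) ≡ degreeSum ls + degreeSum ks
degreeSum-++ ls ks = trans (cong sum (map-++ pred ls ks)) (sum-++ (map pred ls) (map pred ks))

degreeSum-↭ : ∀ {ls ks} → ls ↭ ks → degreeSum ls ≡ degreeSum ks
degreeSum-↭ p = sum-↭ (map⁺ pred p)

edgeWeight : List (Edge V) → ℕ
edgeWeight es = degreeSum (map edgeSize es)

≈⇒sizes↭ : ∀ {es fs : List (Edge V)} → es ≈ fs → map edgeSize es ↭ map edgeSize fs
≈⇒sizes↭ ≈refl        = ↭-refl
≈⇒sizes↭ (≈trans p q) = ↭-trans (≈⇒sizes↭ p) (≈⇒sizes↭ q)
≈⇒sizes↭ (prep e p)   = ↭-prep _ (≈⇒sizes↭ p)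
≈⇒sizes↭ (swap d)     = ↭-swap _ _ ↭-refl
≈⇒sizes↭ (rotate {r = r} {xs} {v} {ys} {es} u) =
  ↭-reflexive (cong (λ n → suc n ∷ map edgeSize es) (begin
    length (xs ++ v ∷ ys)        ≡⟨ length-++ xs ⟩
    length xs + suc (length ys)  ≡⟨ ℕ.+-suc (length xs) (length ys) ⟩
    suc (length xs + length ys)  ≡⟨ cong suc (ℕ.+-comm (length xs) (length ys)) ⟩
    suc (length ys + length xs)  ≡⟨ sym (ℕ.+-suc (length ys) (length xs)) ⟩
    length ys + suc (length xs)  ≡⟨ sym (length-++ ys) ⟩
    length (ys ++ r ∷ xs)        ∎))
  where open ≡-Reasoning

module _ {V : Set} where
  open CMSolver (++-commutativeMonoid {A = ℕ}) hiding (_⊕_)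
  open CMSolver (++-commutativeMonoid {A = ℕ}) using () renaming (_⊕_ to _∙_)

  sizes-factors  : ∀ (r : V) T → map edgeSize (factors r T) ↭ sizes T
  sizes-branches : ∀ (b : Branches V) → map edgeSize (before b) ++ map edgeSize (after b) ↭ sizesB b
  sizes-factors r leaf       = ↭-refl
  sizes-factors r (node b C)
    rewrite map-++ edgeSize (before b) ((r , verts b) ∷ after b ++ factors r C)
          | map-++ edgeSize (after b) (factors r C) =
    ↭-trans (solve 4 (λ p e q c → (p ∙ (e ∙ (q ∙ c))) ⊜ (e ∙ ((p ∙ q) ∙ c))) ↭-refl
      (map edgeSize (before b)) [ suc (length (verts b)) ] (map edgeSize (after b)) (map edgeSize (factors r C)))
      (↭-prep _ (++⁺ (sizes-branches b) (sizes-factors r C)))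
  sizes-branches none             = ↭-refl
  sizes-branches (branch A v B b)
    rewrite map-++ edgeSize (factors v B) (before b) | map-++ edgeSize (factors v A) (after b) =
    ↭-trans (solve 4 (λ β p α q → ((β ∙ p) ∙ (α ∙ q)) ⊜ (α ∙ (β ∙ (p ∙ q)))) ↭-refl
      (map edgeSize (factors v B)) (map edgeSize (before b)) (map edgeSize (factors v A)) (map edgeSize (after b)))
      (++⁺ (sizes-factors v A) (++⁺ (sizes-factors v B) (sizes-branches b)))

-- Charge every vertex other than the root to the polygon through which it is first reached; a
-- polygon with j vertices is charged j - 1 times.
length-word  : ∀ (T : Tree V) → length (word T) ≡ degreeSum (sizes T)
length-wordB : ∀ (b : Branches V) → length (wordB b) ≡ length (verts b) + degreeSum (sizesB b)
length-word leaf       = refl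
length-word (node b C) = begin
  length (wordB b ++ word C)                                   ≡⟨ length-++ (wordB b) ⟩
  length (wordB b) + length (word C)                           ≡⟨ cong₂ _+_ (length-wordB b) (length-word C) ⟩
  length (verts b) + degreeSum (sizesB b) + degreeSum (sizes C) ≡⟨ ℕ.+-assoc (length (verts b)) _ _ ⟩
  length (verts b) + (degreeSum (sizesB b) + degreeSum (sizes C))
    ≡⟨ cong (length (verts b) +_) (sym (degreeSum-++ (sizesB b) (sizes C))) ⟩
  length (verts b) + degreeSum (sizesB b ++ sizes C)           ∎
  where open ≡-Reasoning
length-wordB none             = refl
length-wordB (branch A v B b) = begin
  length (word A ++ v ∷ word B ++ wordB b)                    ≡⟨ length-++ (word A) ⟩
  length (word A) + suc (length (word B ++ wordB b))           ≡⟨ cong (λ z → length (word A) + suc z) (length-++ (word B)) ⟩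
  length (word A) + suc (length (word B) + length (wordB b))
    ≡⟨ cong₂ (λ x y → x + suc y) (length-word A) (cong₂ _+_ (length-word B) (length-wordB b)) ⟩
  degreeSum (sizes A) + suc (degreeSum (sizes B) + (length (verts b) + degreeSum (sizesB b)))
    ≡⟨ rearrange (degreeSum (sizes A)) (degreeSum (sizes B)) (length (verts b)) (degreeSum (sizesB b)) ⟩
  suc (length (verts b)) + (degreeSum (sizes A) + (degreeSum (sizes B) + degreeSum (sizesB b)))
    ≡⟨ cong (suc (length (verts b)) +_) (sym (trans (degreeSum-++ (sizes A) _)
         (cong (degreeSum (sizes A) +_) (degreeSum-++ (sizes B) (sizesB b))))) ⟩
  suc (length (verts b)) + degreeSum (sizes A ++ sizes B ++ sizesB b) ∎
  where
  open ≡-Reasoning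
  rearrange : ∀ a b v c → a + suc (b + (v + c)) ≡ suc v + (a + (b + c))
  rearrange = solve-∀

length-factors : ∀ (r : V) T → length (word T) ≡ edgeWeight (factors r T)
length-factors r T = trans (length-word T) (sym (degreeSum-↭ (sizes-factors r T)))

infixr 5 _⊗_

_⊗_ : System V → System V → System V
(X , es) ⊗ (Y , fs) = X ++ Y , es ++ fs

⇝-refl : {s : System V} → s ⇝ s
⇝-refl = ↭-refl , λ _ → ≈refl

⇝-⊗ : {s s′ t t′ : System V} → s ⇝ s′ → t ⇝ t′ → s ⊗ t ⇝ s′ ⊗ t′
⇝-⊗ {s = X , es} {s′ = _ , es′} {t = _ , fs} (p , f) (q , g) = ++⁺ p q , λ u →
  let (uX , uY , _) = Unique-++⁻ X u in ≈trans (++-≈ˡ fs (f uX)) (++-≈ʳ es′ (g uY))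

forest : List (V × Tree V) → System V
forest []            = [] , []
forest ((r , T) ∷ Φ) = rooted r T ⊗ forest Φ

module _ {V : Set} where
  open CMSolver (++-commutativeMonoid {A = V}) hiding (_⊕_)
  open CMSolver (++-commutativeMonoid {A = V}) using () renaming (_⊕_ to _∙_)

  ⊗-exchange : ∀ s r T r′ T′ → s ≡ rooted r T → ∀ t → s ⊗ (rooted r′ T′ ⊗ t) ⇝ rooted {V} r′ T′ ⊗ (s ⊗ t)
  ⊗-exchange .(rooted r T) r T r′ T′ refl (Y , fs) =
      solve 3 (λ a b c → (a ∙ (b ∙ c)) ⊜ (b ∙ (a ∙ c))) ↭-refl (r ∷ word T) (r′ ∷ word T′) Y
    , λ u → block-swap fs (factors-within r T) (factors-within r′ T′)
              (disjointParts (r ∷ word T) (r′ ∷ word T′) u ↭-refl)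

  -- Distinct parts have disjoint supports, so the part of `v`, re-rooted at `v`, can be brought to
  -- the front of the factors.
  extract : ∀ (Φ : List (V × Tree V)) {v} → v ∈ proj₁ (forest Φ) →
            ∃₂ λ T Φ′ → forest Φ ⇝ rooted v T ⊗ forest Φ′
  extract ((r , T) ∷ Φ) v∈ with ∈-++⁻ (r ∷ word T) v∈
  ... | inj₁ p with reroot′ r T p
  ...   | T′ , q = T′ , Φ , ⇝-⊗ q ⇝-refl
  extract ((r , T) ∷ Φ) v∈ | inj₂ p with extract Φ p
  ...   | T′ , Φ′ , q = T′ , (r , T) ∷ Φ′ ,
            ⇝-trans (⇝-⊗ (⇝-refl {s = rooted r T}) q) (⊗-exchange _ r T _ T′ refl (forest Φ′))

  -- Such labellings are those that factor through the connected components; they stand in for a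
  -- connectivity relation.
  Inv : (V → Fin k) → List (Edge V) → Set
  Inv f es = All (λ e → ∀ x → x ∈ proj₂ e → f x ≡ f (proj₁ e)) es

  Inv-≈ : ∀ {f : V → Fin k} {es fs} → es ≈ fs → Inv f es → Inv f fs
  Inv-≈ ≈refl        i           = i
  Inv-≈ (≈trans p q) i           = Inv-≈ q (Inv-≈ p i)
  Inv-≈ (prep e p)   (i ∷ is)    = i ∷ Inv-≈ p is
  Inv-≈ (swap d)     (i ∷ j ∷ is) = j ∷ i ∷ is
  Inv-≈ {f = f} (rotate {r = r} {xs} {v} {ys} u) (i ∷ is) = (λ x x∈ → trans (toRoot x x∈) (sym fv)) ∷ is
    where
    fv : f v ≡ f r
    fv = i v (∈-++⁺ʳ xs (here refl))
    toRoot : ∀ x → x ∈ ys ++ r ∷ xs → f x ≡ f r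
    toRoot x x∈ with ∈-++⁻ ys x∈
    ... | inj₁ p           = i x (∈-++⁺ʳ xs (there p))
    ... | inj₂ (here refl) = refl
    ... | inj₂ (there p)   = i x (∈-++⁺ˡ p)

  Inv-word  : ∀ {f : V → Fin k} r T → Inv f (factors r T) → ∀ x → x ∈ word T → f x ≡ f r
  Inv-wordB : ∀ {f : V → Fin k} {c} b → Inv f (before b) → Inv f (after b) →
              (∀ x → x ∈ verts b → f x ≡ c) → ∀ x → x ∈ wordB b → f x ≡ c
  Inv-word r (node b C) i x x∈ with All.++⁻ (before b) i
  ... | ib , ie ∷ i′ with All.++⁻ (after b) i′ | ∈-++⁻ (wordB b) x∈
  ...   | ia , iC | inj₁ p = Inv-wordB b ib ia ie x p
  ...   | ia , iC | inj₂ p = Inv-word r C iC x p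
  Inv-wordB (branch A v B b) ib ia fv x x∈
    with All.++⁻ (factors v B) ib | All.++⁻ (factors v A) ia | ∈-++⁻ (word A) x∈
  ... | iB , ib′ | iA , ia′ | inj₁ p           = trans (Inv-word v A iA x p) (fv v (here refl))
  ... | iB , ib′ | iA , ia′ | inj₂ (here refl) = fv x (here refl)
  ... | iB , ib′ | iA , ia′ | inj₂ (there p) with ∈-++⁻ (word B) p
  ...   | inj₁ q = trans (Inv-word v B iB x q) (fv v (here refl))
  ...   | inj₂ q = Inv-wordB b ib′ ia′ (λ y y∈ → fv y (there y∈)) x q

  -- `before b` is empty because the polygon to be added is applied before everything in the forest:
  -- all parts it picks up sit on the `A` side.
  Attached : List V → List (V × Tree V) → Set
  Attached vs Φ = ∃₂ λ b Φ′ → verts b ≡ vs × before b ≡ [] ×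
    forest Φ ⇝ (wordB b , after b) ⊗ forest Φ′

  -- A vertex of vs lying in a part already reached can be dropped: its
  -- label is determined by the remaining ones.
  Droppable : List V → List V → List (V × Tree V) → Set
  Droppable S vs Φ = ∃ λ ws → length ws < length vs ×
    (∀ {k} (f : V → Fin k) c → Inv f (proj₂ (forest Φ)) → (∀ x → x ∈ S → f x ≡ c) →
      (∀ x → x ∈ ws → f x ≡ c) → ∀ x → x ∈ vs → f x ≡ c)

  attach : ∀ S Φ vs → (∀ x → x ∈ S ⊎ x ∈ proj₁ (forest Φ)) → Unique (proj₁ (forest Φ)) →
           Attached vs Φ ⊎ Droppable S vs Φ
  attach S Φ []       cover u = inj₁ (none , Φ , refl , refl , ⇝-refl)
  attach S Φ (v ∷ vs) cover u with cover v
  ... | inj₁ v∈S = inj₂ (vs , ℕ.≤-refl , λ where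
          f c inv fS fws x (here refl) → fS x v∈S
          f c inv fS fws x (there p)   → fws x p)
  ... | inj₂ v∈Φ with extract Φ v∈Φ
  ...   | T , Φ₁ , q
    with attach ((v ∷ word T) ++ S) Φ₁ vs cover′ (proj₁ (proj₂ (Unique-++⁻ (v ∷ word T) (Unique-↭ (proj₁ q) u))))
    where
    cover′ : ∀ x → x ∈ (v ∷ word T) ++ S ⊎ x ∈ proj₁ (forest Φ₁)
    cover′ x with cover x
    ... | inj₁ p = inj₁ (∈-++⁺ʳ (v ∷ word T) p)
    ... | inj₂ p with ∈-++⁻ (v ∷ word T) (∈-resp-↭ (proj₁ q) p)
    ...   | inj₁ p′ = inj₁ (∈-++⁺ˡ p′)
    ...   | inj₂ p′ = inj₂ p′
  ...     | inj₁ (b , Φ′ , vb , bb , s) = inj₁ (branch T v leaf b , Φ′ , cong (v ∷_) vb , bb ,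
            ⇝-trans (⇝-trans q (⇝-⊗ (⇝-refl {s = rooted v T}) s))
              ( solve 4 (λ v t w y → ((v ∙ t) ∙ (w ∙ y)) ⊜ ((t ∙ (v ∙ w)) ∙ y)) ↭-refl
                  [ v ] (word T) (wordB b) (proj₁ (forest Φ′))
              , λ _ → ≡⇒≈ (sym (++-assoc (factors v T) (after b) _))))
  -- The recursive call worked with a larger `S`. Since `v` itself is kept, the whole part at `v`
  -- carries the common label, as that call requires.
  ...     | inj₂ (ws , lt , det) = inj₂ (v ∷ ws , s≤s lt , λ f c inv fS fws →
            let inv′ = Inv-≈ (proj₂ q u) inv
                invT , invΦ = All.++⁻ (factors v T) inv′
                fv = fws v (here refl)
            in λ where
              x (here refl) → fv
              x (there x∈)  → det f c invΦ
                (λ { y y∈ → fromS f (trans′ (Inv-word v T invT) fv) fv fS y (∈-++⁻ (v ∷ word T) y∈) })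
                (λ y y∈ → fws y (there y∈)) x x∈)
    where
    trans′ : ∀ {k} {f : V → Fin k} {c} → (∀ x → x ∈ word T → f x ≡ f v) → f v ≡ c → ∀ x → x ∈ word T → f x ≡ c
    trans′ h e x x∈ = trans (h x x∈) e
    fromS : ∀ {k} (f : V → Fin k) {c} → (∀ x → x ∈ word T → f x ≡ c) → f v ≡ c → (∀ x → x ∈ S → f x ≡ c) →
            ∀ y → y ∈ v ∷ word T ⊎ y ∈ S → f y ≡ c
    fromS f hT hv hS y (inj₁ (here refl)) = hv
    fromS f hT hv hS y (inj₁ (there p))   = hT y p
    fromS f hT hv hS y (inj₂ p)           = hS y p

  -- Only degrees and labellings are compared: `es₀` connects at least as much as `es` at a smaller
  -- total degree.
  Redundant : List (Edge V) → Set
  Redundant es = ∃ λ es₀ → edgeWeight es₀ < edgeWeight es × (∀ {k} (f : V → Fin k) → Inv f es₀ → Inv f es)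

Forest : List (Edge (Fin N)) → Set
Forest {N} es = ∃ λ Φ → proj₁ (forest Φ) ↭ allFin N × es ≈ proj₂ (forest Φ)

singletons : List (Fin N) → List (Fin N × Tree (Fin N))
singletons = map (_, leaf)

forest-singletons : ∀ (vs : List (Fin N)) → forest (singletons vs) ≡ (vs , [])
forest-singletons []       = refl
forest-singletons (v ∷ vs) = cong (λ s → rooted v leaf ⊗ s) (forest-singletons vs)

module _ {N : ℕ} where
  open CMSolver (++-commutativeMonoid {A = Fin N}) hiding (_⊕_)
  open CMSolver (++-commutativeMonoid {A = Fin N}) using () renaming (_⊕_ to _∙_)

  build : ∀ (es : List (Edge (Fin N))) → Forest es ⊎ Redundant es
  build [] = inj₁ (singletons (allFin N) , ↭-reflexive (cong proj₁ (forest-singletons (allFin N)))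
                 , ≡⇒≈ (sym (cong proj₂ (forest-singletons (allFin N)))))
  build ((r , vs) ∷ es) with build es
  ... | inj₂ (es₀ , lt , det) = inj₂ ((r , vs) ∷ es₀ , ℕ.+-monoʳ-< (length vs) lt ,
          λ { f (i ∷ is) → i ∷ det f is })
  ... | inj₁ (Φ , perm , es≈) with extract Φ (∈-resp-↭ (↭-sym perm) (∈-allFin r))
  ...   | T , Φ₁ , q with attach (r ∷ word T) Φ₁ vs cover uΦ₁
    where
    u : Unique (proj₁ (forest Φ))
    u = Unique-↭ (↭-sym perm) (allFin⁺ N)
    uΦ₁ : Unique (proj₁ (forest Φ₁))
    uΦ₁ = proj₁ (proj₂ (Unique-++⁻ (r ∷ word T) (Unique-↭ (proj₁ q) u)))
    cover : ∀ x → x ∈ r ∷ word T ⊎ x ∈ proj₁ (forest Φ₁)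
    cover x = ∈-++⁻ (r ∷ word T) (∈-resp-↭ (↭-trans (↭-sym perm) (proj₁ q)) (∈-allFin x))
  ...     | inj₁ (b , Φ′ , refl , bb , s) = inj₁ ((r , node b T) ∷ Φ′ , perm′ , es≈′)
    where
    u : Unique (proj₁ (forest Φ))
    u = Unique-↭ (↭-sym perm) (allFin⁺ N)
    u₁ : Unique ((r ∷ word T) ++ proj₁ (forest Φ₁))
    u₁ = Unique-↭ (proj₁ q) u
    uΦ₁ : Unique (proj₁ (forest Φ₁))
    uΦ₁ = proj₁ (proj₂ (Unique-++⁻ (r ∷ word T) u₁))
    u₂ : Unique ((r ∷ word T) ++ wordB b ++ proj₁ (forest Φ′))
    u₂ = Unique-↭ (++⁺ˡ (r ∷ word T) (proj₁ s)) u₁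
    perm′ : proj₁ (forest ((r , node b T) ∷ Φ′)) ↭ allFin N
    perm′ = ↭-trans (solve 4 (λ r b t y → ((r ∙ (b ∙ t)) ∙ y) ⊜ ((r ∙ t) ∙ (b ∙ y))) ↭-refl
              [ r ] (wordB b) (word T) (proj₁ (forest Φ′)))
      (↭-trans (++⁺ˡ (r ∷ word T) (↭-sym (proj₁ s))) (↭-trans (↭-sym (proj₁ q)) perm))
    -- The part at `r` has to end up last, behind the factors in the branches; the two blocks are
    -- disjoint.
    es≈′ : (r , verts b) ∷ es ≈ (before b ++ (r , verts b) ∷ after b ++ factors r T) ++ proj₂ (forest Φ′)
    es≈′ = ≈trans (prep _ (≈trans es≈ (≈trans (proj₂ q u) (≈trans
        (++-≈ʳ (factors r T) (proj₂ s uΦ₁))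
        (block-swap _ (factors-within r T) (after-within b) (disjointParts (r ∷ word T) (wordB b) u₂ ↭-refl))))))
      (≡⇒≈ (trans (cong ((r , verts b) ∷_) (sym (++-assoc (after b) (factors r T) _)))
        (cong (λ z → (z ++ (r , verts b) ∷ after b ++ factors r T) ++ proj₂ (forest Φ′)) (sym bb))))
  ...     | inj₂ (ws , lt , det) = inj₂ ((r , ws) ∷ es , ℕ.+-monoˡ-< (edgeWeight es) lt , λ where
            f (i ∷ is) →
              let invT , invΦ₁ = All.++⁻ (factors r T)
                    (Inv-≈ (proj₂ q (Unique-↭ (↭-sym perm) (allFin⁺ N))) (Inv-≈ es≈ is))
              in det f (f r) invΦ₁ (λ { x (here refl) → refl ; x (there p) → Inv-word r T invT x p }) i ∷ is)

-- Labellings and the number of components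

Surjective : (Fin N → Fin k) → Set
Surjective f = ∀ y → ∃ λ x → f x ≡ y

Coarsening : (Fin N → Fin k) → List (Edge (Fin N)) → ℕ → Set
Coarsening {N} {k} f es m = ∃₂ λ k′ (f′ : Fin N → Fin k′) →
  (∀ {x y} → f x ≡ f y → f′ x ≡ f′ y) × Inv f′ es × Surjective f′ × k ≤ k′ + m

merge : ∀ (f : Fin N → Fin k) → Surjective f → ∀ r v → Coarsening f [ (r , [ v ]) ] 1
merge {k = k} f surj r v with f v Fin.≟ f r
... | yes e = k , f , id , ((λ { x (here refl) → e }) ∷ []) , surj , ℕ.m≤m+n k 1
merge {k = zero}  f surj r v | no _ with () ← f r
merge {N} {suc k} f surj r v | no ne = k , f′ , coarsens , ((λ { x (here refl) → glued }) ∷ []) , surj′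
                                     , ℕ.≤-reflexive (ℕ.+-comm 1 k)
  where
  -- The label of `v` is removed, and its points take over the label of `r`, which `ne` shows to be
  -- a different one.
  f′ : Fin N → Fin k
  f′ x with f v Fin.≟ f x
  ... | yes _ = punchOut ne
  ... | no p  = punchOut p
  coarsens : ∀ {x y} → f x ≡ f y → f′ x ≡ f′ y
  coarsens {x} {y} e with f v Fin.≟ f x | f v Fin.≟ f y
  ... | yes _ | yes _ = refl
  ... | yes p | no q  = ⊥-elim (q (trans p e))
  ... | no p  | yes q = ⊥-elim (p (trans q (sym e)))
  ... | no p  | no q  = Fin.punchOut-cong (f v) e
  glued : f′ v ≡ f′ r
  glued with f v Fin.≟ f v | f v Fin.≟ f r
  ... | yes _ | yes p = ⊥-elim (ne p)
  ... | yes _ | no p  = Fin.punchOut-cong (f v) refl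
  ... | no p  | _     = ⊥-elim (p refl)
  surj′ : Surjective f′
  surj′ y with surj (punchIn (f v) y)
  ... | x , e = x , value
    where
    value : f′ x ≡ y
    value with f v Fin.≟ f x
    ... | yes p = ⊥-elim (Fin.punchInᵢ≢i (f v) y (sym (trans p e)))
    ... | no p  = trans (Fin.punchOut-cong (f v) e) (Fin.punchOut-punchIn (f v))

mergeAll : ∀ (f : Fin N → Fin k) → Surjective f → ∀ r vs → Coarsening f [ (r , vs) ] (length vs)
mergeAll {k = k} f surj r []       = k , f , id , ((λ _ ()) ∷ []) , surj , ℕ.m≤m+n k 0
mergeAll {k = k} f surj r (v ∷ vs) with merge f surj r v
... | k₁ , f₁ , c₁ , (i₁ ∷ []) , s₁ , le₁ with mergeAll f₁ s₁ r vs
... | k₂ , f₂ , c₂ , (i₂ ∷ []) , s₂ , le₂ = k₂ , f₂ , c₂ ∘ c₁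
    , ((λ { x (here refl) → c₂ (i₁ x (here refl)) ; x (there p) → i₂ x p }) ∷ []) , s₂ , (begin
      k                        ≤⟨ le₁ ⟩
      k₁ + 1                   ≤⟨ ℕ.+-monoˡ-≤ 1 le₂ ⟩
      k₂ + length vs + 1       ≡⟨ ℕ.+-assoc k₂ (length vs) 1 ⟩
      k₂ + (length vs + 1)     ≡⟨ cong (k₂ +_) (ℕ.+-comm (length vs) 1) ⟩
      k₂ + suc (length vs)     ∎)
  where open ℕ.≤-Reasoning

-- Start with all labels distinct; a factor with j points costs at most j - 1 of them.
components : ∀ (es : List (Edge (Fin N))) → ∃₂ λ k (f : Fin N → Fin k) →
             Inv f es × Surjective f × N ≤ k + edgeWeight es
components {N} []              = N , id , [] , (λ y → y , refl) , ℕ.m≤m+n N 0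
components {N} ((r , vs) ∷ es) with components es
... | k , f , i , s , le with mergeAll f s r vs
... | k′ , f′ , c , (i′ ∷ []) , s′ , le′ = k′ , f′ , i′ ∷ All.map (λ h x x∈ → c (h x x∈)) i , s′ , (begin
      N                                    ≤⟨ le ⟩
      k + edgeWeight es                    ≤⟨ ℕ.+-monoˡ-≤ (edgeWeight es) le′ ⟩
      k′ + length vs + edgeWeight es       ≡⟨ ℕ.+-assoc k′ (length vs) _ ⟩
      k′ + (length vs + edgeWeight es)     ∎)
  where open ℕ.≤-Reasoning

Inv-cycle : ∀ {f : Fin N → Fin k} {r} ws → (∀ x → x ∈ ws → f x ≡ f r) → ∀ x → f (cycle r ws x) ≡ f x
Inv-cycle []       i x = refl
Inv-cycle {f = f} {r} (w ∷ ws) i x = trans (Inv-cycle ws (λ y y∈ → i y (there y∈)) _) step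
  where
  step : f (transposition r w x) ≡ f x
  step with position r w x
  ... | left refl   = trans (cong f (transposition-left x w)) (i w (here refl))
  ... | right refl  = trans (cong f (transposition-right r x)) (sym (i x (here refl)))
  ... | off x≢r x≢w = cong f (transposition-fix x≢r x≢w)

Inv-product : ∀ {f : Fin N → Fin k} es → Inv f es → ∀ x → f (product es x) ≡ f x
Inv-product []              []       x = refl
Inv-product ((r , ws) ∷ es) (i ∷ is) x = trans (Inv-product es is _) (Inv-cycle ws i x)

Path-constant : ∀ {f : Fin N → Fin k} {g u t} ws → (∀ x → f (g x) ≡ f x) → Path g u ws t →
                ∀ {x} → x ∈ u ∷ ws → f x ≡ f u
Path-constant ws       h p       (here refl) = refl
Path-constant {f = f} {u = u} (w ∷ ws) h (p , q) (there x∈) =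
  trans (Path-constant ws h q x∈) (trans (cong f (sym p)) (h u))

successors : ∀ n → List (Fin (suc n))
successors n = tabulate suc

successors-unique : ∀ n → Unique (zero ∷ successors n)
successors-unique n = allFin⁺ (suc n)

longCycle-path : ∀ n → Path (longCycle n) zero (successors n) zero
longCycle-path n = go n zero suc refl (λ _ → refl) refl
  where
  toℕ-mod : ∀ a → toℕ (a mod suc n) ≡ a % suc n
  toℕ-mod a = Fin.toℕ-fromℕ< _
  -- `k` is the value of the current point and `m` the number of points still to come. The reduction
  -- modulo `suc n` takes effect only at the last step, where `m` is zero.
  go : ∀ m (u : Fin (suc n)) (h : Fin m → Fin (suc n)) {k} → toℕ u ≡ k → (∀ i → toℕ (h i) ≡ suc (k + toℕ i)) →
       k + m ≡ n → Path (longCycle n) u (tabulate h) zero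
  go zero u h {k} eu eh e = Fin.toℕ-injective (trans (toℕ-mod (suc (toℕ u)))
    (trans (cong (λ z → suc z % suc n) (trans eu (trans (sym (ℕ.+-identityʳ k)) e))) (n%n≡0 (suc n))))
  go (suc m) u h {k} eu eh e = Fin.toℕ-injective (trans (toℕ-mod (suc (toℕ u)))
      (trans (cong (λ z → suc z % suc n) eu) (trans (m<n⇒m%n≡m (s≤s k<n))
        (sym (trans (eh zero) (cong suc (ℕ.+-identityʳ k)))))))
    , go m (h zero) (h ∘ suc) (trans (eh zero) (cong suc (ℕ.+-identityʳ k)))
        (λ i → trans (eh (suc i)) (cong suc (ℕ.+-suc k (toℕ i)))) (trans (sym (ℕ.+-suc k m)) e)
    where
    k<n : k < n
    k<n = subst (suc k ≤_) (trans (sym (ℕ.+-suc k m)) e) (s≤s (ℕ.m≤m+n k m))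

-- A labelling constant on the factors is constant along the orbits of their product. Here there is
-- a single orbit, hence at most one label, but a list of degree below n leaves at least two.
not-redundant : ∀ n (es : List (Edge (Fin (suc n)))) → edgeWeight es ≡ n → product es ≗ longCycle n → ¬ Redundant es
not-redundant n es we prod≗ (es₀ , lt , det) with components es₀
... | k , f , i , s , le = ℕ.<-irrefl refl (begin-strict
    suc n                     ≤⟨ le ⟩
    k + edgeWeight es₀        <⟨ ℕ.+-monoʳ-< k (subst (edgeWeight es₀ <_) we lt) ⟩
    k + n                     ≤⟨ ℕ.+-monoˡ-≤ n (k≤1 f s constant) ⟩
    suc n                     ∎)
  where
  open ℕ.≤-Reasoning
  constant : ∀ x → f x ≡ f zero
  constant x = Path-constant (successors n) (λ y → trans (cong f (sym (prod≗ y))) (Inv-product es (det f i) y))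
    (longCycle-path n) (∈-allFin x)
  k≤1 : ∀ {k} (f : Fin (suc n) → Fin k) → Surjective f → (∀ x → f x ≡ f zero) → k ≤ 1
  k≤1 {zero}        f s c = z≤n
  k≤1 {suc zero}    f s c = s≤s z≤n
  k≤1 {suc (suc k)} f s c with trans (trans (sym (proj₂ (s zero))) (c _)) (trans (sym (c _)) (proj₂ (s (suc zero))))
  ... | ()

length-forest : ∀ (Φ : List (V × Tree V)) → length (proj₁ (forest Φ)) ≡ length Φ + edgeWeight (proj₂ (forest Φ))
length-forest []            = refl
length-forest ((r , T) ∷ Φ) = cong suc (begin
  length (word T ++ proj₁ (forest Φ))                            ≡⟨ length-++ (word T) ⟩
  length (word T) + length (proj₁ (forest Φ))                    ≡⟨ cong₂ _+_ (length-factors r T) (length-forest Φ) ⟩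
  edgeWeight (factors r T) + (length Φ + edgeWeight (proj₂ (forest Φ))) ≡⟨ rearrange (edgeWeight (factors r T)) (length Φ) _ ⟩
  length Φ + (edgeWeight (factors r T) + edgeWeight (proj₂ (forest Φ)))
    ≡⟨ cong (length Φ +_) (sym (trans (cong degreeSum (map-++ edgeSize (factors r T) _)) (degreeSum-++ (map edgeSize (factors r T)) _))) ⟩
  length Φ + edgeWeight (factors r T ++ proj₂ (forest Φ))        ∎)
  where
  open ≡-Reasoning
  rearrange : ∀ a b c → a + (b + c) ≡ b + (a + c)
  rearrange = solve-∀

-- Counting vertices by `length-forest` leaves exactly one tree. Re-rooted at the first point, it
-- has as contour word the orbit of that point under the product, which is the long cycle.
realise : ∀ n (es : List (Edge (Fin (suc n)))) → edgeWeight es ≡ n → product es ≗ longCycle n →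
          ∃ λ T → word T ≡ successors n × es ≈ factors zero T
realise n es we prod≗ with build es
... | inj₂ red = ⊥-elim (not-redundant n es we prod≗ red)
... | inj₁ (Φ , perm , es≈) = fromForest Φ perm es≈ single
  where
  single : length Φ ≡ 1
  single = ℕ.+-cancelʳ-≡ n (length Φ) 1 (begin
    length Φ + n                               ≡⟨ cong (length Φ +_) (trans (sym we) (degreeSum-↭ (≈⇒sizes↭ es≈))) ⟩
    length Φ + edgeWeight (proj₂ (forest Φ))   ≡⟨ sym (length-forest Φ) ⟩
    length (proj₁ (forest Φ))                  ≡⟨ ↭-length perm ⟩
    length (allFin (suc n))                    ≡⟨ length-tabulate {n = suc n} id ⟩
    suc n                                      ∎)
    where open ≡-Reasoning
  fromForest : ∀ Φ → proj₁ (forest Φ) ↭ allFin (suc n) → es ≈ proj₂ (forest Φ) → length Φ ≡ 1 →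
               ∃ λ T → word T ≡ successors n × es ≈ factors zero T
  fromForest ((r , T) ∷ []) p e _ with reroot′ r T (subst (zero ∈_) (++-identityʳ (r ∷ word T)) (∈-resp-↭ (↭-sym p) (here refl)))
  ... | T′ , q , f = T′ , word≡ , e′
    where
    p′ : r ∷ word T ↭ allFin (suc n)
    p′ = subst (_↭ allFin (suc n)) (++-identityʳ (r ∷ word T)) p
    u′ : Unique (zero ∷ word T′)
    u′ = Unique-↭ (↭-trans (↭-sym p′) q) (allFin⁺ (suc n))
    e′ : es ≈ factors zero T′
    e′ = ≈trans e (≈trans (≡⇒≈ (++-identityʳ (factors r T))) (f (Unique-↭ (↭-sym p′) (allFin⁺ (suc n)))))
    word≡ : word T′ ≡ successors n
    word≡ = Path-determined (word T′) (successors n)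
      (Path-cong (word T′) (λ {x} _ → trans (sym (product-factors zero T′ u′ x)) (trans (sym (product-≈ e′ x)) (prod≗ x)))
        (cycle-path zero (word T′) u′))
      (longCycle-path n) (Unique[x∷xs]⇒x∉xs u′) (Unique[x∷xs]⇒x∉xs (successors-unique n))

-- Inequivalence of distinct cacti

MeetAtMostOnce : List V → List V → Set
MeetAtMostOnce X Y = ∀ x y → x ∈ X → x ∈ Y → y ∈ X → y ∈ Y → x ≡ y

Meet : Edge V → Edge V → Set
Meet e f = MeetAtMostOnce (support e) (support f)

Meet-sym : ∀ {e f : Edge V} → Meet e f → Meet f e
Meet-sym m x y a b c d = m x y b a d c

Meet-cross : ∀ {X Y : List V} {es fs} → Within X es → Within Y fs → MeetAtMostOnce X Y →
             All (λ e → All (Meet e) fs) es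
Meet-cross p q m = All.map (λ i → All.map (λ j x y a b c d → m x y (i a) (j b) (i c) (j d)) q) p

disjoint⇒meet : ∀ {X Y : List V} → Disjoint X Y → MeetAtMostOnce X Y
disjoint⇒meet d x y a b _ _ = ⊥-elim (d (a , b))

only⇒meet : ∀ {X Y : List V} v → (∀ x → x ∈ X → x ∈ Y → x ≡ v) → MeetAtMostOnce X Y
only⇒meet v o x y a b c d = trans (o x a b) (sym (o y c d))

AllPairs-↭ : ∀ {A : Set} {R : A → A → Set} → (∀ {x y} → R x y → R y x) →
             ∀ {xs ys} → xs ↭ ys → AllPairs R xs → AllPairs R ys
AllPairs-↭ {A} {R} R-sym p = PermSetoid.AllPairs-resp-↭ (setoid A) R-sym (resp₂ R) (Perm.↭⇒↭ₛ p)

module _ {V : Set} where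
  open CMSolver (++-commutativeMonoid {A = V}) hiding (_⊕_; id)
  open CMSolver (++-commutativeMonoid {A = V}) using () renaming (_⊕_ to _∙_; id to ∅)
  private module E = CMSolver (++-commutativeMonoid {A = Edge V})

  -- Polygons are glued at single vertices: parts hanging at different vertices are disjoint, and
  -- the two parts at one vertex share only that vertex with each other and with the polygon.
  factors-meet : ∀ (r : V) T → Unique (r ∷ word T) → AllPairs Meet (factors r T)
  branches-meet : ∀ (r : V) b → Unique (r ∷ wordB b) →
    All (Meet (r , verts b)) (before b ++ after b) × AllPairs Meet (before b ++ after b)
  factors-meet r leaf       u = []
  factors-meet r (node b C) u with branches-meet r b (proj₁ (Unique-++⁻ (r ∷ wordB b) u))
  ... | root , pairs = AllPairs-↭ Meet-sym
    (E.solve 4 (λ p e q c → (e E.⊕ ((p E.⊕ q) E.⊕ c)) E.⊜ (p E.⊕ (e E.⊕ (q E.⊕ c)))) ↭-refl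
      (before b) [ (r , verts b) ] (after b) (factors r C))
    (All.++⁺ root (All.head (Meet-cross (id ∷ []) (factors-within r C) (only⇒meet r rootOnly)))
      ∷ AllPairs.++⁺ pairs (factors-meet r C uC)
          (Meet-cross (All.++⁺ (before-within b) (after-within b)) (factors-within r C) (disjoint⇒meet dis)))
    where
    uC : Unique (r ∷ word C)
    uC = uniquePart _ u (solve 3 (λ r b c → (r ∙ (b ∙ c)) ⊜ ((r ∙ c) ∙ b)) ↭-refl [ r ] (wordB b) (word C))
    dis : Disjoint (wordB b) (r ∷ word C)
    dis = disjointParts _ _ {[]} u (solve 3 (λ r b c → (r ∙ (b ∙ c)) ⊜ (b ∙ ((r ∙ c) ∙ ∅))) ↭-refl [ r ] (wordB b) (word C))
    rootOnly : ∀ x → x ∈ r ∷ verts b → x ∈ r ∷ word C → x ≡ r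
    rootOnly x (here refl) _ = refl
    rootOnly x (there p)   q = ⊥-elim (dis (verts⊆wordB b p , q))
  branches-meet r none             u = [] , []
  branches-meet r (branch A v B b) u with branches-meet r b uniqueb
    where
    uniqueb : Unique (r ∷ wordB b)
    uniqueb = uniquePart _ u (solve 5 (λ r a v b c → (r ∙ (a ∙ (v ∙ (b ∙ c)))) ⊜ ((r ∙ c) ∙ (v ∙ (a ∙ b))))
      ↭-refl [ r ] (word A) [ v ] (word B) (wordB b))
  ... | root , pairs =
      All.++⁺ (All.++⁺ (All.head (Meet-cross (id ∷ []) (factors-within v B) (only⇒meet v onlyB)))
                       (extend (before-within b) (All.++⁻ˡ (before b) root)))
              (All.++⁺ (All.head (Meet-cross (id ∷ []) (factors-within v A) (only⇒meet v onlyA)))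
                       (extend (after-within b) (All.++⁻ʳ (before b) root)))
    , AllPairs-↭ Meet-sym
        (E.solve 4 (λ x y z w → ((x E.⊕ z) E.⊕ (y E.⊕ w)) E.⊜ ((x E.⊕ y) E.⊕ (z E.⊕ w))) ↭-refl
          (factors v B) (before b) (factors v A) (after b))
        (AllPairs.++⁺
          (AllPairs.++⁺ (factors-meet v B uniqueB) (factors-meet v A uniqueA)
            (Meet-cross (factors-within v B) (factors-within v A) (only⇒meet v onlyBA)))
          pairs
          (Meet-cross (All.++⁺ (Within-⊆ ∈-++⁺ˡ (factors-within v B)) (Within-⊆ ∈A (factors-within v A)))
            (All.++⁺ (before-within b) (after-within b)) (disjoint⇒meet disBA)))
    where
    uniqueA : Unique (v ∷ word A)
    uniqueA = uniquePart _ u (solve 5 (λ r a v b c → (r ∙ (a ∙ (v ∙ (b ∙ c)))) ⊜ ((v ∙ a) ∙ (r ∙ (c ∙ b))))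
      ↭-refl [ r ] (word A) [ v ] (word B) (wordB b))
    uniqueB : Unique (v ∷ word B)
    uniqueB = uniquePart _ u (solve 5 (λ r a v b c → (r ∙ (a ∙ (v ∙ (b ∙ c)))) ⊜ ((v ∙ b) ∙ (r ∙ (c ∙ a))))
      ↭-refl [ r ] (word A) [ v ] (word B) (wordB b))
    disBA : Disjoint ((v ∷ word B) ++ word A) (wordB b)
    disBA = disjointParts _ _ u (solve 5 (λ r a v b c → (r ∙ (a ∙ (v ∙ (b ∙ c)))) ⊜ (((v ∙ b) ∙ a) ∙ (c ∙ r)))
      ↭-refl [ r ] (word A) [ v ] (word B) (wordB b))
    disRest : Disjoint (r ∷ wordB b) ((v ∷ word B) ++ word A)
    disRest = disjointParts _ _ {[]} u (solve 5 (λ r a v b c → (r ∙ (a ∙ (v ∙ (b ∙ c)))) ⊜ ((r ∙ c) ∙ (((v ∙ b) ∙ a) ∙ ∅)))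
      ↭-refl [ r ] (word A) [ v ] (word B) (wordB b))
    disAB : Disjoint (word A) (v ∷ word B)
    disAB = disjointParts _ _ u (solve 5 (λ r a v b c → (r ∙ (a ∙ (v ∙ (b ∙ c)))) ⊜ (a ∙ ((v ∙ b) ∙ (r ∙ c))))
      ↭-refl [ r ] (word A) [ v ] (word B) (wordB b))
    ∈A : ∀ {x} → x ∈ v ∷ word A → x ∈ (v ∷ word B) ++ word A
    ∈A (here refl) = here refl
    ∈A (there p)   = ∈-++⁺ʳ (v ∷ word B) p
    offRest : ∀ x → x ∈ r ∷ v ∷ verts b → x ∈ (v ∷ word B) ++ word A → x ≡ v
    offRest x (here refl)         q = ⊥-elim (disRest (here refl , q))
    offRest x (there (here refl)) q = refl
    offRest x (there (there p))   q = ⊥-elim (disRest (there (verts⊆wordB b p) , q))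
    onlyB : ∀ x → x ∈ r ∷ v ∷ verts b → x ∈ v ∷ word B → x ≡ v
    onlyB x p q = offRest x p (∈-++⁺ˡ q)
    onlyA : ∀ x → x ∈ r ∷ v ∷ verts b → x ∈ v ∷ word A → x ≡ v
    onlyA x p q = offRest x p (∈A q)
    onlyBA : ∀ x → x ∈ v ∷ word B → x ∈ v ∷ word A → x ≡ v
    onlyBA x p (here refl) = refl
    onlyBA x p (there q)   = ⊥-elim (disAB (q , p))
    v∉ : v ∉ wordB b
    v∉ p = disBA (here refl , p)
    add : ∀ {f} → (∀ {x} → x ∈ support f → x ∈ wordB b) → Meet (r , verts b) f → Meet (r , v ∷ verts b) f
    add w m x y p q p′ q′ = m x y (drop p q) q (drop p′ q′) q′
      where
      drop : ∀ {x} → x ∈ r ∷ v ∷ verts b → x ∈ _ → x ∈ r ∷ verts b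
      drop (here refl)         q = here refl
      drop (there (here refl)) q = ⊥-elim (v∉ (w q))
      drop (there (there p))   q = there p
    extend : ∀ {fs} → Within (wordB b) fs → All (Meet (r , verts b)) fs → All (Meet (r , v ∷ verts b)) fs
    extend []       []       = []
    extend (w ∷ ws) (m ∷ ms) = add w m ∷ extend ws ms

-- The sequence of factors moving a given point

Moves : Fin N → Perm N → Set
Moves u σ = σ u ≢ u

moves? : ∀ (u : Fin N) σ → Dec (Moves u σ)
moves? u σ = ¬? (σ u Fin.≟ u)

proj : Fin N → List (Perm N) → List (Perm N)
proj u = filter (moves? u)

MeetPerm : Perm N → Perm N → Set
MeetPerm σ τ = ∀ x y → Moves x σ → Moves x τ → Moves y σ → Moves y τ → x ≡ y

-- The condition under which `proj` is invariant. It speaks of permutations and not of codes,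
-- because an equivalence runs through arbitrary lists of permutations.
record Good (fs : List (Perm N)) : Set where
  constructor good
  field
    meet      : AllPairs MeetPerm fs
    injective : All Inj fs

module _ {N : ℕ} where

  MeetPerm-sym : {σ τ : Perm N} → MeetPerm σ τ → MeetPerm τ σ
  MeetPerm-sym m x y a b c d = m x y b a d c

  Moves-≗ : ∀ {σ τ : Perm N} {u} → σ ≗ τ → Moves u σ → Moves u τ
  Moves-≗ {u = u} e m p = m (trans (e u) p)

  ≗-sym : {σ τ : Perm N} → σ ≗ τ → τ ≗ σ
  ≗-sym e x = sym (e x)

  MeetPerm-≗ : {σ σ′ τ τ′ : Perm N} → σ ≗ σ′ → τ ≗ τ′ → MeetPerm σ τ → MeetPerm σ′ τ′
  MeetPerm-≗ e f m x y a b c d =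
    m x y (Moves-≗ (≗-sym e) a) (Moves-≗ (≗-sym f) b) (Moves-≗ (≗-sym e) c) (Moves-≗ (≗-sym f) d)

  All-Swap : ∀ {P : Perm N → Set} {fs gs} → Swap fs gs → All P fs → All P gs
  All-Swap (here c)  (p ∷ q ∷ ps) = q ∷ p ∷ ps
  All-Swap (there s) (p ∷ ps)     = p ∷ All-Swap s ps

  All-≗ : ∀ {P : Perm N → Set} → (∀ {σ τ} → σ ≗ τ → P σ → P τ) →
          ∀ {fs gs} → Pointwise _≗_ fs gs → All P fs → All P gs
  All-≗ r []       []       = []
  All-≗ r (e ∷ es) (p ∷ ps) = r e p ∷ All-≗ r es ps

  Good-Swap : ∀ {fs gs : List (Perm N)} → Swap fs gs → Good fs → Good gs
  Good-Swap s (good m i) = good (swapped s m) (All-Swap s i)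
    where
    swapped : ∀ {fs gs : List (Perm N)} → Swap fs gs → AllPairs MeetPerm fs → AllPairs MeetPerm gs
    swapped (here c)  ((m ∷ ms) ∷ ns ∷ rest) = (MeetPerm-sym m ∷ ns) ∷ ms ∷ rest
    swapped (there s) (ms ∷ rest)            = All-Swap s ms ∷ swapped s rest

  Good-≗ : ∀ {fs gs : List (Perm N)} → Pointwise _≗_ fs gs → Good fs → Good gs
  Good-≗ e (good m i) = good (respects e m)
    (All-≗ (λ e inj {x} {y} p → inj (trans (e x) (trans p (sym (e y))))) e i)
    where
    respects : ∀ {fs gs : List (Perm N)} → Pointwise _≗_ fs gs → AllPairs MeetPerm fs → AllPairs MeetPerm gs
    respects []       []         = []
    respects (e ∷ es) (ms ∷ rest) =
      All-≗ (λ f → MeetPerm-≗ (λ _ → refl) f) es (All.map (MeetPerm-≗ e (λ _ → refl)) ms) ∷ respects es rest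

  -- If `σ` fixes `τ u`, then commutation and injectivity of `τ` make it fix `u`. Otherwise both
  -- factors move `τ u` as well as `u`, so these two points coincide and `τ` fixes `u`.
  commuting-disjoint : ∀ {σ τ : Perm N} u → Inj τ → MeetPerm σ τ → σ ∘ τ ≗ τ ∘ σ → Moves u σ → Moves u τ → ⊥
  commuting-disjoint {σ} {τ} u inj m c mσ mτ with σ (τ u) Fin.≟ τ u
  ... | yes p = mσ (inj (trans (sym (c u)) p))
  ... | no ¬p = mτ (m (τ u) u ¬p (λ q → mτ (inj q)) mσ mτ)

  skip : ∀ {u : Fin N} σ fs → σ u ≡ u → proj u (σ ∷ fs) ≡ proj u fs
  skip {u} σ fs p = filter-reject (moves? u) {x = σ} {xs = fs} (λ m → m p)

  keep : ∀ {u : Fin N} σ fs → Moves u σ → proj u (σ ∷ fs) ≡ σ ∷ proj u fs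
  keep {u} σ fs = filter-accept (moves? u) {x = σ} {xs = fs}

  -- A swap could alter the sequence at `u` only if both factors moved `u`, which
  -- `commuting-disjoint` forbids.
  proj-Swap : ∀ u {fs gs : List (Perm N)} → Swap fs gs → Good fs → proj u fs ≡ proj u gs
  proj-Swap u (here {σ} {τ} {l} c) (good ((m ∷ _) ∷ _) (_ ∷ inj ∷ _)) = cases (σ u Fin.≟ u) (τ u Fin.≟ u)
    where
    cases : Dec (σ u ≡ u) → Dec (τ u ≡ u) → proj u (σ ∷ τ ∷ l) ≡ proj u (τ ∷ σ ∷ l)
    cases (yes p) (yes q) = trans (trans (skip σ (τ ∷ l) p) (skip τ l q)) (sym (trans (skip τ (σ ∷ l) q) (skip σ l p)))
    cases (yes p) (no q)  = trans (trans (skip σ (τ ∷ l) p) (keep τ l q)) (sym (trans (keep τ (σ ∷ l) q) (cong (τ ∷_) (skip σ l p))))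
    cases (no p)  (yes q) = trans (trans (keep σ (τ ∷ l) p) (cong (σ ∷_) (skip τ l q))) (sym (trans (skip τ (σ ∷ l) q) (keep σ l p)))
    cases (no p)  (no q)  = ⊥-elim (commuting-disjoint u inj m c p q)
  proj-Swap u (there {σ} {l} {l′} s) (good (_ ∷ ms) (_ ∷ is)) = cases (σ u Fin.≟ u)
    where
    cases : Dec (σ u ≡ u) → proj u (σ ∷ l) ≡ proj u (σ ∷ l′)
    cases (yes p) = trans (skip σ l p) (trans (proj-Swap u s (good ms is)) (sym (skip σ l′ p)))
    cases (no p)  = trans (keep σ l p) (trans (cong (σ ∷_) (proj-Swap u s (good ms is))) (sym (keep σ l′ p)))

  proj-≗ : ∀ u {fs gs : List (Perm N)} → Pointwise _≗_ fs gs → Pointwise _≗_ (proj u fs) (proj u gs)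
  proj-≗ u = Pointwise.filter⁺ (moves? u) (moves? u) (λ e → Moves-≗ e) (λ e → Moves-≗ (≗-sym e))

  ≋-trans : ∀ {fs gs hs : List (Perm N)} → Pointwise _≗_ fs gs → Pointwise _≗_ gs hs → Pointwise _≗_ fs hs
  ≋-trans = Pointwise.transitive (λ p q x → trans (p x) (q x))

  proj-Equiv : ∀ {fs gs : List (Perm N)} → Equiv fs gs → Good fs → ∀ u → Pointwise _≗_ (proj u fs) (proj u gs)
  proj-Equiv ε            g u = ≗-refl
  proj-Equiv (inj₁ s ◅ p) g u =
    subst (λ z → Pointwise _≗_ z _) (sym (proj-Swap u s g)) (proj-Equiv p (Good-Swap s g) u)
  proj-Equiv (inj₂ e ◅ p) g u = ≋-trans (proj-≗ u e) (proj-Equiv p (Good-≗ e g) u)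

  moved⇒support : ∀ (e : Edge (Fin N)) {u} → Moves u (perm e) → u ∈ support e
  moved⇒support (r , ws) {u} m = decidable-stable (_∈?_ Fin._≟_ u (r ∷ ws)) (λ u∉ → m (cycle-fix ws u∉))

  factors-good : ∀ (r : Fin N) T → Unique (r ∷ word T) → Good (map perm (factors r T))
  factors-good r T u = good
    (AllPairs.map⁺ (AllPairs′.map (λ {e} {f} m x y a b c d →
      m x y (moved⇒support e a) (moved⇒support f b) (moved⇒support e c) (moved⇒support f d)) (factors-meet r T u)))
    (All.map⁺ (All.universal (λ (s , ws) {x} {y} → cycle-injective s ws {x} {y}) (factors r T)))

  Proper : Tree (Fin N) → Set
  Proper T = All (2 ≤_) (sizes T)

  ProperB : Branches (Fin N) → Set
  ProperB b = All (2 ≤_) (sizesB b)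

  cycle-root-moves : ∀ {r : Fin N} w ws → Unique (r ∷ w ∷ ws) → Moves r (cycle r (w ∷ ws))
  cycle-root-moves w ws u@((r≢w ∷ _) ∷ _) e = r≢w (trans (sym e) (proj₁ (cycle-path _ (w ∷ ws) u)))

  -- A vertex other than the base point is first made the base point by `rotation`.
  cycle-moves : ∀ (e : Edge (Fin N)) → 2 ≤ edgeSize e → Unique (support e) → ∀ {u} → u ∈ support e → Moves u (perm e)
  cycle-moves (r , [])     (s≤s ())
  cycle-moves (r , w ∷ ws) _ u (here refl) = cycle-root-moves w ws u
  cycle-moves (r , w ∷ ws) _ u {x} (there x∈) with ∈-∃++ x∈
  ... | ys , zs , eq = inside (w ∷ ws) eq u
    where
    rootMoves : ∀ zs → Unique (x ∷ zs ++ r ∷ ys) → Moves x (cycle x (zs ++ r ∷ ys))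
    rootMoves []       u = cycle-root-moves r ys u
    rootMoves (z ∷ zs) u = cycle-root-moves z (zs ++ r ∷ ys) u
    inside : ∀ ls → ls ≡ ys ++ x ∷ zs → Unique (r ∷ ls) → Moves x (cycle r ls)
    inside .(ys ++ x ∷ zs) refl u e =
      rootMoves zs (Unique-↭ (++-comm (r ∷ ys) (x ∷ zs)) u) (trans (sym (rotation ys zs u x)) e)

  -- The polygons at the root in order of application: the value that `proj` must take there.
  roots : Fin N → Tree (Fin N) → List (Edge (Fin N))
  roots r leaf       = []
  roots r (node b C) = (r , verts b) ∷ roots r C

  roots-within : ∀ r T → Within (r ∷ word T) (roots r T)
  roots-within r leaf       = []
  roots-within r (node b C) =
      (λ { (here refl) → here refl ; (there p) → there (∈-++⁺ˡ (verts⊆wordB b p)) })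
    ∷ Within-⊆ (λ { (here refl) → here refl ; (there p) → there (∈-++⁺ʳ (wordB b) p) }) (roots-within r C)

  projE : Fin N → List (Edge (Fin N)) → List (Perm N)
  projE u es = proj u (map perm es)

  projE-++ : ∀ u es fs → projE u (es ++ fs) ≡ projE u es ++ projE u fs
  projE-++ u es fs = trans (cong (proj u) (map-++ perm es fs)) (filter-++ (moves? u) (map perm es) (map perm fs))

  projE-none : ∀ u {X es} → Within X es → u ∉ X → projE u es ≡ []
  projE-none u {X} w u∉ = filter-none (moves? u) (All.map⁺ (All.map (λ {e} i m → u∉ (i (moved⇒support e m))) w))

  projE-one : ∀ u e {es} → 2 ≤ edgeSize e → Unique (support e) → u ∈ support e →
              projE u (e ∷ es) ≡ perm e ∷ projE u es
  projE-one u e {es} le un u∈ = keep (perm e) (map perm es) (cycle-moves e le un u∈)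

  projE-root : ∀ r T → Unique (r ∷ word T) → Proper T → projE r (factors r T) ≡ map perm (roots r T)
  projE-root r leaf       u p = refl
  projE-root r (node b C) u@(r≢ ∷ u′) (pb ∷ ps) = begin
    projE r (before b ++ (r , verts b) ∷ after b ++ factors r C)
      ≡⟨ trans (projE-++ r (before b) _) (cong (_++ projE r ((r , verts b) ∷ after b ++ factors r C)) (projE-none r (before-within b) r∉b)) ⟩
    projE r ((r , verts b) ∷ after b ++ factors r C)
      ≡⟨ projE-one r (r , verts b) pb (root-unique r b u) (here refl) ⟩
    cycle r (verts b) ∷ projE r (after b ++ factors r C)
      ≡⟨ cong (cycle r (verts b) ∷_) (trans (projE-++ r (after b) _) (cong (_++ projE r (factors r C)) (projE-none r (after-within b) r∉b))) ⟩
    cycle r (verts b) ∷ projE r (factors r C)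
      ≡⟨ cong (cycle r (verts b) ∷_) (projE-root r C uC (All.++⁻ʳ (sizesB b) ps)) ⟩
    cycle r (verts b) ∷ map perm (roots r C) ∎
    where
    open ≡-Reasoning
    r∉b : r ∉ wordB b
    r∉b p = All.lookup r≢ (∈-++⁺ˡ p) refl
    uC : Unique (r ∷ word C)
    uC = All.++⁻ʳ (wordB b) r≢ ∷ proj₁ (proj₂ (Unique-++⁻ (wordB b) u′))

  -- At each vertex of T, the factors of G moving it are, in order, the
  -- polygons hanging from it in T; so G determines T from the root down.
  Embedded  : List (Perm N) → Fin N → Tree (Fin N) → Set
  EmbeddedB : List (Perm N) → Edge (Fin N) → Branches (Fin N) → Set
  Embedded G r leaf       = ⊤
  Embedded G r (node b C) = EmbeddedB G (r , verts b) b × Embedded G r C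
  EmbeddedB G e none             = ⊤
  EmbeddedB G e (branch A v B b) =
    (proj v G ≡ map perm (roots v B) ++ perm e ∷ map perm (roots v A)) ×
    Embedded G v A × Embedded G v B × EmbeddedB G e b

  embedded  : ∀ G r T → Unique (r ∷ word T) → Proper T →
              (∀ {u} → u ∈ word T → proj u G ≡ projE u (factors r T)) → Embedded G r T
  -- Localization: a point below the polygon `e` is moved only by `e` and by the factors of its own
  -- part, so the hypothesis on `proj` passes to the subtrees. `sep` records that, among the points
  -- of the remaining branches, only the remaining vertices lie on `e`.
  embeddedB : ∀ G e b → 2 ≤ edgeSize e → Unique (support e) → (∀ {u} → u ∈ verts b → u ∈ support e) →
              Unique (wordB b) → ProperB b → (∀ {u} → u ∈ wordB b → u ∈ support e → u ∈ verts b) →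
              (∀ {u} → u ∈ wordB b → proj u G ≡ projE u (before b) ++ projE u [ e ] ++ projE u (after b)) →
              EmbeddedB G e b
  embedded G r leaf       u p h = tt
  embedded G r (node b C) u@(r≢ ∷ u′) (pb ∷ ps) h =
      embeddedB G (r , verts b) b pb (root-unique r b u) there (proj₁ split) (All.++⁻ˡ (sizesB b) ps) sep hb
    , embedded G r C (All.++⁻ʳ (wordB b) r≢ ∷ proj₁ (proj₂ split)) (All.++⁻ʳ (sizesB b) ps) hC
    where
    split = Unique-++⁻ (wordB b) u′
    expand : ∀ u → projE u (factors r (node b C))
           ≡ projE u (before b) ++ projE u [ (r , verts b) ] ++ projE u (after b) ++ projE u (factors r C)
    expand u = trans (projE-++ u (before b) _) (cong (projE u (before b) ++_)
      (trans (projE-++ u [ (r , verts b) ] _) (cong (projE u [ (r , verts b) ] ++_) (projE-++ u (after b) _))))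
    sep : ∀ {u} → u ∈ wordB b → u ∈ r ∷ verts b → u ∈ verts b
    sep p (here refl) = ⊥-elim (All.lookup r≢ (∈-++⁺ˡ p) refl)
    sep p (there q)   = q
    hb : ∀ {u} → u ∈ wordB b → proj u G ≡ projE u (before b) ++ projE u [ (r , verts b) ] ++ projE u (after b)
    hb {u} p = trans (h (∈-++⁺ˡ p)) (trans (expand u)
      (cong (λ z → projE u (before b) ++ projE u [ (r , verts b) ] ++ z)
        (trans (cong (projE u (after b) ++_) (projE-none u (factors-within r C) u∉)) (++-identityʳ _))))
      where
      u∉ : u ∉ r ∷ word C
      u∉ (here refl) = All.lookup r≢ (∈-++⁺ˡ p) refl
      u∉ (there q)   = proj₂ (proj₂ split) (p , q)
    hC : ∀ {u} → u ∈ word C → proj u G ≡ projE u (factors r C)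
    hC {u} p = trans (h (∈-++⁺ʳ (wordB b) p)) (trans (expand u)
      (cong₂ _++_ (projE-none u (before-within b) u∉b)
        (cong₂ _++_ (projE-none u {X = support (r , verts b)} (id ∷ []) u∉e)
          (cong (_++ projE u (factors r C)) (projE-none u (after-within b) u∉b)))))
      where
      u∉b : u ∉ wordB b
      u∉b q = proj₂ (proj₂ split) (q , p)
      u∉e : u ∉ r ∷ verts b
      u∉e (here refl) = All.lookup r≢ (∈-++⁺ʳ (wordB b) p) refl
      u∉e (there q)   = u∉b (verts⊆wordB b q)
  embeddedB G e none             le ue inc u p sep h = tt
  embeddedB G e (branch A v B b) le ue inc u p sep h =
      atv
    , embedded G v A (All.tabulate (λ q e → v∉A (subst (_∈ word A) (sym e) q)) ∷ proj₁ splitA)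
        (All.++⁻ˡ (sizes A) p) hA
    , embedded G v B (All.++⁻ˡ (word B) v≢ ∷ proj₁ splitB) (All.++⁻ˡ (sizes B) p′) hB
    , embeddedB G e b le ue (λ q → inc (there q)) (proj₁ (proj₂ splitB)) (All.++⁻ʳ (sizes B) p′) sepb hb
    where
    open ≡-Reasoning
    p′ = All.++⁻ʳ (sizes A) p
    splitA = Unique-++⁻ (word A) u
    v≢ = AllPairs′.head (proj₁ (proj₂ splitA))
    splitB = Unique-++⁻ (word B) (AllPairs′.tail (proj₁ (proj₂ splitA)))
    v∉A : v ∉ word A
    v∉A q = proj₂ (proj₂ splitA) (q , here refl)
    v∉b : v ∉ wordB b
    v∉b q = All.lookup v≢ (∈-++⁺ʳ (word B) q) refl
    ∈Bv : ∀ {x} → x ∈ word B → x ∈ word A ++ v ∷ word B ++ wordB b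
    ∈Bv q = ∈-++⁺ʳ (word A) (there (∈-++⁺ˡ q))
    ∈bv : ∀ {x} → x ∈ wordB b → x ∈ word A ++ v ∷ word B ++ wordB b
    ∈bv q = ∈-++⁺ʳ (word A) (there (∈-++⁺ʳ (word B) q))
    parts : ∀ u {fB fb m fA fa} → projE u (factors v B) ≡ fB → projE u (before b) ≡ fb → projE u [ e ] ≡ m →
            projE u (factors v A) ≡ fA → projE u (after b) ≡ fa →
            projE u (before (branch A v B b)) ++ projE u [ e ] ++ projE u (after (branch A v B b))
            ≡ (fB ++ fb) ++ m ++ fA ++ fa
    parts u e₁ e₂ e₃ e₄ e₅ = cong₂ _++_ (trans (projE-++ u (factors v B) _) (cong₂ _++_ e₁ e₂))
      (cong₂ _++_ e₃ (trans (projE-++ u (factors v A) _) (cong₂ _++_ e₄ e₅)))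
    off-e : ∀ {u} → u ∈ word A ++ v ∷ word B ++ wordB b → u ≢ v → u ∉ verts b → projE u [ e ] ≡ []
    off-e {u} u∈ u≢v u∉ = projE-none u {X = support e} (id ∷ []) λ q → case (sep u∈ q)
      where
      case : u ∈ v ∷ verts b → ⊥
      case (here q)  = u≢v q
      case (there q) = u∉ q
    atv : proj v G ≡ map perm (roots v B) ++ perm e ∷ map perm (roots v A)
    atv = trans (h (∈-++⁺ʳ (word A) (here refl))) (trans
      (parts v (projE-root v B (All.++⁻ˡ (word B) v≢ ∷ proj₁ splitB) (All.++⁻ˡ (sizes B) p′))
        (projE-none v (before-within b) v∉b)
        (projE-one v e {[]} le ue (inc (here refl)))
        (projE-root v A (All.tabulate (λ q e → v∉A (subst (_∈ word A) (sym e) q)) ∷ proj₁ splitA) (All.++⁻ˡ (sizes A) p))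
        (projE-none v (after-within b) v∉b))
      (cong₂ _++_ (++-identityʳ _) (cong (perm e ∷_) (++-identityʳ _))))
    hA : ∀ {u} → u ∈ word A → proj u G ≡ projE u (factors v A)
    hA {u} q = trans (h (∈-++⁺ˡ q)) (trans
      (parts u (projE-none u (factors-within v B) u∉B) (projE-none u (before-within b) u∉b)
        (off-e (∈-++⁺ˡ q) u≢v (λ s → u∉b (verts⊆wordB b s))) refl (projE-none u (after-within b) u∉b))
      (++-identityʳ _))
      where
      u≢v : u ≢ v
      u≢v refl = v∉A q
      u∉B : u ∉ v ∷ word B
      u∉B (here s)  = u≢v s
      u∉B (there s) = proj₂ (proj₂ splitA) (q , there (∈-++⁺ˡ s))
      u∉b : u ∉ wordB b
      u∉b s = proj₂ (proj₂ splitA) (q , there (∈-++⁺ʳ (word B) s))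
    hB : ∀ {u} → u ∈ word B → proj u G ≡ projE u (factors v B)
    hB {u} q = trans (h (∈Bv q)) (trans
      (parts u refl (projE-none u (before-within b) u∉b)
        (off-e (∈Bv q) u≢v (λ s → u∉b (verts⊆wordB b s)))
        (projE-none u (factors-within v A) u∉A) (projE-none u (after-within b) u∉b))
      (trans (++-identityʳ _) (++-identityʳ _)))
      where
      u≢v : u ≢ v
      u≢v refl = All.lookup v≢ (∈-++⁺ˡ q) refl
      u∉A : u ∉ v ∷ word A
      u∉A (here s)  = u≢v s
      u∉A (there s) = proj₂ (proj₂ splitA) (s , there (∈-++⁺ˡ q))
      u∉b : u ∉ wordB b
      u∉b s = proj₂ (proj₂ splitB) (q , s)
    sepb : ∀ {u} → u ∈ wordB b → u ∈ support e → u ∈ verts b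
    sepb q s with sep (∈bv q) s
    ... | here refl = ⊥-elim (v∉b q)
    ... | there t   = t
    hb : ∀ {u} → u ∈ wordB b → proj u G ≡ projE u (before b) ++ projE u [ e ] ++ projE u (after b)
    hb {u} q = trans (h (∈bv q)) (parts u (projE-none u (factors-within v B) u∉B) refl refl
        (projE-none u (factors-within v A) u∉A) refl)
      where
      u≢v : u ≢ v
      u≢v refl = v∉b q
      u∉A : u ∉ v ∷ word A
      u∉A (here s)  = u≢v s
      u∉A (there s) = proj₂ (proj₂ splitA) (s , there (∈-++⁺ʳ (word B) q))
      u∉B : u ∉ v ∷ word B
      u∉B (here s)  = u≢v s
      u∉B (there s) = proj₂ (proj₂ splitB) (s , q)

  cycle-determined : ∀ {r : Fin N} ws zs → Unique (r ∷ ws) → Unique (r ∷ zs) → cycle r ws ≗ cycle r zs → ws ≡ zs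
  cycle-determined ws zs u u′ e = Path-determined ws zs
    (Path-cong ws (λ {x} _ → e x) (cycle-path _ ws u)) (cycle-path _ zs u′)
    (Unique[x∷xs]⇒x∉xs u) (Unique[x∷xs]⇒x∉xs u′)

  -- In the sequence at a vertex, the polygon leading towards the root is recognized as the first
  -- factor that moves `r`. There the `B` part ends and the `A` part begins.
  splitAt-moved : ∀ {r : Fin N} xs {a ys} xs′ {a′ ys′} → All (λ σ → ¬ Moves r σ) xs → All (λ σ → ¬ Moves r σ) xs′ →
    Moves r a → Moves r a′ → Pointwise _≗_ (xs ++ a ∷ ys) (xs′ ++ a′ ∷ ys′) →
    Pointwise _≗_ xs xs′ × Pointwise _≗_ ys ys′
  splitAt-moved []       []         _        _         m m′ (e ∷ es) = [] , es
  splitAt-moved []       (x′ ∷ xs′) _        (n ∷ _)   m m′ (e ∷ es) = ⊥-elim (n (Moves-≗ e m))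
  splitAt-moved (x ∷ xs) []         (n ∷ _)  _         m m′ (e ∷ es) = ⊥-elim (n (Moves-≗ (≗-sym e) m′))
  splitAt-moved (x ∷ xs) (x′ ∷ xs′) (_ ∷ ns) (_ ∷ ns′) m m′ (e ∷ es) =
    let p , q = splitAt-moved xs xs′ ns ns′ m m′ es in e ∷ p , q

  roots-fix : ∀ {r v : Fin N} T → r ∉ v ∷ word T → All (λ σ → ¬ Moves r σ) (map perm (roots v T))
  roots-fix T r∉ = All.map⁺ (All.map (λ {e} i m → r∉ (i (moved⇒support e m))) (roots-within _ T))

  -- Both cacti are unfolded from the root in parallel. Equal sequences at the root give equal
  -- polygons by `cycle-determined`; at each of their vertices the sequence, split at the polygon
  -- just found, gives the root sequences of `B` and `A`.
  determined  : ∀ {G G′} r T T′ → Embedded G r T → Embedded G′ r T′ → (∀ u → Pointwise _≗_ (proj u G) (proj u G′)) →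
    Unique (r ∷ word T) → Unique (r ∷ word T′) → Proper T → Proper T′ →
    Pointwise _≗_ (map perm (roots r T)) (map perm (roots r T′)) → T ≡ T′
  determinedB : ∀ {G G′} r e e′ b b′ → EmbeddedB G e b → EmbeddedB G′ e′ b′ → (∀ u → Pointwise _≗_ (proj u G) (proj u G′)) →
    Moves r (perm e) → Moves r (perm e′) → Unique (r ∷ wordB b) → Unique (r ∷ wordB b′) → ProperB b → ProperB b′ →
    verts b ≡ verts b′ → b ≡ b′
  determined r leaf       leaf         _ _ _ _ _ _ _ _ = refl
  determined r (node b C) (node b′ C′) (Eb , EC) (Eb′ , EC′) G≋ u@(r≢ ∷ u₁) u′@(r≢′ ∷ u₁′) (p ∷ ps) (p′ ∷ ps′) (e ∷ es) =
    cong₂ node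
      (determinedB r (r , verts b) (r , verts b′) b b′ Eb Eb′ G≋
        (cycle-moves (r , verts b) p ue (here refl)) (cycle-moves (r , verts b′) p′ ue′ (here refl))
        (proj₁ (Unique-++⁻ (r ∷ wordB b) u)) (proj₁ (Unique-++⁻ (r ∷ wordB b′) u′))
        (All.++⁻ˡ (sizesB b) ps) (All.++⁻ˡ (sizesB b′) ps′)
        (cycle-determined (verts b) (verts b′) ue ue′ e))
      (determined r C C′ EC EC′ G≋
        (All.++⁻ʳ (wordB b) r≢ ∷ proj₁ (proj₂ (Unique-++⁻ (wordB b) u₁)))
        (All.++⁻ʳ (wordB b′) r≢′ ∷ proj₁ (proj₂ (Unique-++⁻ (wordB b′) u₁′)))
        (All.++⁻ʳ (sizesB b) ps) (All.++⁻ʳ (sizesB b′) ps′) es)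
    where
    ue  = root-unique r b u
    ue′ = root-unique r b′ u′
  determinedB r e e′ none none _ _ _ _ _ _ _ _ _ _ = refl
  determinedB r e e′ (branch A v B b) (branch A′ v′ B′ b′) (at , EA , EB , Eb) (at′ , EA′ , EB′ , Eb′) G≋ m m′
    (r≢ ∷ u) (r≢′ ∷ u′) p p′ vs with refl ← proj₁ (∷-injective vs) =
    branch-cong
      (determined v A A′ EA EA′ G≋ (uA A u) (uA A′ u′) (All.++⁻ˡ (sizes A) p) (All.++⁻ˡ (sizes A′) p′) (proj₂ halves))
      (determined v B B′ EB EB′ G≋ (uB A B u) (uB A′ B′ u′) (All.++⁻ˡ (sizes B) pB) (All.++⁻ˡ (sizes B′) pB′) (proj₁ halves))
      (determinedB r e e′ b b′ Eb Eb′ G≋ m m′ (ub A B b r≢ u) (ub A′ B′ b′ r≢′ u′) (All.++⁻ʳ (sizes B) pB) (All.++⁻ʳ (sizes B′) pB′)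
        (proj₂ (∷-injective vs)))
    where
    branch-cong : ∀ {A A′ B B′ : Tree (Fin N)} {v b b′} → A ≡ A′ → B ≡ B′ → b ≡ b′ → branch A v B b ≡ branch A′ v B′ b′
    branch-cong refl refl refl = refl
    pB  = All.++⁻ʳ (sizes A) p
    pB′ = All.++⁻ʳ (sizes A′) p′
    uA : ∀ A {ws} → Unique (word A ++ v ∷ ws) → Unique (v ∷ word A)
    uA A u = let uA , _ , d = Unique-++⁻ (word A) u in
      All.tabulate (λ q e → d (subst (_∈ word A) (sym e) q , here refl)) ∷ uA
    uB : ∀ A B {ws} → Unique (word A ++ v ∷ word B ++ ws) → Unique (v ∷ word B)
    uB A B u = proj₁ (Unique-++⁻ (v ∷ word B) (proj₁ (proj₂ (Unique-++⁻ (word A) u))))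
    ub : ∀ A B b → All (r ≢_) (word A ++ v ∷ word B ++ wordB b) → Unique (word A ++ v ∷ word B ++ wordB b) →
         Unique (r ∷ wordB b)
    ub A B b r≢ u = All.++⁻ʳ (word B) (All.tail (All.++⁻ʳ (word A) r≢))
      ∷ proj₁ (proj₂ (Unique-++⁻ (v ∷ word B) (proj₁ (proj₂ (Unique-++⁻ (word A) u)))))
    r∉ : ∀ A B {ws} → All (r ≢_) (word A ++ v ∷ word B ++ ws) → r ∉ v ∷ word B
    r∉ A B r≢ q = All.lookup r≢ (∈-++⁺ʳ (word A) (∈-++⁺ˡ {xs = v ∷ word B} q)) refl
    halves : Pointwise _≗_ (map perm (roots v B)) (map perm (roots v B′)) ×
             Pointwise _≗_ (map perm (roots v A)) (map perm (roots v A′))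
    halves = splitAt-moved (map perm (roots v B)) (map perm (roots v B′))
      (roots-fix B (r∉ A B r≢)) (roots-fix B′ (r∉ A′ B′ r≢′)) m m′
      (subst₂ (Pointwise _≗_) at at′ (G≋ v))

  tree-injective : ∀ (r : Fin N) T T′ → Unique (r ∷ word T) → Unique (r ∷ word T′) → Proper T → Proper T′ →
    Equiv (map perm (factors r T)) (map perm (factors r T′)) → T ≡ T′
  tree-injective r T T′ u u′ p p′ eq = determined {map perm (factors r T)} {map perm (factors r T′)} r T T′
    (embedded _ r T u p (λ _ → refl)) (embedded _ r T′ u′ p′ (λ _ → refl)) same u u′ p p′
    (subst₂ (Pointwise _≗_) (projE-root r T u p) (projE-root r T′ u′ p′) (same r))
    where
    same : ∀ x → Pointwise _≗_ (proj x (map perm (factors r T))) (proj x (map perm (factors r T′)))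
    same = proj-Equiv eq (factors-good r T u)

-- Types of factorizations

HasType : Ty → List ℕ → Set
HasType α ls = All (2 ≤_) ls × (∀ i → count (suc (suc i)) ls ≡ coeff α i)

HasType-↭ : ∀ {α ls ks} → ls ↭ ks → HasType α ls → HasType α ks
HasType-↭ p (le , c) = All-resp-↭ p le ,
  λ i → trans (sym (↭-length (filter-↭ (suc (suc i) ℕ.≟_) p))) (c i)

count-same : ∀ j ls → count j (j ∷ ls) ≡ suc (count j ls)
count-same j ls = cong length (filter-accept (j ℕ.≟_) refl)

count-other : ∀ {k j} ls → k ≢ j → count k (j ∷ ls) ≡ count k ls
count-other {k} ls k≢j = cong length (filter-reject (k ℕ.≟_) k≢j)

count-++ : ∀ k ls ks → count k (ls ++ ks) ≡ count k ls + count k ks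
count-++ k ls ks = trans (cong length (filter-++ (k ℕ.≟_) ls ks)) (length-++ (filter (k ℕ.≟_) ls))

coeff-decAt-same : ∀ i α → coeff (decAt i α) i ≡ pred (coeff α i)
coeff-decAt-same i       []      = refl
coeff-decAt-same zero    (zero ∷ α)  = refl
coeff-decAt-same zero    (suc a ∷ α) = refl
coeff-decAt-same (suc i) (a ∷ α) = coeff-decAt-same i α

coeff-decAt-other : ∀ {i k} α → k ≢ i → coeff (decAt i α) k ≡ coeff α k
coeff-decAt-other                 []      k≢i = refl
coeff-decAt-other {zero} {zero}   (a ∷ α) k≢i = ⊥-elim (k≢i refl)
coeff-decAt-other {zero} {suc k}  (a ∷ α) k≢i = refl
coeff-decAt-other {suc i} {zero}  (a ∷ α) k≢i = refl
coeff-decAt-other {suc i} {suc k} (a ∷ α) k≢i = coeff-decAt-other α (k≢i ∘ cong suc)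

HasType-∷⁻ : ∀ {α i ls} → HasType α (suc (suc i) ∷ ls) →
             (∃ λ c → coeff α i ≡ suc c) × HasType (decAt i α) ls
HasType-∷⁻ {α} {i} {ls} ((_ ∷ le) , c) = (_ , here-count) , le , rest
  where
  here-count : coeff α i ≡ suc (count (suc (suc i)) ls)
  here-count = trans (sym (c i)) (count-same _ ls)
  rest : ∀ k → count (suc (suc k)) ls ≡ coeff (decAt i α) k
  rest k with k ℕ.≟ i
  ... | yes refl = trans (cong pred (sym here-count)) (sym (coeff-decAt-same i α))
  ... | no k≢i   = trans (sym (count-other ls (k≢i ∘ ℕ.suc-injective ∘ ℕ.suc-injective)))
                     (trans (c k) (sym (coeff-decAt-other α k≢i)))

HasType-∷⁺ : ∀ {α i c ls} → coeff α i ≡ suc c → HasType (decAt i α) ls → HasType α (suc (suc i) ∷ ls)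
HasType-∷⁺ {α} {i} {c} {ls} e (le , h) = s≤s (s≤s z≤n) ∷ le , counts
  where
  counts : ∀ k → count (suc (suc k)) (suc (suc i) ∷ ls) ≡ coeff α k
  counts k with k ℕ.≟ i
  ... | yes refl = trans (count-same _ ls) (trans (cong suc (trans (h i) (coeff-decAt-same i α)))
                     (trans (cong (λ z → suc (pred z)) e) (sym e)))
  ... | no k≢i   = trans (count-other ls (k≢i ∘ ℕ.suc-injective ∘ ℕ.suc-injective))
                     (trans (h k) (coeff-decAt-other α k≢i))

weightFrom-zero : ∀ k α → (∀ i → coeff α i ≡ 0) → weightFrom k α ≡ 0
weightFrom-zero k []      z = refl
weightFrom-zero k (a ∷ α) z = cong₂ _+_ (trans (cong (k *_) (z 0)) (ℕ.*-zeroʳ k)) (weightFrom-zero (suc k) α (z ∘ suc))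

weightFrom-decAt : ∀ k α i {c} → coeff α i ≡ suc c → weightFrom k α ≡ (k + i) + weightFrom k (decAt i α)
weightFrom-decAt k (.(suc c) ∷ α) zero    {c} refl = shuffle k c (weightFrom (suc k) α)
  where
  shuffle : ∀ k c w → k * suc c + w ≡ (k + 0) + (k * c + w)
  shuffle = solve-∀
weightFrom-decAt k (a ∷ α)        (suc i) e = trans
  (cong (k * a +_) (weightFrom-decAt (suc k) α i e)) (shuffle k a i (weightFrom (suc k) (decAt i α)))
  where
  shuffle : ∀ k a i w → k * a + (suc k + i + w) ≡ (k + suc i) + (k * a + w)
  shuffle = solve-∀

HasType-weight : ∀ {α} ls → HasType α ls → degreeSum ls ≡ weight α
HasType-weight {α} []                h = sym (weightFrom-zero 1 α (λ i → sym (proj₂ h i)))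
HasType-weight {α} (suc (suc i) ∷ ls) h with HasType-∷⁻ {α} {i} {ls} h
... | (c , e) , h′ = trans (cong (suc i +_) (HasType-weight {decAt i α} ls h′)) (sym (weightFrom-decAt 1 α i e))
HasType-weight (zero ∷ ls)     ((() ∷ _) , _)
HasType-weight (suc zero ∷ ls) ((s≤s () ∷ _) , _)

-- Cycles as polygons and polygons as cycles

module _ {N : ℕ} where

  orbit-path : ∀ (σ : Perm N) x {t} m u (h : Fin m → Fin N) k → u ≡ iter k σ x →
    (∀ i → h i ≡ iter (suc (k + toℕ i)) σ x) → t ≡ iter (suc (k + m)) σ x → Path σ u (tabulate h) t
  orbit-path σ x zero    u h k eu eh et =
    trans (cong σ eu) (sym (trans et (cong (λ z → iter (suc z) σ x) (ℕ.+-identityʳ k))))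
  orbit-path σ x (suc m) u h k eu eh et =
      trans (cong σ eu) (sym e₀)
    , orbit-path σ x m (h zero) (h ∘ suc) (suc k) e₀
        (λ i → trans (eh (suc i)) (cong (λ z → iter (suc z) σ x) (ℕ.+-suc k (toℕ i))))
        (trans et (cong (λ z → iter (suc z) σ x) (ℕ.+-suc k m)))
    where
    e₀ : h zero ≡ iter (suc k) σ x
    e₀ = trans (eh zero) (cong (λ z → iter (suc z) σ x) (ℕ.+-identityʳ k))

  -- The polygon lists the orbit of the given point. Comparing paths gives agreement on the orbit;
  -- outside it both permutations fix everything.
  cycle⇒edge : ∀ {j} {σ : Perm N} → 2 ≤ j → IsCycle j σ →
               ∃ λ e → edgeSize e ≡ j × σ ≗ perm e
  cycle⇒edge {suc m} {σ} _ (x , closes , inj , fixes) = (x , ws) , cong suc (length-tabulate _) , agree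
    where
    point : Fin (suc m) → Fin N
    point i = iter (toℕ i) σ x
    ws : List (Fin N)
    ws = tabulate (point ∘ suc)
    unique : Unique (x ∷ ws)
    unique = tabulate⁺ {f = point} (inj _ _)
    agree : σ ≗ cycle x ws
    agree y with _∈?_ Fin._≟_ y (x ∷ ws)
    ... | yes y∈ = Path-agree ws (orbit-path σ x m x (point ∘ suc) 0 refl (λ _ → refl) (sym closes))
                     (cycle-path x ws unique) y∈
    ... | no y∉  = trans (fixes y (λ a e → y∉ (subst (_∈ x ∷ ws) e (∈-tabulate⁺ {f = point} a))))
                     (sym (cycle-fix ws y∉))

  iter-shift : ∀ k (g : Perm N) u → iter (suc k) g u ≡ iter k g (g u)
  iter-shift zero    g u = refl
  iter-shift (suc k) g u = cong g (iter-shift k g u)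

  iter-path : ∀ {g : Perm N} {u t} ws → Path g u ws t → ∀ (a : Fin (suc (length ws))) →
              iter (toℕ a) g u ≡ lookup (u ∷ ws) a
  iter-path ws       p       zero    = refl
  iter-path {g} {u} (w ∷ ws) (p , q) (suc a) =
    trans (iter-shift (toℕ a) g u) (trans (cong (iter (toℕ a) g) p) (iter-path ws q a))

  iter-closes : ∀ {g : Perm N} {u t} ws → Path g u ws t → iter (suc (length ws)) g u ≡ t
  iter-closes         []       p       = p
  iter-closes {g} {u} (w ∷ ws) (p , q) =
    trans (iter-shift (suc (length ws)) g u) (trans (cong (iter (suc (length ws)) g) p) (iter-closes ws q))

  lookup-injective : ∀ {A : Set} {xs : List A} → Unique xs → ∀ i j → lookup xs i ≡ lookup xs j → i ≡ j
  lookup-injective (p ∷ u) zero    zero    e = refl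
  lookup-injective (p ∷ u) zero    (suc j) e = ⊥-elim (All.lookup p (∈-lookup j) e)
  lookup-injective (p ∷ u) (suc i) zero    e = ⊥-elim (All.lookup p (∈-lookup i) (sym e))
  lookup-injective (p ∷ u) (suc i) (suc j) e = cong suc (lookup-injective u i j e)

  edge⇒cycle : ∀ (e : Edge (Fin N)) → Unique (support e) → IsCycle (edgeSize e) (perm e)
  edge⇒cycle (r , ws) u = r , iter-closes ws path
    , (λ a b e → lookup-injective u a b (trans (sym (iter-path ws path a)) (trans e (iter-path ws path b))))
    , (λ y off → cycle-fix ws λ y∈ → off (index y∈) (trans (iter-path ws path (index y∈)) (sym (lookup-index y∈))))
    where
    path = cycle-path r ws u

factors-unique : ∀ (r : V) T → Unique (r ∷ word T) → All (Unique ∘ support) (factors r T)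
branches-unique : ∀ (b : Branches V) → Unique (wordB b) → All (Unique ∘ support) (before b) × All (Unique ∘ support) (after b)
factors-unique r leaf       u = []
factors-unique r (node b C) u@(r≢ ∷ u′) =
  let ub , uC , _ = Unique-++⁻ (wordB b) u′
      pb , pa = branches-unique b ub
  in All.++⁺ pb (root-unique r b u ∷ All.++⁺ pa (factors-unique r C (All.++⁻ʳ (wordB b) r≢ ∷ uC)))
branches-unique none             u = [] , []
branches-unique (branch A v B b) u =
  let uA , uvB , d = Unique-++⁻ (word A) u
      uB , ub , _ = Unique-++⁻ (v ∷ word B) uvB
      pb , pa = branches-unique b ub
  in All.++⁺ (factors-unique v B uB) pb
   , All.++⁺ (factors-unique v A (All.tabulate (λ q e → d (subst (_∈ word A) (sym e) q , here refl)) ∷ uA)) pa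

edges : ∀ {ls} {fs : List (Perm N)} → Pointwise (λ j σ → (2 ≤ j) × IsCycle j σ) ls fs →
        ∃ λ es → map edgeSize es ≡ ls × Pointwise _≗_ fs (map perm es)
edges []             = [] , refl , []
edges ((le , c) ∷ p) with cycle⇒edge le c | edges p
... | e , refl , σ≗ | es , refl , fs≗ = e ∷ es , refl , σ≗ ∷ fs≗

lengths≥2 : ∀ {ls} {fs : List (Perm N)} → Pointwise (λ j σ → (2 ≤ j) × IsCycle j σ) ls fs → All (2 ≤_) ls
lengths≥2 []             = []
lengths≥2 ((le , _) ∷ p) = le ∷ lengths≥2 p

prod-≗ : ∀ {fs gs : List (Perm N)} → Pointwise _≗_ fs gs → prod fs ≗ prod gs
prod-≗ []                 x = refl
prod-≗ {gs = τ ∷ gs} (e ∷ es) x = trans (prod-≗ es _) (cong (prod gs) (e x))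

fact⇒tree : ∀ {α fs} → IsFact α fs → ∃ λ T → word T ≡ successors (weight α) × HasType α (sizes T) ×
            Equiv fs (map perm (factors zero T))
fact⇒tree {α} {fs} (ls , cycles , prod≗ , counts) with edges cycles
... | es , refl , fs≗ with realise (weight α) es (HasType-weight {α} _ type) prod≗′
  where
  type : HasType α (map edgeSize es)
  type = lengths≥2 cycles , counts
  prod≗′ : product es ≗ longCycle (weight α)
  prod≗′ x = trans (sym (prod-≗ fs≗ x)) (prod≗ x)
...   | T , word≡ , es≈ = T , word≡
    , HasType-↭ {α} (↭-trans (≈⇒sizes↭ es≈) (sizes-factors zero T)) (lengths≥2 cycles , counts)
    , inj₂ fs≗ ◅ ≈⇒Equiv es≈

tree⇒fact : ∀ {α} T → word T ≡ successors (weight α) → HasType α (sizes T) → IsFact α (map perm (factors zero T))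
tree⇒fact {α} T word≡ type = map edgeSize (factors zero T)
    , cycles (proj₁ type′) (factors-unique zero T unique)
    , (λ x → trans (product-factors zero T unique x) (agree x))
    , proj₂ type′
  where
  type′ : HasType α (map edgeSize (factors zero T))
  type′ = HasType-↭ {α} (↭-sym (sizes-factors zero T)) type
  unique : Unique (zero ∷ word T)
  unique = subst (λ w → Unique (zero ∷ w)) (sym word≡) (successors-unique (weight α))
  cycles : ∀ {es : List (Edge (Fin (suc (weight α))))} → All (2 ≤_) (map edgeSize es) → All (Unique ∘ support) es →
           Pointwise (λ j σ → (2 ≤ j) × IsCycle j σ) (map edgeSize es) (map perm es)
  cycles {[]}     []       []       = []
  cycles {e ∷ es} (l ∷ ls) (u ∷ us) = (l , edge⇒cycle e u) ∷ cycles ls us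
  agree : ∀ x → cycle zero (word T) x ≡ longCycle (weight α) x
  agree x rewrite word≡ = Path-agree (successors (weight α))
    (cycle-path zero (successors (weight α)) (successors-unique (weight α))) (longCycle-path (weight α)) (∈-allFin x)

-- Unlabelled cacti

-- Once the contour word is prescribed, labels carry no further information: `labelled` fills in any
-- word of the right length, and `shape-word-injective` makes the result unique.
shape  : Tree V → Tree ⊤
shapeB : Branches V → Branches ⊤
shape leaf       = leaf
shape (node b C) = node (shapeB b) (shape C)
shapeB none             = none
shapeB (branch A v B b) = branch (shape A) tt (shape B) (shapeB b)

verts-shape : ∀ (b : Branches V) → length (verts (shapeB b)) ≡ length (verts b)
verts-shape none             = refl
verts-shape (branch A v B b) = cong suc (verts-shape b)

sizes-shape  : ∀ (T : Tree V) → sizes (shape T) ≡ sizes T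
sizes-shapeB : ∀ (b : Branches V) → sizesB (shapeB b) ≡ sizesB b
sizes-shape leaf       = refl
sizes-shape (node b C) = cong₂ _∷_ (cong suc (verts-shape b)) (cong₂ _++_ (sizes-shapeB b) (sizes-shape C))
sizes-shapeB none             = refl
sizes-shapeB (branch A v B b) = cong₂ _++_ (sizes-shape A) (cong₂ _++_ (sizes-shape B) (sizes-shapeB b))

length-shape : ∀ (T : Tree V) → length (word (shape T)) ≡ length (word T)
length-shape T = trans (length-word (shape T)) (trans (cong degreeSum (sizes-shape T)) (sym (length-word T)))

splitLength : ∀ (w : List V) m {n} → length w ≡ m + n →
              ∃₂ λ x y → w ≡ x ++ y × length x ≡ m × length y ≡ n
splitLength w       zero    e = [] , w , refl , refl , e
splitLength (v ∷ w) (suc m) e with splitLength w m (ℕ.suc-injective e)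
... | x , y , refl , ex , ey = v ∷ x , y , refl , cong suc ex , ey

labelled  : ∀ (s : Tree ⊤) (w : List V) → length w ≡ length (word s) → ∃ λ T → shape T ≡ s × word T ≡ w
labelledB : ∀ (b : Branches ⊤) (w : List V) → length w ≡ length (wordB b) → ∃ λ c → shapeB c ≡ b × wordB c ≡ w
labelled leaf       []      e = leaf , refl , refl
labelled (node b C) w       e with splitLength w (length (wordB b)) (trans e (length-++ (wordB b)))
... | x , y , refl , ex , ey with labelledB b x ex | labelled C y ey
... | c , refl , refl | T , refl , refl = node c T , refl , refl
labelledB none             []  e = none , refl , refl
labelledB (branch A _ B b) w   e with splitLength w (length (word A)) (trans e (length-++ (word A)))
... | x , (v ∷ y) , refl , ex , ey
  with splitLength y (length (word B)) (trans (ℕ.suc-injective ey) (length-++ (word B)))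
... | y₁ , y₂ , refl , ey₁ , ey₂ with labelled A x ex | labelled B y₁ ey₁ | labelledB b y₂ ey₂
... | A′ , refl , refl | B′ , refl , refl | b′ , refl , refl = branch A′ v B′ b′ , refl , refl

++-split : ∀ (xs ys : List V) {us vs} → length xs ≡ length ys → xs ++ us ≡ ys ++ vs → xs ≡ ys × us ≡ vs
++-split []       []       _ e = refl , e
++-split (x ∷ xs) (y ∷ ys) l e =
  let e₁ , e₂ = ∷-injective e; p , q = ++-split xs ys (ℕ.suc-injective l) e₂ in cong₂ _∷_ e₁ p , q

node-injective : ∀ {b c : Branches V} {C D} → node b C ≡ node c D → b ≡ c × C ≡ D
node-injective refl = refl , refl

branch-injective : ∀ {A A′ B B′ : Tree V} {v v′ b b′} → branch A v B b ≡ branch A′ v′ B′ b′ →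
                   A ≡ A′ × B ≡ B′ × b ≡ b′
branch-injective refl = refl , refl , refl

shape-lengths : ∀ {T T′ : Tree V} → shape T ≡ shape T′ → length (word T) ≡ length (word T′)
shape-lengths {T = T} {T′} e = trans (sym (length-shape T)) (trans (cong (length ∘ word) e) (length-shape T′))

shape-lengthsB : ∀ (b b′ : Branches V) → shapeB b ≡ shapeB b′ → length (wordB b) ≡ length (wordB b′)
shape-lengthsB b b′ e = trans (sym (len b)) (trans (cong (length ∘ wordB) e) (len b′))
  where
  len : ∀ b → length (wordB (shapeB b)) ≡ length (wordB b)
  len b = trans (length-wordB (shapeB b)) (trans
    (cong₂ _+_ (verts-shape b) (cong degreeSum (sizes-shapeB b))) (sym (length-wordB b)))

shape-word-injective  : ∀ (T T′ : Tree V) → shape T ≡ shape T′ → word T ≡ word T′ → T ≡ T′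
shape-word-injectiveB : ∀ (b b′ : Branches V) → shapeB b ≡ shapeB b′ → wordB b ≡ wordB b′ → b ≡ b′
shape-word-injective leaf       leaf         _ _ = refl
shape-word-injective (node b C) (node b′ C′) e w =
  let eb , eC = node-injective e
      wb , wC = ++-split (wordB b) (wordB b′) (shape-lengthsB b b′ eb) w
  in cong₂ node (shape-word-injectiveB b b′ eb wb) (shape-word-injective C C′ eC wC)
shape-word-injectiveB none             none                 _ _ = refl
shape-word-injectiveB (branch A v B b) (branch A′ v′ B′ b′) e w
  with branch-injective e
... | eA , eB , eb with ++-split (word A) (word A′) (shape-lengths {T = A} {A′} eA) w
... | wA , wvB with refl ← ∷-injectiveˡ wvB | ++-split (word B) (word B′) (shape-lengths {T = B} {B′} eB) (∷-injectiveʳ wvB)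
... | wB , wb with shape-word-injective A A′ eA wA | shape-word-injective B B′ eB wB | shape-word-injectiveB b b′ eb wb
... | refl | refl | refl = refl

record Enumerates (P : Tree ⊤ → Set) (E : List (Tree ⊤)) : Set where
  constructor enumerates
  field
    unique   : Unique E
    sound    : ∀ {s} → s ∈ E → P s
    complete : ∀ {s} → P s → s ∈ E

OfType : Ty → Tree ⊤ → Set
OfType α s = HasType α (sizes s)

-- All cacti here have contour word `successors`, so equal shapes mean equal cacti and hence
-- equivalent representatives. Conversely a shape of type `α`, labelled by that word, gives a
-- factorization equivalent to some representative, and `tree-injective` identifies the two cacti.
classes⇒shapes : ∀ {α n} → ClassCount α n → ∃ λ E → length E ≡ n × Enumerates (OfType α) E
classes⇒shapes {α} {n} (reps , facts , distinct , meets) =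
  tabulate (shape ∘ tree) , length-tabulate (shape ∘ tree) , enumerates
    (tabulate⁺ λ {i} {k} e → distinct i k (Equiv-trans (equivalent i)
      (subst (λ T → Equiv (map perm (factors zero T)) _) (sym (tree-unique i k e)) (Equiv-sym (equivalent k)))))
    (λ s∈ → let i , e = ∈-tabulate⁻ s∈ in
      subst (OfType α) (sym e) (subst (HasType α) (sym (sizes-shape (tree i))) (typed i)))
    complete
  where
  Equiv-trans : ∀ {fs gs hs : List (Perm (suc (weight α)))} → Equiv fs gs → Equiv gs hs → Equiv fs hs
  Equiv-trans = _◅◅_
  data-of = λ i → fact⇒tree {α} (facts i)
  tree : Fin n → Tree (Fin (suc (weight α)))
  tree i = proj₁ (data-of i)
  word≡ : ∀ i → word (tree i) ≡ successors (weight α)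
  word≡ i = proj₁ (proj₂ (data-of i))
  typed : ∀ i → HasType α (sizes (tree i))
  typed i = proj₁ (proj₂ (proj₂ (data-of i)))
  equivalent : ∀ i → Equiv (Vec.lookup reps i) (map perm (factors zero (tree i)))
  equivalent i = proj₂ (proj₂ (proj₂ (data-of i)))
  tree-unique : ∀ i k → shape (tree i) ≡ shape (tree k) → tree i ≡ tree k
  tree-unique i k e = shape-word-injective _ _ e (trans (word≡ i) (sym (word≡ k)))
  word-unique : ∀ T → word T ≡ successors (weight α) → Unique (zero ∷ word T)
  word-unique T e = subst (λ w → Unique (zero ∷ w)) (sym e) (successors-unique (weight α))
  complete : ∀ {s} → OfType α s → s ∈ tabulate (shape ∘ tree)
  complete {s} type with labelled s (successors (weight α))
    (trans (length-tabulate {n = weight α} suc) (trans (sym (HasType-weight {α} (sizes s) type)) (sym (length-word s))))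
  ... | T , refl , w with meets _ (tree⇒fact {α} T w (subst (HasType α) (sizes-shape T) type))
  ... | i , eq = subst (λ U → shape U ∈ tabulate (shape ∘ tree))
      (sym (tree-injective zero T (tree i) (word-unique T w) (word-unique (tree i) (word≡ i))
        (proj₁ (subst (HasType α) (sizes-shape T) type)) (proj₁ (typed i)) (eq ◅◅ equivalent i)))
      (∈-tabulate⁺ {f = shape ∘ tree} i)

Forest⊤ : Set
Forest⊤ = List (Tree ⊤)

allSizes : Forest⊤ → List ℕ
allSizes = concatMap sizes

codeB : Branches ⊤ → Forest⊤
codeB none             = []
codeB (branch A _ B b) = A ∷ B ∷ codeB b

-- The root polygon of a tree with i + 2 vertices carries 2 (i + 1) + 1 = 2 i + 3 subtrees.
code : Tree ⊤ → Forest⊤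
code leaf       = []
code (node b C) = codeB b ++ [ C ]

codeB-injective : ∀ b b′ {C C′} → codeB b ++ [ C ] ≡ codeB b′ ++ [ C′ ] → b ≡ b′ × C ≡ C′
codeB-injective none             none                refl = refl , refl
codeB-injective none             (branch _ _ _ _)    ()
codeB-injective (branch _ _ _ _) none                ()
codeB-injective (branch A _ B b) (branch A′ _ B′ b′) e with ∷-injective e
... | refl , e₁ with ∷-injective e₁
... | refl , e₂ with codeB-injective b b′ e₂
... | refl , refl = refl , refl

code-injective : ∀ {s t} → code s ≡ code t → s ≡ t
code-injective {leaf}     {leaf}      e = refl
code-injective {leaf}     {node b C}  e with () ← ++-conicalʳ (codeB b) [ C ] (sym e)
code-injective {node b C} {leaf}      e with () ← ++-conicalʳ (codeB b) [ C ] e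
code-injective {node b C} {node c D}  e with codeB-injective b c e
... | refl , refl = refl

length-codeB : ∀ b C → length (codeB b ++ [ C ]) ≡ suc (2 * length (verts b))
length-codeB none             C = refl
length-codeB (branch A _ B b) C = trans (cong (2 +_) (length-codeB b C)) (shuffle (length (verts b)))
  where
  shuffle : ∀ n → 3 + 2 * n ≡ 1 + 2 * (1 + n)
  shuffle = solve-∀

sizes-codeB : ∀ b C → allSizes (codeB b ++ [ C ]) ≡ sizesB b ++ sizes C
sizes-codeB none             C = ++-identityʳ (sizes C)
sizes-codeB (branch A _ B b) C = trans (cong (λ z → sizes A ++ sizes B ++ z) (sizes-codeB b C))
  (trans (cong (sizes A ++_) (sym (++-assoc (sizes B) _ _))) (sym (++-assoc (sizes A) _ _)))

subtrees : ℕ → ℕ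
subtrees i = 2 * i + 3

-- The bound on sizes excludes the degenerate `node none C`, a polygon with one vertex; i + 1
-- branches then make a polygon with i + 2 vertices.
encode : ∀ s → All (2 ≤_) (sizes s) → s ≡ leaf ⊎
         (∃ λ i → length (code s) ≡ subtrees i × sizes s ≡ suc (suc i) ∷ allSizes (code s))
encode leaf                        p             = inj₁ refl
encode (node none C)               (s≤s () ∷ _)
encode (node b@(branch _ _ _ b′) C) p = inj₂ (length (verts b′)
  , trans (length-codeB b C) (shuffle (length (verts b′)))
  , cong (suc (length (verts b)) ∷_) (sym (sizes-codeB b C)))
  where
  shuffle : ∀ n → 1 + 2 * (1 + n) ≡ 2 * n + 3
  shuffle = solve-∀

decode : ∀ i as → length as ≡ subtrees i → ∃ λ s → code s ≡ as × sizes s ≡ suc (suc i) ∷ allSizes as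
decode i as e with decodeB (suc i) as (trans e (shuffle i))
  where
  shuffle : ∀ n → 2 * n + 3 ≡ 1 + 2 * (1 + n)
  shuffle = solve-∀
  decodeB : ∀ m as → length as ≡ suc (2 * m) → ∃₂ λ b C → codeB b ++ [ C ] ≡ as × length (verts b) ≡ m
  decodeB zero    (C ∷ [])      e = none , C , refl , refl
  decodeB (suc m) (A ∷ [])      e with () ← ℕ.suc-injective e
  decodeB (suc m) (A ∷ B ∷ as)  e with decodeB m as (ℕ.suc-injective (ℕ.suc-injective (trans e (shuffle′ m))))
    where
    shuffle′ : ∀ m → 1 + 2 * (1 + m) ≡ 3 + 2 * m
    shuffle′ = solve-∀
  ... | b , C , refl , refl = branch A tt B b , C , refl , refl
... | b , C , refl , l = node b C , refl
    , cong₂ _∷_ (cong suc l) (sym (sizes-codeB b C))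

-- The recursion for the number of classes

module _ {A B : Set} where

  ∈-concatMap : ∀ {f : A → List B} {y} xs → y ∈ concatMap f xs → ∃ λ x → x ∈ xs × y ∈ f x
  ∈-concatMap {f} (x ∷ xs) y∈ with ∈-++⁻ (f x) y∈
  ... | inj₁ p = x , here refl , p
  ... | inj₂ p = let x′ , q , r = ∈-concatMap xs p in x′ , there q , r

  concatMap-∈ : ∀ {f : A → List B} {x y xs} → x ∈ xs → y ∈ f x → y ∈ concatMap f xs
  concatMap-∈ (here refl) y∈ = ∈-++⁺ˡ y∈
  concatMap-∈ {f} {xs = x ∷ _} (there p) y∈ = ∈-++⁺ʳ (f x) (concatMap-∈ p y∈)

  concatMap-unique : ∀ {f : A → List B} {xs} → Unique xs → (∀ {x} → x ∈ xs → Unique (f x)) →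
    (∀ {x y z} → x ∈ xs → y ∈ xs → z ∈ f x → z ∈ f y → x ≡ y) → Unique (concatMap f xs)
  concatMap-unique []       u d = []
  concatMap-unique {f} {x ∷ xs} (p ∷ us) u d = Unique.++⁺ (u (here refl))
    (concatMap-unique us (u ∘ there) (λ a b → d (there a) (there b)))
    (λ (z∈ , z∈′) → let y , y∈ , z∈y = ∈-concatMap xs z∈′ in
      All.lookup p y∈ (d (here refl) (there y∈) z∈ z∈y))

  length-concatMap : ∀ (f : A → List B) xs → length (concatMap f xs) ≡ sum (map (length ∘ f) xs)
  length-concatMap f []       = refl
  length-concatMap f (x ∷ xs) = trans (length-++ (f x)) (cong (length (f x) +_) (length-concatMap f xs))

unique-↭ : ∀ {A : Set} {xs ys : List A} → Unique xs → Unique ys →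
           (∀ {x} → x ∈ xs → x ∈ ys) → (∀ {x} → x ∈ ys → x ∈ xs) → xs ↭ ys
unique-↭ u u′ f g = ∼bag⇒↭ (unique∧set⇒bag u u′ (mk⇔ f g))

length-productWith : ∀ {A B C : Set} (f : A → B → C) xs ys →
                     length (cartesianProductWith f xs ys) ≡ length xs * length ys
length-productWith f []       ys = refl
length-productWith f (x ∷ xs) ys = trans (length-++ (map (f x) ys))
  (cong₂ _+_ (length-map (f x) ys) (length-productWith f xs ys))

below-⊖ : ∀ {α β} → β ∈ below α → ∀ i → coeff β i + coeff (α ⊖ β) i ≡ coeff α i
below-⊖ {[]}    (here refl) i = refl
below-⊖ {a ∷ α} β∈ i with ∈-concatMap {f = λ b → map (b ∷_) (below α)} (upTo (suc a)) β∈
... | b , b∈ , β∈′ with ∈-map⁻ (b ∷_) β∈′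
below-⊖ {a ∷ α} β∈ zero    | b , b∈ , _ | β , _ , refl = ℕ.m+[n∸m]≡n (ℕ.≤-pred (∈-upTo⁻ b∈))
below-⊖ {a ∷ α} β∈ (suc i) | b , b∈ , _ | β , q , refl = below-⊖ {α} q i

below-unique : ∀ α → Unique (below α)
below-unique []      = [] ∷ []
below-unique (a ∷ α) = concatMap-unique (Unique.upTo⁺ (suc a)) (λ _ → Unique.map⁺ ∷-injectiveʳ (below-unique α))
  λ {b} {c} _ _ p q → let _ , _ , e = ∈-map⁻ (b ∷_) p; _ , _ , e′ = ∈-map⁻ (c ∷_) q in ∷-injectiveˡ (trans (sym e) e′)

-- Lists that differ by trailing zeros represent the same type. All lists in `below α` have the
-- length of `α`, so each type occurs there once.
below-extensional : ∀ α {β γ} → β ∈ below α → γ ∈ below α → (∀ i → coeff β i ≡ coeff γ i) → β ≡ γ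
below-extensional []      (here refl) (here refl) e = refl
below-extensional (a ∷ α) β∈ γ∈ e
  with ∈-concatMap {f = λ b → map (b ∷_) (below α)} (upTo (suc a)) β∈
     | ∈-concatMap {f = λ b → map (b ∷_) (below α)} (upTo (suc a)) γ∈
... | b , _ , p | c , _ , q with ∈-map⁻ (b ∷_) p | ∈-map⁻ (c ∷_) q
... | β , β∈′ , refl | γ , γ∈′ , refl = cong₂ _∷_ (e 0) (below-extensional α β∈′ γ∈′ (e ∘ suc))

restrict : Ty → (ℕ → ℕ) → Ty
restrict []      g = []
restrict (a ∷ α) g = g 0 ∷ restrict α (g ∘ suc)

restrict-below : ∀ α g → (∀ i → g i ≤ coeff α i) → restrict α g ∈ below α
restrict-below []      g le = here refl
restrict-below (a ∷ α) g le = concatMap-∈ (∈-upTo⁺ (s≤s (le 0)))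
  (∈-map⁺ (g 0 ∷_) (restrict-below α (g ∘ suc) (le ∘ suc)))

coeff-restrict : ∀ α g → (∀ i → g i ≤ coeff α i) → ∀ i → coeff (restrict α g) i ≡ g i
coeff-restrict []      g le i       = sym (ℕ.n≤0⇒n≡0 (le i))
coeff-restrict (a ∷ α) g le zero    = refl
coeff-restrict (a ∷ α) g le (suc i) = coeff-restrict α (g ∘ suc) (le ∘ suc) i

HasType-++⁺ : ∀ {α β ls ks} → β ∈ below α → HasType β ls → HasType (α ⊖ β) ks → HasType α (ls ++ ks)
HasType-++⁺ {α} {β} {ls} {ks} β∈ (p , c) (q , d) = All.++⁺ p q , λ i →
  trans (count-++ (suc (suc i)) ls ks) (trans (cong₂ _+_ (c i) (d i)) (below-⊖ {α} β∈ i))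

HasType-++⁻ : ∀ {α} ls {ks} → HasType α (ls ++ ks) → ∃ λ β → β ∈ below α × HasType β ls × HasType (α ⊖ β) ks
HasType-++⁻ {α} ls {ks} (p , c) = restrict α g , β∈ , (All.++⁻ˡ ls p , λ i → sym (coeff-restrict α g le i))
  , (All.++⁻ʳ ls p , λ i → ℕ.+-cancelˡ-≡ (g i) _ _ (begin
      g i + count (suc (suc i)) ks                               ≡⟨ total i ⟩
      coeff α i                                                  ≡⟨ sym (below-⊖ {α} β∈ i) ⟩
      coeff (restrict α g) i + coeff (α ⊖ restrict α g) i        ≡⟨ cong (_+ coeff (α ⊖ restrict α g) i) (coeff-restrict α g le i) ⟩
      g i + coeff (α ⊖ restrict α g) i                           ∎))
  where
  open ≡-Reasoning
  g : ℕ → ℕ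
  g i = count (suc (suc i)) ls
  total : ∀ i → g i + count (suc (suc i)) ks ≡ coeff α i
  total i = trans (sym (count-++ (suc (suc i)) ls ks)) (c i)
  le : ∀ i → g i ≤ coeff α i
  le i = subst (g i ≤_) (total i) (ℕ.m≤m+n (g i) _)
  β∈ : restrict α g ∈ below α
  β∈ = restrict-below α g le

allZero⇔ : ∀ α → (allZero α ≡ 1 × ∀ i → coeff α i ≡ 0) ⊎ (allZero α ≡ 0 × ∃ λ i → coeff α i ≢ 0)
allZero⇔ []          = inj₁ (refl , λ _ → refl)
allZero⇔ (zero ∷ α) with allZero⇔ α
... | inj₁ (e , z)     = inj₁ (e , λ { zero → refl ; (suc i) → z i })
... | inj₂ (e , i , n) = inj₂ (e , suc i , n)
allZero⇔ (suc a ∷ α) = inj₂ (refl , 0 , λ ())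

record Tuples (k : ℕ) (α : Ty) (L : List Forest⊤) : Set where
  constructor tuples
  field
    unique   : Unique L
    sound    : ∀ {as} → as ∈ L → length as ≡ k × HasType α (allSizes as)
    complete : ∀ {as} → length as ≡ k → HasType α (allSizes as) → as ∈ L

-- Each operation on coefficients gets a counterpart on lists with the same recursion: its length is
-- the coefficient, and its elements are the tuples of trees that the coefficient counts.
oneE : Ty → List Forest⊤
oneE α = replicate (one α) []

oneE-tuples : ∀ α → Tuples 0 α (oneE α)
oneE-tuples α with allZero⇔ α
... | inj₁ (e , z) rewrite e = tuples ([] ∷ [])
        (λ { (here refl) → refl , [] , λ i → sym (z i) }) (λ { {[]} _ _ → here refl })
... | inj₂ (e , i , n) rewrite e = tuples [] (λ ()) (λ { {[]} _ (_ , c) → ⊥-elim (n (sym (c i))) })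

mulE : (Ty → List (Tree ⊤)) → (Ty → List Forest⊤) → Ty → List Forest⊤
mulE E F α = concatMap (λ β → cartesianProductWith _∷_ (E β) (F (α ⊖ β))) (below α)

powE : (Ty → List (Tree ⊤)) → ℕ → Ty → List Forest⊤
powE E zero    = oneE
powE E (suc k) = mulE E (powE E k)

timesE : ℕ → (Ty → List Forest⊤) → Ty → List Forest⊤
timesE i F α with coeff α i
... | zero  = []
... | suc _ = F (decAt i α)

rhsE : (Ty → List (Tree ⊤)) → Ty → List Forest⊤
rhsE E α = oneE α ++ concatMap (λ i → timesE i (powE E (subtrees i)) α) (upTo (length α))

module _ {H : Ty → ℕ} (E : Ty → List (Tree ⊤)) (size≡ : ∀ α → length (E α) ≡ H α)
         (enum : ∀ α → Enumerates (OfType α) (E α)) where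

  length-powE : ∀ k α → length (powE E k α) ≡ pow H k α
  length-powE zero    α = length-replicate (one α)
  length-powE (suc k) α = trans (length-concatMap _ (below α)) (cong sum (map-cong (λ β →
    trans (length-productWith _∷_ (E β) _) (cong₂ _*_ (size≡ β) (length-powE k (α ⊖ β)))) (below α)))

  length-timesE : ∀ i {F G} → (∀ α → length (F α) ≡ G α) → ∀ α → length (timesE i F α) ≡ timesVar i G α
  length-timesE i e α with coeff α i
  ... | zero  = refl
  ... | suc _ = e (decAt i α)

  length-rhsE : ∀ α → length (rhsE E α) ≡ rhsCoeff H α
  length-rhsE α = trans (length-++ (oneE α)) (cong₂ _+_ (length-replicate (one α))
    (trans (length-concatMap _ (upTo (length α)))
      (cong sum (map-cong (λ i → length-timesE i (length-powE (subtrees i)) α) (upTo (length α))))))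

  powE-tuples : ∀ k α → Tuples k α (powE E k α)
  powE-tuples zero    α = oneE-tuples α
  powE-tuples (suc k) α = tuples unique sound complete
    where
    F : Ty → List Forest⊤
    F = powE E k
    cell : Ty → List Forest⊤
    cell β = cartesianProductWith _∷_ (E β) (F (α ⊖ β))
    sound : ∀ {as} → as ∈ mulE E F α → length as ≡ suc k × HasType α (allSizes as)
    sound as∈ with ∈-concatMap {f = cell} (below α) as∈
    ... | β , β∈ , as∈′ with ∈-cartesianProductWith⁻ _∷_ (E β) (F (α ⊖ β)) as∈′
    ... | a , as , a∈ , as∈″ , refl = let l , h = Tuples.sound (powE-tuples k (α ⊖ β)) as∈″ in
      cong suc l , HasType-++⁺ {α} {β} {sizes a} β∈ (Enumerates.sound (enum β) a∈) h
    complete : ∀ {as} → length as ≡ suc k → HasType α (allSizes as) → as ∈ mulE E F α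
    complete {a ∷ as} l h with HasType-++⁻ {α} (sizes a) h
    ... | β , β∈ , ha , has = concatMap-∈ {f = cell} β∈
      (∈-cartesianProductWith⁺ _∷_ (Enumerates.complete (enum β) ha)
        (Tuples.complete (powE-tuples k (α ⊖ β)) (ℕ.suc-injective l) has))
    unique : Unique (mulE E F α)
    unique = concatMap-unique (below-unique α)
      (λ {β} _ → Unique.cartesianProductWith⁺ _∷_ ∷-injective
        (Enumerates.unique (enum β)) (Tuples.unique (powE-tuples k (α ⊖ β))))
      same
      where
      -- The first tree of the tuple has type `β`, so the tuple determines its cell.
      same : ∀ {β γ as} → β ∈ below α → γ ∈ below α → as ∈ cell β → as ∈ cell γ → β ≡ γ
      same {β} {γ} β∈ γ∈ p q with ∈-cartesianProductWith⁻ _∷_ (E β) (F (α ⊖ β)) p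
                                | ∈-cartesianProductWith⁻ _∷_ (E γ) (F (α ⊖ γ)) q
      ... | a , _ , a∈ , _ , refl | _ , _ , a∈′ , _ , refl = below-extensional α β∈ γ∈
        λ i → trans (sym (proj₂ (Enumerates.sound (enum β) a∈) i)) (proj₂ (Enumerates.sound (enum γ) a∈′) i)

  timesE-∈⁻ : ∀ i F α {as} → as ∈ timesE i F α → (∃ λ c → coeff α i ≡ suc c) × as ∈ F (decAt i α)
  timesE-∈⁻ i F α as∈ with coeff α i
  ... | suc c = (c , refl) , as∈

  timesE-∈⁺ : ∀ i F α {as c} → coeff α i ≡ suc c → as ∈ F (decAt i α) → as ∈ timesE i F α
  timesE-∈⁺ i F α e as∈ with coeff α i | e
  ... | suc c | _ = as∈

  timesE-unique : ∀ i F α → Unique (F (decAt i α)) → Unique (timesE i F α)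
  timesE-unique i F α u with coeff α i
  ... | zero  = []
  ... | suc _ = u

  coeff-support : ∀ α {i c} → coeff α i ≡ suc c → i < length α
  coeff-support (a ∷ α) {zero}  e = s≤s z≤n
  coeff-support (a ∷ α) {suc i} e = s≤s (coeff-support α e)

  subtrees-injective : ∀ {i k} → subtrees i ≡ subtrees k → i ≡ k
  subtrees-injective e = ℕ.*-cancelˡ-≡ _ _ 2 (ℕ.+-cancelʳ-≡ 3 _ _ e)

  -- Two lists without repetition and with the same elements: `encode` and `decode` pass between a
  -- tree whose root polygon has i + 2 vertices and its subtrees, of total type `decAt i α`.
  -- Different i give tuples of different lengths, so the summands do not overlap.
  codes-↭ : ∀ α → map code (E α) ↭ rhsE E α
  codes-↭ α = unique-↭ (Unique.map⁺ code-injective (Enumerates.unique (enum α))) unique to from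
    where
    cell : ℕ → List Forest⊤
    cell i = timesE i (powE E (subtrees i)) α
    cell-length : ∀ {i as} → as ∈ cell i → length as ≡ subtrees i
    cell-length {i} as∈ = proj₁ (Tuples.sound (powE-tuples (subtrees i) (decAt i α)) (proj₂ (timesE-∈⁻ i (powE E (subtrees i)) α as∈)))
    unique : Unique (rhsE E α)
    unique = Unique.++⁺ (Tuples.unique (oneE-tuples α))
      (concatMap-unique (Unique.upTo⁺ (length α))
        (λ {i} _ → timesE-unique i (powE E (subtrees i)) α (Tuples.unique (powE-tuples (subtrees i) (decAt i α))))
        (λ {i} {k} _ _ p q → subtrees-injective (trans (sym (cell-length {i} p)) (cell-length {k} q))))
      (λ { {as} (p , q) → let i , _ , r = ∈-concatMap {f = cell} (upTo (length α)) q in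
        nonzero i (trans (sym (cell-length {i} r)) (proj₁ (Tuples.sound (oneE-tuples α) p))) })
      where
      nonzero : ∀ i → subtrees i ≢ 0
      nonzero i e with () ← trans (sym (ℕ.+-comm (2 * i) 3)) e
    to : ∀ {as} → as ∈ map code (E α) → as ∈ rhsE E α
    to as∈ with ∈-map⁻ code as∈
    ... | s , s∈ , refl with Enumerates.sound (enum α) s∈
    ... | h with encode s (proj₁ h)
    ... | inj₁ refl = ∈-++⁺ˡ (Tuples.complete (oneE-tuples α) refl h)
    ... | inj₂ (i , l , e) with HasType-∷⁻ {α} {i} (subst (HasType α) e h)
    ... | (c , ec) , h′ = ∈-++⁺ʳ (oneE α) (concatMap-∈ {f = cell} (∈-upTo⁺ (coeff-support α ec))
      (timesE-∈⁺ i (powE E (subtrees i)) α ec (Tuples.complete (powE-tuples (subtrees i) (decAt i α)) l h′)))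
    from : ∀ {as} → as ∈ rhsE E α → as ∈ map code (E α)
    from as∈ with ∈-++⁻ (oneE α) as∈
    from {[]}    _ | inj₁ p = ∈-map⁺ code (Enumerates.complete (enum α) {leaf} (proj₂ (Tuples.sound (oneE-tuples α) p)))
    from {_ ∷ _} _ | inj₁ p with () ← proj₁ (Tuples.sound (oneE-tuples α) p)
    from {as}    _ | inj₂ p with ∈-concatMap {f = cell} (upTo (length α)) p
    ... | i , _ , q with timesE-∈⁻ i (powE E (subtrees i)) α q
    ... | (c , ec) , r with Tuples.sound (powE-tuples (subtrees i) (decAt i α)) r
    ... | l , h with decode i as l
    ... | s , refl , e = ∈-map⁺ code (Enumerates.complete (enum α) (subst (HasType α) (sym e) (HasType-∷⁺ {α} {i} ec h)))

  recursion : ∀ α → H α ≡ rhsCoeff H α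
  recursion α = begin
    H α                       ≡⟨ sym (size≡ α) ⟩
    length (E α)              ≡⟨ sym (length-map code (E α)) ⟩
    length (map code (E α))   ≡⟨ ↭-length (codes-↭ α) ⟩
    length (rhsE E α)         ≡⟨ length-rhsE α ⟩
    rhsCoeff H α              ∎
    where open ≡-Reasoning

-- Signed sums over cacti

boxes≡below : ∀ k b → boxes k b ≡ below (replicate k b)
boxes≡below zero    b = refl
boxes≡below (suc k) b = cong (λ L → concatMap (λ a → map (a ∷_) L) (upTo (suc b))) (boxes≡below k b)

coeff-replicate : ∀ {n b i} → i < n → coeff (replicate n b) i ≡ b
coeff-replicate {suc n} {i = zero}  _       = refl
coeff-replicate {suc n} {i = suc i} (s≤s p) = coeff-replicate {n} p

count-degree : ∀ i ls → suc i * count (suc (suc i)) ls ≤ degreeSum ls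
count-degree i []       = ℕ.≤-reflexive (ℕ.*-zeroʳ (suc i))
count-degree i (j ∷ ls) with suc (suc i) ℕ.≟ j
... | yes refl = subst (_≤ suc i + degreeSum ls)
      (sym (trans (cong (suc i *_) (count-same (suc (suc i)) ls)) (ℕ.*-suc (suc i) (count (suc (suc i)) ls))))
      (ℕ.+-monoʳ-≤ (suc i) (count-degree i ls))
... | no ≢j = subst (λ z → suc i * z ≤ pred j + degreeSum ls) (sym (count-other ls ≢j))
      (ℕ.≤-trans (count-degree i ls) (ℕ.m≤n+m _ (pred j)))

-- The type must fit into the box of `typesOfWeight`: i + 1 times the number of cycles of length i +
-- 2 is at most n, so every entry is at most n and those from position n on vanish.
type-exists : ∀ {n ls} → All (2 ≤_) ls → degreeSum ls ≡ n → ∃ λ α → α ∈ typesOfWeight n × HasType α ls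
type-exists {n} {ls} p refl = α
    , ∈-filter⁺ (λ α → weight α ℕ.≟ n) (subst (α ∈_) (sym (boxes≡below n n)) (restrict-below (replicate n n) g le))
        (sym (HasType-weight {α} ls type))
    , type
  where
  g : ℕ → ℕ
  g i = count (suc (suc i)) ls
  le : ∀ i → g i ≤ coeff (replicate n n) i
  le i with i ℕ.<? n
  ... | yes i<n = subst (g i ≤_) (sym (coeff-replicate i<n))
        (ℕ.≤-trans (ℕ.m≤m+n (g i) (i * g i)) (count-degree i ls))
  ... | no i≮n  = ℕ.≤-trans (ℕ.≤-reflexive (small (g i) (count-degree i ls))) z≤n
    where
    small : ∀ c → suc i * c ≤ n → c ≡ 0
    small zero    _ = refl
    small (suc c) q = ⊥-elim (i≮n (ℕ.≤-trans (ℕ.m≤m*n (suc i) (suc c)) q))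
  α : Ty
  α = restrict (replicate n n) g
  type : HasType α ls
  type = p , λ i → sym (coeff-restrict (replicate n n) g le i)

sum-zero : ∀ α → (∀ i → coeff α i ≡ 0) → size α ≡ 0
sum-zero []      z = refl
sum-zero (a ∷ α) z = cong₂ _+_ (z 0) (sum-zero α (z ∘ suc))

sum-decAt : ∀ α i {c} → coeff α i ≡ suc c → size α ≡ suc (size (decAt i α))
sum-decAt (_ ∷ α) zero    refl = refl
sum-decAt (a ∷ α) (suc i) e    = trans (cong (a +_) (sum-decAt α i e)) (ℕ.+-suc a _)

HasType-size : ∀ {α} ls → HasType α ls → length ls ≡ size α
HasType-size {α} []                 h = sym (sum-zero α (λ i → sym (proj₂ h i)))
HasType-size {α} (suc (suc i) ∷ ls) h with HasType-∷⁻ {α} {i} {ls} h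
... | (c , e) , h′ = trans (cong suc (HasType-size {decAt i α} ls h′)) (sym (sum-decAt α i e))
HasType-size (zero ∷ ls)     ((() ∷ _) , _)
HasType-size (suc zero ∷ ls) ((s≤s () ∷ _) , _)

-- For type α and weight n this is the sign with exponent |α| + n; in this form it is multiplicative
-- under concatenation.
sign : List ℕ → ℤ
sign ls = ℤ.-1ℤ ℤ.^ (length ls + degreeSum ls)

sign-++ : ∀ ls ks → sign (ls ++ ks) ≡ sign ls ℤ.* sign ks
sign-++ ls ks = trans (cong (ℤ.-1ℤ ℤ.^_)
    (trans (cong₂ _+_ (length-++ ls) (degreeSum-++ ls ks))
      (shuffle (length ls) (length ks) (degreeSum ls) (degreeSum ks))))
  (ℤ.^-distribˡ-+-* ℤ.-1ℤ (length ls + degreeSum ls) (length ks + degreeSum ks))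
  where
  shuffle : ∀ a b c d → (a + b) + (c + d) ≡ (a + c) + (b + d)
  shuffle = solve-∀

module _ {A : Set} where

  total : (A → ℤ) → List A → ℤ
  total f xs = foldr ℤ._+_ (pos 0) (map f xs)

  total-++ : ∀ f xs ys → total f (xs ++ ys) ≡ total f xs ℤ.+ total f ys
  total-++ f []       ys = sym (ℤ.+-identityˡ _)
  total-++ f (x ∷ xs) ys = trans (cong (λ z → f x ℤ.+ z) (total-++ f xs ys)) (sym (ℤ.+-assoc (f x) _ _))

  total-cong : ∀ {f g} xs → (∀ {x} → x ∈ xs → f x ≡ g x) → total f xs ≡ total g xs
  total-cong []       e = refl
  total-cong (x ∷ xs) e = cong₂ ℤ._+_ (e (here refl)) (total-cong xs (e ∘ there))

  total-↭ : ∀ {f xs ys} → xs ↭ ys → total f xs ≡ total f ys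
  total-↭ {f} p = PermSetoid.foldr-commMonoid (setoid ℤ) ℤ.+-0-isCommutativeMonoid (Perm.↭⇒↭ₛ (map⁺ f p))

  total-*ˡ : ∀ c f xs → total (λ x → c ℤ.* f x) xs ≡ c ℤ.* total f xs
  total-*ˡ c f []       = sym (ℤ.*-zeroʳ c)
  total-*ˡ c f (x ∷ xs) = trans (cong (λ z → c ℤ.* f x ℤ.+ z) (total-*ˡ c f xs)) (sym (ℤ.*-distribˡ-+ c (f x) _))

  total-const : ∀ {c f} xs → (∀ {x} → x ∈ xs → f x ≡ c) → total f xs ≡ c ℤ.* pos (length xs)
  total-const {c} []       e = sym (ℤ.*-zeroʳ c)
  total-const {c} (x ∷ xs) e = trans (cong₂ ℤ._+_ (e (here refl)) (total-const xs (e ∘ there)))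
    (sym (ℤ.*-suc c (pos (length xs))))

total-map : ∀ {A B : Set} (f : B → ℤ) (g : A → B) xs → total f (map g xs) ≡ total (f ∘ g) xs
total-map f g []       = refl
total-map f g (x ∷ xs) = cong (λ z → f (g x) ℤ.+ z) (total-map f g xs)

total-concatMap : ∀ {A B : Set} (f : B → ℤ) (g : A → List B) xs → total f (concatMap g xs) ≡ total (total f ∘ g) xs
total-concatMap f g []       = refl
total-concatMap f g (x ∷ xs) = trans (total-++ f (g x) _) (cong (λ z → total f (g x) ℤ.+ z) (total-concatMap f g xs))

forestSign : Forest⊤ → ℤ
forestSign as = sign (allSizes as)

total-product : ∀ (S : List (Tree ⊤)) (L : List Forest⊤) →
  total forestSign (cartesianProductWith _∷_ S L) ≡ total (sign ∘ sizes) S ℤ.* total forestSign L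
total-product []      L = refl
total-product (s ∷ S) L = begin
  total forestSign (map (s ∷_) L ++ cartesianProductWith _∷_ S L)
    ≡⟨ total-++ forestSign (map (s ∷_) L) _ ⟩
  total forestSign (map (s ∷_) L) ℤ.+ total forestSign (cartesianProductWith _∷_ S L)
    ≡⟨ cong₂ ℤ._+_ (trans (total-map forestSign (s ∷_) L) (trans
         (total-cong L (λ {as} _ → sign-++ (sizes s) (allSizes as))) (total-*ˡ (sign (sizes s)) forestSign L)))
         (total-product S L) ⟩
  sign (sizes s) ℤ.* total forestSign L ℤ.+ total (sign ∘ sizes) S ℤ.* total forestSign L
    ≡⟨ sym (ℤ.*-distribʳ-+ (total forestSign L) (sign (sizes s)) _) ⟩
  total (sign ∘ sizes) (s ∷ S) ℤ.* total forestSign L ∎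
  where open ≡-Reasoning

-- The Cauchy product. The recursion splits off the constant term of `Y` and shifts the rest, which
-- suits equations of the form Y = Z + t W.
conv : (ℕ → ℤ) → (ℕ → ℤ) → ℕ → ℤ
conv X Y zero    = X 0 ℤ.* Y 0
conv X Y (suc n) = conv X (Y ∘ suc) n ℤ.+ X (suc n) ℤ.* Y 0

convL : (ℕ → List (Tree ⊤)) → (ℕ → List Forest⊤) → ℕ → List Forest⊤
convL S L zero    = cartesianProductWith _∷_ (S 0) (L 0)
convL S L (suc n) = convL S (L ∘ suc) n ++ cartesianProductWith _∷_ (S (suc n)) (L 0)

total-convL : ∀ S L n → total forestSign (convL S L n) ≡ conv (total (sign ∘ sizes) ∘ S) (total forestSign ∘ L) n
total-convL S L zero    = total-product (S 0) (L 0)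
total-convL S L (suc n) = trans (total-++ forestSign (convL S (L ∘ suc) n) _)
  (cong₂ ℤ._+_ (total-convL S (L ∘ suc) n) (total-product (S (suc n)) (L 0)))

convL-∈⁻ : ∀ S L n {as} → as ∈ convL S L n →
           ∃₂ λ m l → ∃₂ λ a as′ → m + l ≡ n × a ∈ S m × as′ ∈ L l × as ≡ a ∷ as′
convL-∈⁻ S L zero    p with ∈-cartesianProductWith⁻ _∷_ (S 0) (L 0) p
... | a , as , a∈ , as∈ , e = 0 , 0 , a , as , refl , a∈ , as∈ , e
convL-∈⁻ S L (suc n) p with ∈-++⁻ (convL S (L ∘ suc) n) p
... | inj₁ q with convL-∈⁻ S (L ∘ suc) n q
...   | m , l , a , as , e , a∈ , as∈ , e′ = m , suc l , a , as , trans (ℕ.+-suc m l) (cong suc e) , a∈ , as∈ , e′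
convL-∈⁻ S L (suc n) p | inj₂ q with ∈-cartesianProductWith⁻ _∷_ (S (suc n)) (L 0) q
...   | a , as , a∈ , as∈ , e = suc n , 0 , a , as , ℕ.+-identityʳ (suc n) , a∈ , as∈ , e

convL-∈⁺ : ∀ S L n m l {a as} → m + l ≡ n → a ∈ S m → as ∈ L l → a ∷ as ∈ convL S L n
convL-∈⁺ S L n       m zero    e p q with trans (sym (ℕ.+-identityʳ m)) e
convL-∈⁺ S L zero    m zero    e p q | refl = ∈-cartesianProductWith⁺ _∷_ p q
convL-∈⁺ S L (suc n) m zero    e p q | refl = ∈-++⁺ʳ (convL S (L ∘ suc) n) (∈-cartesianProductWith⁺ _∷_ p q)
convL-∈⁺ S L zero    m (suc l) e p q with () ← trans (sym (ℕ.+-suc m l)) e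
convL-∈⁺ S L (suc n) m (suc l) e p q =
  ∈-++⁺ˡ (convL-∈⁺ S (L ∘ suc) n m l (ℕ.suc-injective (trans (sym (ℕ.+-suc m l)) e)) p q)

convL-unique : ∀ S L n → (∀ m → Unique (S m)) → (∀ l → Unique (L l)) →
               (∀ {a m m′} → a ∈ S m → a ∈ S m′ → m ≡ m′) → Unique (convL S L n)
convL-unique S L zero    uS uL graded = Unique.cartesianProductWith⁺ _∷_ ∷-injective (uS 0) (uL 0)
convL-unique S L (suc n) uS uL graded = Unique.++⁺ (convL-unique S (L ∘ suc) n uS (uL ∘ suc) graded)
  (Unique.cartesianProductWith⁺ _∷_ ∷-injective (uS (suc n)) (uL 0)) disjoint
  where
  disjoint : Disjoint (convL S (L ∘ suc) n) (cartesianProductWith _∷_ (S (suc n)) (L 0))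
  disjoint (p , q) with convL-∈⁻ S (L ∘ suc) n p | ∈-cartesianProductWith⁻ _∷_ (S (suc n)) (L 0) q
  ... | m , l , _ , _ , e , a∈ , _ , refl | _ , _ , a∈′ , _ , refl =
    ℕ.1+n≰n (ℕ.≤-trans (ℕ.≤-reflexive (sym (graded a∈ a∈′))) (ℕ.≤-trans (ℕ.m≤m+n m l) (ℕ.≤-reflexive e)))

OfWeight : ℕ → List ℕ → Set
OfWeight n ls = All (2 ≤_) ls × degreeSum ls ≡ n

WeightTuples : ℕ → ℕ → List Forest⊤ → Set
WeightTuples k n L = Unique L × (∀ {as} → as ∈ L → length as ≡ k × OfWeight n (allSizes as)) ×
  (∀ {as} → length as ≡ k → OfWeight n (allSizes as) → as ∈ L)

tuplesOf : (ℕ → List (Tree ⊤)) → ℕ → ℕ → List Forest⊤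
tuplesOf S zero    zero    = [ [] ]
tuplesOf S zero    (suc n) = []
tuplesOf S (suc k) n       = convL S (tuplesOf S k) n

-- layers S k n is the disjoint union of tuplesOf S (k + 2 i) (n − i) over i ≤ n.
layers : (ℕ → List (Tree ⊤)) → ℕ → ℕ → List Forest⊤
layers S k zero    = tuplesOf S k zero
layers S k (suc n) = tuplesOf S k (suc n) ++ layers S (2 + k) n

module _ (S : ℕ → List (Tree ⊤)) (enum : ∀ n → Enumerates (OfWeight n ∘ sizes) (S n)) where

  tuplesOf-tuples : ∀ k n → WeightTuples k n (tuplesOf S k n)
  tuplesOf-tuples zero zero    = ([] ∷ []) , (λ { (here refl) → refl , [] , refl }) , λ { {[]} _ _ → here refl }
  tuplesOf-tuples zero (suc n) = [] , (λ ()) , λ { {[]} _ (_ , ()) }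
  tuplesOf-tuples (suc k) n    = unique , sound , complete
    where
    IH = tuplesOf-tuples k
    unique : Unique (tuplesOf S (suc k) n)
    unique = convL-unique S (tuplesOf S k) n (λ m → Enumerates.unique (enum m)) (λ l → proj₁ (IH l))
      (λ {_} {m} {m′} p q → trans (sym (proj₂ (Enumerates.sound (enum m) p))) (proj₂ (Enumerates.sound (enum m′) q)))
    sound : ∀ {as} → as ∈ tuplesOf S (suc k) n → length as ≡ suc k × OfWeight n (allSizes as)
    sound as∈ with convL-∈⁻ S (tuplesOf S k) n as∈
    ... | m , l , a , as , e , a∈ , as∈′ , refl with Enumerates.sound (enum m) a∈ | proj₁ (proj₂ (IH l)) as∈′
    ... | p , d | len , q , d′ = cong suc len , All.++⁺ p q ,
      trans (degreeSum-++ (sizes a) (allSizes as)) (trans (cong₂ _+_ d d′) e)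
    complete : ∀ {as} → length as ≡ suc k → OfWeight n (allSizes as) → as ∈ tuplesOf S (suc k) n
    complete {a ∷ as} len (p , d) =
      convL-∈⁺ S (tuplesOf S k) n (degreeSum (sizes a)) (degreeSum (allSizes as))
        (trans (sym (degreeSum-++ (sizes a) (allSizes as))) d)
        (Enumerates.complete (enum _) (All.++⁻ˡ (sizes a) p , refl))
        (proj₂ (proj₂ (IH _)) (ℕ.suc-injective len) (All.++⁻ʳ (sizes a) p , refl))

  Layer : ℕ → ℕ → Forest⊤ → Set
  Layer k n as = ∃ λ i → length as ≡ 2 * i + k × All (2 ≤_) (allSizes as) × degreeSum (allSizes as) + i ≡ n

  shift-layer : ∀ i k → 2 * i + (2 + k) ≡ 2 * (1 + i) + k
  shift-layer = solve-∀

  layers-sound : ∀ k n {as} → as ∈ layers S k n → Layer k n as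
  layers-sound k zero    p with proj₁ (proj₂ (tuplesOf-tuples k 0)) p
  ... | len , q , d = 0 , len , q , trans (ℕ.+-identityʳ _) d
  layers-sound k (suc n) p with ∈-++⁻ (tuplesOf S k (suc n)) p
  ... | inj₁ p′ with proj₁ (proj₂ (tuplesOf-tuples k (suc n))) p′
  ...   | len , q , d = 0 , len , q , trans (ℕ.+-identityʳ _) d
  layers-sound k (suc n) p | inj₂ p′ with layers-sound (2 + k) n p′
  ...   | i , len , q , d = suc i , trans len (shift-layer i k) , q , trans (ℕ.+-suc _ i) (cong suc d)

  layers-complete : ∀ k n {as} → Layer k n as → as ∈ layers S k n
  layers-complete k zero    (zero  , len , q , d) =
    proj₂ (proj₂ (tuplesOf-tuples k 0)) len (q , trans (sym (ℕ.+-identityʳ _)) d)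
  layers-complete k zero    (suc i , len , q , d) with () ← trans (sym (ℕ.+-suc _ i)) d
  layers-complete k (suc n) (zero  , len , q , d) =
    ∈-++⁺ˡ (proj₂ (proj₂ (tuplesOf-tuples k (suc n))) len (q , trans (sym (ℕ.+-identityʳ _)) d))
  layers-complete k (suc n) (suc i , len , q , d) = ∈-++⁺ʳ (tuplesOf S k (suc n))
    (layers-complete (2 + k) n (i , trans len (sym (shift-layer i k)) , q , ℕ.suc-injective (trans (sym (ℕ.+-suc _ i)) d)))

  layers-unique : ∀ k n → Unique (layers S k n)
  layers-unique k zero    = proj₁ (tuplesOf-tuples k 0)
  layers-unique k (suc n) = Unique.++⁺ (proj₁ (tuplesOf-tuples k (suc n))) (layers-unique (2 + k) n) disjoint
    where
    disjoint : Disjoint (tuplesOf S k (suc n)) (layers S (2 + k) n)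
    disjoint (p , q) with proj₁ (proj₂ (tuplesOf-tuples k (suc n))) p | layers-sound (2 + k) n q
    ... | len , _ | i , len′ , _ = ℕ.m≢1+n+m k {suc (2 * i)} (trans (sym len) (trans len′ (shuffle i k)))
      where
      shuffle : ∀ i k → 2 * i + (2 + k) ≡ 1 + (1 + 2 * i) + k
      shuffle = solve-∀

  -- A root polygon with i + 2 vertices uses up weight i + 1 and leaves 2 i + 3 subtrees of total
  -- weight n - i.
  codes-layers : ∀ n → map code (S (suc n)) ↭ layers S 3 n
  codes-layers n = unique-↭ (Unique.map⁺ code-injective (Enumerates.unique (enum (suc n)))) (layers-unique 3 n) to from
    where
    to : ∀ {as} → as ∈ map code (S (suc n)) → as ∈ layers S 3 n
    to as∈ with ∈-map⁻ code as∈
    ... | s , s∈ , refl with Enumerates.sound (enum (suc n)) s∈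
    ... | p , d with encode s p
    ... | inj₁ refl with () ← d
    to as∈ | s , s∈ , refl | p , d | inj₂ (i , len , e) = layers-complete 3 n (i , len ,
      All.tail (subst (All (2 ≤_)) e p) ,
      trans (ℕ.+-comm _ i) (ℕ.suc-injective (trans (sym (cong degreeSum e)) d)))
    from : ∀ {as} → as ∈ layers S 3 n → as ∈ map code (S (suc n))
    from {as} as∈ with layers-sound 3 n as∈
    ... | i , len , p , d with decode i as len
    ... | s , refl , e = ∈-map⁺ code (Enumerates.complete (enum (suc n))
      (subst (OfWeight (suc n)) (sym e) (s≤s (s≤s z≤n) ∷ p , cong suc (trans (ℕ.+-comm i _) d))))

  A : ℕ → ℤ
  A n = total (sign ∘ sizes) (S n)

  P : ℕ → ℕ → ℤ
  P k n = total forestSign (tuplesOf S k n)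

  P-suc : ∀ k n → P (suc k) n ≡ conv A (P k) n
  P-suc k n = total-convL S (tuplesOf S k) n

  A-zero : A 0 ≡ pos 1
  A-zero = total-↭ (unique-↭ (Enumerates.unique (enum 0)) ([] ∷ []) to from)
    where
    to : ∀ {s} → s ∈ S 0 → s ∈ [ leaf ]
    to {s} s∈ with Enumerates.sound (enum 0) s∈
    ... | p , d with encode s p
    ... | inj₁ refl = here refl
    ... | inj₂ (i , _ , e) with () ← trans (sym (cong degreeSum e)) d
    from : ∀ {s} → s ∈ [ leaf ] → s ∈ S 0
    from (here refl) = Enumerates.complete (enum 0) ([] , refl)

  -- A tuple of 2 i + 3 subtrees receives the sign of its polygon, that is, of the exponent i; the
  -- sign is thus read off the length of the tuple. The value -1 at 1 is chosen to give 1 at 3.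
  parity : ℕ → ℤ
  parity zero          = pos 1
  parity (suc zero)    = ℤ.-1ℤ
  parity (suc (suc k)) = ℤ.- parity k

  parity-subtrees : ∀ i → parity (subtrees i) ≡ ℤ.-1ℤ ℤ.^ i
  parity-subtrees zero    = refl
  parity-subtrees (suc i) = trans (cong parity (sym (shift-layer i 3))) (trans (cong parity (shuffle i))
    (trans (cong ℤ.-_ (parity-subtrees i)) (sym (ℤ.-1*i≡-i _))))
    where
    shuffle : ∀ i → 2 * i + 5 ≡ 2 + (2 * i + 3)
    shuffle = solve-∀

  -- The coefficient of tⁿ in the sum over i of (-t)ⁱ times the power of `A` with exponent k + 2 i,
  -- that is, in the k-th power of `A` divided by 1 + t A².
  alternating : ℕ → ℕ → ℤ
  alternating k zero    = P k zero
  alternating k (suc n) = P k (suc n) ℤ.- alternating (2 + k) n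

  paritySign : Forest⊤ → ℤ
  paritySign as = parity (length as) ℤ.* forestSign as

  total-tuples : ∀ k n → total paritySign (tuplesOf S k n) ≡ parity k ℤ.* P k n
  total-tuples k n = trans
    (total-cong (tuplesOf S k n) λ {as} p →
      cong (λ z → parity z ℤ.* forestSign as) (proj₁ (proj₁ (proj₂ (tuplesOf-tuples k n)) p)))
    (total-*ˡ (parity k) forestSign (tuplesOf S k n))

  total-layers : ∀ k n → total paritySign (layers S k n) ≡ parity k ℤ.* alternating k n
  total-layers k zero    = total-tuples k 0
  total-layers k (suc n) = begin
    total paritySign (tuplesOf S k (suc n) ++ layers S (2 + k) n)
      ≡⟨ total-++ paritySign (tuplesOf S k (suc n)) _ ⟩
    total paritySign (tuplesOf S k (suc n)) ℤ.+ total paritySign (layers S (2 + k) n)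
      ≡⟨ cong₂ ℤ._+_ (total-tuples k (suc n)) (total-layers (2 + k) n) ⟩
    parity k ℤ.* P k (suc n) ℤ.+ ℤ.- parity k ℤ.* alternating (2 + k) n
      ≡⟨ factor (parity k) (P k (suc n)) (alternating (2 + k) n) ⟩
    parity k ℤ.* alternating k (suc n) ∎
    where
    open ≡-Reasoning
    factor : ∀ c x y → c ℤ.* x ℤ.+ ℤ.- c ℤ.* y ≡ c ℤ.* (x ℤ.- y)
    factor = ℤSolver.solve-∀

  A-suc : ∀ n → A (suc n) ≡ alternating 3 n
  A-suc n = begin
    total (sign ∘ sizes) (S (suc n))                ≡⟨ total-cong (S (suc n)) signs ⟩
    total (paritySign ∘ code) (S (suc n))           ≡⟨ sym (total-map paritySign code (S (suc n))) ⟩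
    total paritySign (map code (S (suc n)))         ≡⟨ total-↭ (codes-layers n) ⟩
    total paritySign (layers S 3 n)                 ≡⟨ total-layers 3 n ⟩
    pos 1 ℤ.* alternating 3 n                         ≡⟨ ℤ.*-identityˡ _ ⟩
    alternating 3 n                                 ∎
    where
    open ≡-Reasoning
    signs : ∀ {s} → s ∈ S (suc n) → sign (sizes s) ≡ paritySign (code s)
    signs {s} s∈ with Enumerates.sound (enum (suc n)) s∈
    ... | p , d with encode s p
    ... | inj₁ refl with () ← d
    signs {s} s∈ | p , d | inj₂ (i , len , e) = begin
      sign (sizes s)                                     ≡⟨ cong sign e ⟩
      sign (suc (suc i) ∷ allSizes (code s))             ≡⟨ sign-++ [ suc (suc i) ] (allSizes (code s)) ⟩
      sign [ suc (suc i) ] ℤ.* forestSign (code s)       ≡⟨ cong (ℤ._* forestSign (code s)) one-sign ⟩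
      parity (length (code s)) ℤ.* forestSign (code s)   ∎
      where
      twice : ∀ z → ℤ.-1ℤ ℤ.* (ℤ.-1ℤ ℤ.* z) ≡ z
      twice = ℤSolver.solve-∀
      one-sign : sign [ suc (suc i) ] ≡ parity (length (code s))
      one-sign = trans (cong (λ z → ℤ.-1ℤ ℤ.^ (2 + z)) (ℕ.+-identityʳ i))
        (trans (twice (ℤ.-1ℤ ℤ.^ i)) (trans (sym (parity-subtrees i)) (cong parity (sym len))))

treesOfWeight : (Ty → List (Tree ⊤)) → ℕ → List (Tree ⊤)
treesOfWeight E n = concatMap E (typesOfWeight n)

module _ {H : Ty → ℕ} (E : Ty → List (Tree ⊤)) (size≡ : ∀ α → length (E α) ≡ H α)
         (enum : ∀ α → Enumerates (OfType α) (E α)) where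

  treesOfWeight-enumerates : ∀ n → Enumerates (OfWeight n ∘ sizes) (treesOfWeight E n)
  treesOfWeight-enumerates n = enumerates
    (concatMap-unique (Unique.filter⁺ W? (subst Unique (sym (boxes≡below n n)) (below-unique (replicate n n))))
      (λ {α} _ → Enumerates.unique (enum α))
      (λ {α} {β} α∈ β∈ p q → below-extensional (replicate n n) (box α∈) (box β∈)
        λ i → trans (sym (proj₂ (Enumerates.sound (enum α) p) i)) (proj₂ (Enumerates.sound (enum β) q) i)))
    (λ s∈ → let α , α∈ , p = ∈-concatMap (typesOfWeight n) s∈; h = Enumerates.sound (enum α) p in
      proj₁ h , trans (HasType-weight {α} _ h) (proj₂ (∈-filter⁻ W? {xs = boxes n n} α∈)))
    (λ (p , d) → let α , α∈ , h = type-exists p d in concatMap-∈ α∈ (Enumerates.complete (enum α) h))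
    where
    W? = λ α → weight α ℕ.≟ n
    box : ∀ {α} → α ∈ typesOfWeight n → α ∈ below (replicate n n)
    box {α} α∈ = subst (α ∈_) (boxes≡below n n) (proj₁ (∈-filter⁻ W? {xs = boxes n n} α∈))

  altSum-trees : ∀ n → altSum H n ≡ total (sign ∘ sizes) (treesOfWeight E n)
  altSum-trees n = sym (trans (total-concatMap (sign ∘ sizes) E (typesOfWeight n))
    (total-cong (typesOfWeight n) λ {α} α∈ → trans
      (total-const (E α) λ {s} s∈ → let h = Enumerates.sound (enum α) s∈ in
        cong (ℤ.-1ℤ ℤ.^_) (cong₂ _+_ (HasType-size {α} _ h)
          (trans (HasType-weight {α} _ h) (proj₂ (∈-filter⁻ (λ α → weight α ℕ.≟ n) {xs = boxes n n} α∈)))))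
      (cong (λ z → ℤ.-1ℤ ℤ.^ (size α + n) ℤ.* pos z) (size≡ α))))

open import Data.Nat.Combinatorics using (_C_; nCk≡nC[n∸k]; nCn≡1; nC1≡n; k>n⇒nCk≡0; nCk+nC[k+1]≡[n+1]C[k+1])

-- The Catalan numbers

conv-cong : ∀ X {Y Z} → Y ≗ Z → conv X Y ≗ conv X Z
conv-cong X e zero    = cong (λ z → X 0 ℤ.* z) (e 0)
conv-cong X e (suc n) = cong₂ (λ u v → u ℤ.+ X (suc n) ℤ.* v) (conv-cong X (e ∘ suc) n) (e 0)

conv-+ : ∀ X Y Z n → conv X (λ m → Y m ℤ.+ Z m) n ≡ conv X Y n ℤ.+ conv X Z n
conv-+ X Y Z zero    = ℤ.*-distribˡ-+ (X 0) (Y 0) (Z 0)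
conv-+ X Y Z (suc n) = trans (cong (λ z → z ℤ.+ X (suc n) ℤ.* (Y 0 ℤ.+ Z 0)) (conv-+ X (Y ∘ suc) (Z ∘ suc) n))
  (shuffle (conv X (Y ∘ suc) n) (conv X (Z ∘ suc) n) (X (suc n)) (Y 0) (Z 0))
  where
  shuffle : ∀ a b x y z → (a ℤ.+ b) ℤ.+ x ℤ.* (y ℤ.+ z) ≡ (a ℤ.+ x ℤ.* y) ℤ.+ (b ℤ.+ x ℤ.* z)
  shuffle = ℤSolver.solve-∀

conv-neg : ∀ X Y n → conv X (ℤ.-_ ∘ Y) n ≡ ℤ.- conv X Y n
conv-neg X Y zero    = sym (ℤ.neg-distribʳ-* (X 0) (Y 0))
conv-neg X Y (suc n) = trans (cong (λ z → z ℤ.+ X (suc n) ℤ.* ℤ.- Y 0) (conv-neg X (Y ∘ suc) n))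
  (shuffle (conv X (Y ∘ suc) n) (X (suc n)) (Y 0))
  where
  shuffle : ∀ a x y → ℤ.- a ℤ.+ x ℤ.* ℤ.- y ≡ ℤ.- (a ℤ.+ x ℤ.* y)
  shuffle = ℤSolver.solve-∀

-- Multiplication by A commutes with multiplication by the series variable.
conv-shift : ∀ X {Y Z W} → Y 0 ≡ Z 0 → (∀ n → Y (suc n) ≡ Z (suc n) ℤ.+ W n) →
             ∀ n → conv X Y (suc n) ≡ conv X Z (suc n) ℤ.+ conv X W n
conv-shift X {Y} {Z} {W} e₀ e n = trans
  (cong₂ (λ u v → u ℤ.+ X (suc n) ℤ.* v) (trans (conv-cong X e n) (conv-+ X (Z ∘ suc) W n)) e₀)
  (shuffle (conv X (Z ∘ suc) n) (conv X W n) (X (suc n)) (Z 0))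
  where
  shuffle : ∀ a b x y → (a ℤ.+ b) ℤ.+ x ℤ.* y ≡ (a ℤ.+ x ℤ.* y) ℤ.+ b
  shuffle = ℤSolver.solve-∀

choose-zero : ∀ n → n C 0 ≡ 1
choose-zero n = trans (nCk≡nC[n∸k] {n = n} z≤n) (nCn≡1 n)

-- The absorption identity, by induction with Pascal's rule.
choose-absorb : ∀ n k → suc k * (suc n C suc k) ≡ suc n * (n C k)
choose-absorb n       zero    = begin
  1 * (suc n C 1)     ≡⟨ ℕ.*-identityˡ _ ⟩
  suc n C 1           ≡⟨ nC1≡n (suc n) ⟩
  suc n               ≡⟨ sym (ℕ.*-identityʳ (suc n)) ⟩
  suc n * 1           ≡⟨ cong (suc n *_) (sym (choose-zero n)) ⟩
  suc n * (n C 0)     ∎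
  where open ≡-Reasoning
choose-absorb zero    (suc k) = trans (cong (suc (suc k) *_) (k>n⇒nCk≡0 {1} {suc (suc k)} (s≤s (s≤s z≤n))))
  (trans (ℕ.*-zeroʳ (suc (suc k))) (sym (trans (ℕ.*-identityˡ _) (k>n⇒nCk≡0 {0} {suc k} (s≤s z≤n)))))
choose-absorb (suc n) (suc k) = begin
  suc (suc k) * (suc (suc n) C suc (suc k))
    ≡⟨ cong (suc (suc k) *_) (sym (nCk+nC[k+1]≡[n+1]C[k+1] (suc n) (suc k))) ⟩
  suc (suc k) * (suc n C suc k + suc n C suc (suc k))
    ≡⟨ expand k (suc n C suc k) (suc n C suc (suc k)) ⟩
  suc n C suc k + (suc k * (suc n C suc k) + suc (suc k) * (suc n C suc (suc k)))
    ≡⟨ cong (suc n C suc k +_) (cong₂ _+_ (choose-absorb n k) (choose-absorb n (suc k))) ⟩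
  suc n C suc k + (suc n * (n C k) + suc n * (n C suc k))
    ≡⟨ cong (suc n C suc k +_) (sym (ℕ.*-distribˡ-+ (suc n) (n C k) (n C suc k))) ⟩
  suc n C suc k + suc n * (n C k + n C suc k)
    ≡⟨ cong (λ z → suc n C suc k + suc n * z) (nCk+nC[k+1]≡[n+1]C[k+1] n k) ⟩
  suc (suc n) * (suc n C suc k) ∎
  where
  open ≡-Reasoning
  expand : ∀ k x y → (2 + k) * (x + y) ≡ x + ((1 + k) * x + (2 + k) * y)
  expand = solve-∀

central-symmetry : ∀ n → (suc (2 * n)) C n ≡ (suc (2 * n)) C suc n
central-symmetry n = trans (nCk≡nC[n∸k] (ℕ.≤-trans (ℕ.m≤m+n n (n + 0)) (ℕ.n≤1+n (2 * n))))
  (cong ((suc (2 * n)) C_) (trans (cong (_∸ n) (shuffle n)) (ℕ.m+n∸m≡n n (suc n))))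
  where
  shuffle : ∀ n → 1 + 2 * n ≡ n + (1 + n)
  shuffle = solve-∀

-- The quadratic equation for A and the ballot numbers

module _ (A : ℕ → ℤ) (P : ℕ → ℕ → ℤ) (S : ℕ → ℕ → ℤ)
         (P-zero-zero : P 0 0 ≡ pos 1) (P-zero-suc : ∀ n → P 0 (suc n) ≡ pos 0)
         (P-suc : ∀ k n → P (suc k) n ≡ conv A (P k) n)
         (S-zero : ∀ k → S k 0 ≡ P k 0) (S-suc : ∀ k n → S k (suc n) ≡ P k (suc n) ℤ.- S (2 + k) n)
         (A-zero : A 0 ≡ pos 1) (A-suc : ∀ n → A (suc n) ≡ S 3 n) where

  conv-unit : ∀ X {Y} → Y 0 ≡ pos 1 → (∀ n → Y (suc n) ≡ pos 0) → conv X Y ≗ X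
  conv-unit X e₀ e zero    = trans (cong (λ z → X 0 ℤ.* z) e₀) (ℤ.*-identityʳ (X 0))
  conv-unit X {Y} e₀ e (suc n) = trans
    (cong₂ ℤ._+_ (conv-zero n (Y ∘ suc) e) (trans (cong (λ z → X (suc n) ℤ.* z) e₀) (ℤ.*-identityʳ (X (suc n)))))
    (ℤ.+-identityˡ (X (suc n)))
    where
    conv-zero : ∀ n Z → (∀ m → Z m ≡ pos 0) → conv X Z n ≡ pos 0
    conv-zero zero    Z z = trans (cong (λ y → X 0 ℤ.* y) (z 0)) (ℤ.*-zeroʳ (X 0))
    conv-zero (suc n) Z z = cong₂ ℤ._+_ (conv-zero n (Z ∘ suc) (z ∘ suc))
      (trans (cong (λ y → X (suc n) ℤ.* y) (z 0)) (ℤ.*-zeroʳ (X (suc n))))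

  P-one : P 1 ≗ A
  P-one n = trans (P-suc 0 n) (conv-unit A P-zero-zero P-zero-suc n)

  -- A times the equation that defines `S k` is the equation that defines `S (suc k)`. The induction
  -- on n needs all k at once, since k grows by two whenever n drops by one.
  conv-S : ∀ n k → conv A (S k) n ≡ S (suc k) n
  conv-S zero    k = trans (cong (λ z → A 0 ℤ.* z) (S-zero k)) (trans (sym (P-suc k 0)) (sym (S-zero (suc k))))
  conv-S (suc n) k = begin
    conv A (S k) (suc n)
      ≡⟨ conv-shift A {S k} {P k} {ℤ.-_ ∘ S (2 + k)} (S-zero k) (S-suc k) n ⟩
    conv A (P k) (suc n) ℤ.+ conv A (ℤ.-_ ∘ S (2 + k)) n
      ≡⟨ cong₂ ℤ._+_ (sym (P-suc k (suc n))) (trans (conv-neg A (S (2 + k)) n) (cong ℤ.-_ (conv-S n (2 + k)))) ⟩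
    P (suc k) (suc n) ℤ.- S (3 + k) n
      ≡⟨ sym (S-suc (suc k) n) ⟩
    S (suc k) (suc n) ∎
    where open ≡-Reasoning

  -- Here the equation for A enters: `S 1` is A - t `S 3`, and t `S 3` is A - 1, so everything but
  -- the constant term cancels.
  S-one : S 1 ≗ P 0
  S-one zero    = trans (S-zero 1) (trans (P-one 0) (trans A-zero (sym P-zero-zero)))
  S-one (suc n) = begin
    S 1 (suc n)                  ≡⟨ S-suc 1 n ⟩
    P 1 (suc n) ℤ.- S 3 n        ≡⟨ cong₂ ℤ._-_ (trans (P-one (suc n)) (A-suc n)) refl ⟩
    S 3 n ℤ.- S 3 n              ≡⟨ ℤ.+-inverseʳ (S 3 n) ⟩
    pos 0                        ≡⟨ sym (P-zero-suc n) ⟩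
    P 0 (suc n)                  ∎
    where open ≡-Reasoning

  S-three : S 3 ≗ P 2
  S-three n = begin
    S 3 n            ≡⟨ sym (conv-S n 2) ⟩
    conv A (S 2) n   ≡⟨ conv-cong A (λ m → trans (sym (conv-S m 1)) (trans (conv-cong A S-one m) (sym (P-suc 0 m)))) n ⟩
    conv A (P 1) n   ≡⟨ sym (P-suc 1 n) ⟩
    P 2 n            ∎
    where open ≡-Reasoning

  P-initial : ∀ k → P k 0 ≡ pos 1
  P-initial zero    = P-zero-zero
  P-initial (suc k) = trans (P-suc k 0) (trans (cong₂ ℤ._*_ A-zero (P-initial k)) refl)

  -- The equation A = 1 + t A² multiplied by the k-th power of A and read at exponent n + 1.
  P-pascal : ∀ k n → P (suc k) (suc n) ≡ P k (suc n) ℤ.+ P (2 + k) n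
  P-pascal zero    n = trans (P-one (suc n)) (trans (A-suc n) (trans (S-three n)
    (sym (trans (cong (λ z → z ℤ.+ P 2 n) (P-zero-suc n)) (ℤ.+-identityˡ (P 2 n))))))
  P-pascal (suc k) n = trans (P-suc (suc k) (suc n)) (trans
    (conv-shift A {P (suc k)} {P k} {P (2 + k)} (trans (P-initial (suc k)) (sym (P-initial k))) (P-pascal k) n)
    (cong₂ ℤ._+_ (sym (P-suc k (suc n))) (sym (P-suc (2 + k) n))))

  -- The ballot number is a difference of two binomials; written as a sum, it lets Pascal's rule act
  -- on both against `P-pascal`. The induction is lexicographic, with k allowed to grow by two when
  -- n decreases. At k = 0 the two binomials agree by symmetry.
  ballot : ∀ n k → P k (suc n) ℤ.+ pos (suc (2 * n + k) C n) ≡ pos (suc (2 * n + k) C suc n)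
  ballot n zero = trans (cong (λ z → z ℤ.+ pos (suc (2 * n + 0) C n)) (P-zero-suc n)) (trans (ℤ.+-identityˡ _)
    (cong pos (subst (λ m → suc m C n ≡ suc m C suc n) (sym (ℕ.+-identityʳ (2 * n))) (central-symmetry n))))
  ballot zero (suc k) = begin
    P (suc k) 1 ℤ.+ pos (suc (suc k) C 0)
      ≡⟨ cong₂ ℤ._+_ (trans (P-pascal k 0) (cong (λ z → P k 1 ℤ.+ z) (P-initial (2 + k)))) (cong pos (choose-zero (2 + k))) ⟩
    (P k 1 ℤ.+ pos 1) ℤ.+ pos 1
      ≡⟨ swap-ends (P k 1) (pos 1) (pos 1) ⟩
    pos 1 ℤ.+ (P k 1 ℤ.+ pos 1)
      ≡⟨ cong₂ ℤ._+_ (cong pos (sym (choose-zero (suc k))))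
           (trans (cong (λ z → P k 1 ℤ.+ pos z) (sym (choose-zero (suc k)))) (ballot zero k)) ⟩
    pos (suc k C 0) ℤ.+ pos (suc k C 1)
      ≡⟨ sym (ℤ.pos-+ (suc k C 0) (suc k C 1)) ⟩
    pos (suc k C 0 + suc k C 1)
      ≡⟨ cong pos (nCk+nC[k+1]≡[n+1]C[k+1] (suc k) 0) ⟩
    pos (suc (suc k) C 1) ∎
    where
    open ≡-Reasoning
    swap-ends : ∀ x y z → (x ℤ.+ y) ℤ.+ z ≡ z ℤ.+ (x ℤ.+ y)
    swap-ends = ℤSolver.solve-∀
  ballot (suc n) (suc k) = begin
    P (suc k) (2 + n) ℤ.+ pos (suc (2 * suc n + suc k) C suc n)
      ≡⟨ cong₂ ℤ._+_ (P-pascal k (suc n)) (trans (cong (λ z → pos (suc z C suc n)) (ℕ.+-suc (2 * suc n) k))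
           (trans (cong pos (sym (nCk+nC[k+1]≡[n+1]C[k+1] m n))) (ℤ.pos-+ (m C n) (m C suc n)))) ⟩
    (P k (2 + n) ℤ.+ P (2 + k) (suc n)) ℤ.+ (pos (m C n) ℤ.+ pos (m C suc n))
      ≡⟨ regroup (P k (2 + n)) (P (2 + k) (suc n)) (pos (m C n)) (pos (m C suc n)) ⟩
    (P (2 + k) (suc n) ℤ.+ pos (m C n)) ℤ.+ (P k (2 + n) ℤ.+ pos (m C suc n))
      ≡⟨ cong₂ ℤ._+_ (subst (λ z → P (2 + k) (suc n) ℤ.+ pos (suc z C n) ≡ pos (suc z C suc n)) (index-shift n k) (ballot n (2 + k)))
           (ballot (suc n) k) ⟩
    pos (m C suc n) ℤ.+ pos (m C suc (suc n))
      ≡⟨ sym (ℤ.pos-+ (m C suc n) (m C suc (suc n))) ⟩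
    pos (m C suc n + m C suc (suc n))
      ≡⟨ cong pos (nCk+nC[k+1]≡[n+1]C[k+1] m (suc n)) ⟩
    pos (suc m C suc (suc n))
      ≡⟨ cong (λ z → pos (suc z C suc (suc n))) (sym (ℕ.+-suc (2 * suc n) k)) ⟩
    pos (suc (2 * suc n + suc k) C suc (suc n)) ∎
    where
    open ≡-Reasoning
    m : ℕ
    m = suc (2 * suc n + k)
    index-shift : ∀ n k → 2 * n + (2 + k) ≡ 2 * (1 + n) + k
    index-shift = solve-∀
    regroup : ∀ a b c d → (a ℤ.+ b) ℤ.+ (c ℤ.+ d) ≡ (b ℤ.+ c) ℤ.+ (a ℤ.+ d)
    regroup = ℤSolver.solve-∀

  A≡catalan : ∀ n → A n ≡ pos (catalan n)
  A≡catalan zero    = A-zero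
  A≡catalan (suc n) = begin
    A (suc n)                            ≡⟨ sym (P-one (suc n)) ⟩
    P 1 (suc n)                          ≡⟨ cancel (P 1 (suc n)) (pos d) ⟩
    (P 1 (suc n) ℤ.+ pos d) ℤ.- pos d    ≡⟨ cong (λ z → z ℤ.- pos d) ballot′ ⟩
    pos c ℤ.- pos d                      ≡⟨ ℤ.m-n≡m⊖n c d ⟩
    c ℤ.⊖ d                              ≡⟨ ℤ.⊖-≥ d≤c ⟩
    pos (c ∸ d)                          ≡⟨ cong pos (sym quotient) ⟩
    pos (catalan (suc n))                ∎
    where
    open ≡-Reasoning
    M c d : ℕ
    M = suc n
    c = (2 * M) C M
    d = (2 * M) C n
    cancel : ∀ x y → x ≡ (x ℤ.+ y) ℤ.- y
    cancel = ℤSolver.solve-∀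
    double : 2 * M ≡ suc (2 * n + 1)
    double = shuffle n
      where
      shuffle : ∀ n → 2 * (1 + n) ≡ 1 + (2 * n + 1)
      shuffle = solve-∀
    double′ : 2 * M ≡ suc (suc (2 * n))
    double′ = trans double (cong suc (ℕ.+-comm (2 * n) 1))
    ballot′ : P 1 (suc n) ℤ.+ pos d ≡ pos c
    ballot′ = subst (λ z → P 1 (suc n) ℤ.+ pos (z C n) ≡ pos (z C M)) (sym double) (ballot n 1)
    reflect : d ≡ (2 * M) C suc M
    reflect = trans (nCk≡nC[n∸k] (ℕ.≤-trans (ℕ.n≤1+n n) (ℕ.m≤m+n M (M + 0))))
      (cong ((2 * M) C_) (trans (cong (_∸ n) (shuffle n)) (ℕ.m+n∸m≡n n (2 + n))))
      where
      shuffle : ∀ n → 2 * (1 + n) ≡ n + (2 + n)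
      shuffle = solve-∀
    -- Absorb, reflect, absorb back: both sides equal 2 M times the binomial coefficient of 2 M - 1
    -- over n.
    balance : suc M * d ≡ M * c
    balance = begin
      suc M * d                             ≡⟨ cong (suc M *_) (trans reflect (cong (_C suc M) double′)) ⟩
      suc M * (suc (suc (2 * n)) C suc M)   ≡⟨ choose-absorb (suc (2 * n)) M ⟩
      suc (suc (2 * n)) * (suc (2 * n) C M) ≡⟨ cong (suc (suc (2 * n)) *_) (sym (central-symmetry n)) ⟩
      suc (suc (2 * n)) * (suc (2 * n) C n) ≡⟨ sym (choose-absorb (suc (2 * n)) n) ⟩
      M * (suc (suc (2 * n)) C M)           ≡⟨ cong (λ z → M * (z C M)) (sym double′) ⟩
      M * c                                 ∎
    d≤c : d ≤ c
    d≤c = ℕ.*-cancelˡ-≤ M (ℕ.≤-trans (ℕ.m≤n+m (M * d) d) (ℕ.≤-reflexive balance))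
    -- By `balance`, (M + 1)(c - d) is (M + 1) c - M c, so the division in `catalan` is exact.
    difference : c ≡ (c ∸ d) * suc M
    difference = sym (begin
      (c ∸ d) * suc M            ≡⟨ ℕ.*-distribʳ-∸ (suc M) c d ⟩
      c * suc M ∸ d * suc M      ≡⟨ cong₂ _∸_ (ℕ.*-comm c (suc M)) (trans (ℕ.*-comm d (suc M)) balance) ⟩
      (c + M * c) ∸ M * c        ≡⟨ ℕ.m+n∸n≡m c (M * c) ⟩
      c                          ∎)
    quotient : catalan (suc n) ≡ c ∸ d
    quotient = trans (cong (_/ suc M) difference) (m*n/n≡m (c ∸ d) (suc M))

open import Data.Integer using (+_)

theorem2 : (H : Ty → ℕ) → (∀ α → ClassCount α (H α)) →
    (∀ α → H α ≡ rhsCoeff H α) × (∀ n → altSum H n ≡ + catalan n)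
theorem2 H classes = recursion E size≡ enum , λ n → trans (altSum-trees E size≡ enum n)
  (A≡catalan (A S trees) (P S trees) (alternating S trees) refl (λ _ → refl) (P-suc S trees)
    (λ _ → refl) (λ _ _ → refl) (A-zero S trees) (A-suc S trees) n)
  where
  E : Ty → List (Tree ⊤)
  E α = proj₁ (classes⇒shapes {α} (classes α))
  size≡ : ∀ α → length (E α) ≡ H α
  size≡ α = proj₁ (proj₂ (classes⇒shapes {α} (classes α)))
  enum : ∀ α → Enumerates (OfType α) (E α)
  enum α = proj₂ (proj₂ (classes⇒shapes {α} (classes α)))
  S : ℕ → List (Tree ⊤)
  S = treesOfWeight E
  trees : ∀ n → Enumerates (OfWeight n ∘ sizes) (S n)
  trees = treesOfWeight-enumerates E size≡ enum
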